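{- Let $r\ge 1$ and let $T$ be an $r$-row rectangular (non-skew) fluctuating tableau of type $(c_1,\ldots,c_n)$, and set $t=|c_1|+\cdots+|c_n|$. Let $\sigma\in\mathfrak S_t$ be the long cycle $\sigma(x)=x+1$ for $x<t$, $\sigma(t)=1$, and let $w_0\in\mathfrak S_t$ be $w_0(x)=t+1-x$. Then for all $0\le i\le r$: (i) $\mathrm{prom}_i(T)$ is a permutation of $[t]$; (ii) $\mathrm{prom}_i(T)=\mathrm{prom}_{r-i}(T)^{ -1}$; (iii) $\mathrm{prom}_i(\mathcal P(T))=\sigma^{ -|c_1|}\circ\mathrm{prom}_i(T)\circ\sigma^{|c_1|}$; (iv) $\mathrm{prom}_i(\mathcal E(T))=w_0\circ\mathrm{prom}_{r-i}(T)\circ w_0$. (Maps are composed right to left.)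
   Context: An $r$-row generalized partition is $\lambda=(\lambda_1,\ldots,\lambda_r)\in\mathbb Z^r$ with $\lambda_1\ge\cdots\ge\lambda_r$. Let $\mathcal A_r$ be the set of subsets $S\subseteq\{\pm1,\ldots,\pm r\}$ all of whose elements have the same sign (including $\emptyset$). For $S\in\mathcal A_r$ put $\mathbf e_S=\sum_{s\in S}\mathbf e_s$ if $S\subseteq\{1,\ldots,r\}$ and $\mathbf e_S=-\sum_{s\in S}\mathbf e_{ -s}$ if $S\subseteq\{ -1,\ldots,-r\}$, where $\mathbf e_1,\dots,\mathbf e_r$ is the standard basis of $\mathbb Z^r$. An $r$-row fluctuating tableau of length $n$ is a sequence $T=(\lambda^0,\ldots,\lambda^n)$ of $r$-row generalized partitions with $\lambda^k=\lambda^{k-1}+\mathbf e_{S_k}$ for some $S_k\in\mathcal A_r$; its type is $(c_1,\ldots,c_n)$ with $c_k=|S_k|$ if $S_k$ consists of positive numbers and $c_k=-|S_k|$ otherwise. It is non-skew if $\lambda^0=(0,\ldots,0)$; it is rectangular if moreover $\lambda^n_1=\cdots=\lambda^n_r$. It has oscillating type if every $c_k\in\{\pm1\}$. For $\alpha\in\mathbb Z^r$, $\mathrm{sort}(\alpha)$ is its weakly decreasing rearrangement. The promotion–evacuation diagram of $T=(\lambda^0,\ldots,\lambda^n)$ is the family $(\lambda^{i,j})_{0\le i\le n,\ i\le j\le n+i}$ with $\lambda^{0,j}=\lambda^j$, $\lambda^{i,i}=\lambda^0$, $\lambda^{i,n+i}=\lambda^n$ ($1\le i\le n$), and, for $1\le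 i\le n$ and $i<j<n+i$ (in order of increasing $i$, then increasing $j$), $\lambda^{i,j}=\mathrm{sort}(\lambda^{i-1,j}+\lambda^{i,j-1}-\lambda^{i-1,j-1})$. Promotion is $\mathcal P(T)=(\lambda^{1,1},\lambda^{1,2},\ldots,\lambda^{1,n+1})$ (a fluctuating tableau of type $(c_2,\ldots,c_n,c_1)$) and evacuation is $\mathcal E(T)=(\lambda^{n,n},\lambda^{n-1,n},\ldots,\lambda^{0,n})$. Oscillization: $\mathrm{std}(T)$ replaces each step $\lambda^{k-1}\to\lambda^k$ with $S_k=\{s_1<\cdots<s_m\}$ (increasing as integers) by the $m$ single-cell steps $\lambda^{k-1}+\mathbf e_{\{s_1\}},\ \lambda^{k-1}+\mathbf e_{\{s_1\}}+\mathbf e_{\{s_2\}},\ldots,\lambda^k$ (steps with $S_k=\emptyset$ are deleted); it is a fluctuating tableau of oscillating type and length $t=\sum|c_k|$. Promotion functions. Let $T$ be non-skew of oscillating type and length $t$ with promotion–evacuation diagram $(\lambda^{i,j})$. For $u\ne v$ in $[t]$ let $j=v$ if $u<v$ and $j=v+t$ if $u>v$, and define $a,b\in\{\pm1,\ldots,\pm r\}$ by $\lambda^{u-1,j-1}=\lambda^{u,j-1}+\mathbf e_{\{a\}}$ and $\lambda^{u-1,j}=\lambda^{u,j}+\mathbf e_{\{b\}}$ ($a,b$ have the same sign). Set $M_{uv}=\{i:a\le i<b\}$ if $a,b>0$, $M_{uv}=\{i:|b|\le i<|a|\}$ if $a,b<0$, and $M_{uu}=\{0\}$. (This is the paper's promotion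 matrix of $T$.) For $0\le i\le r-1$, $\mathrm{prom}_i(T)$ is the partial function $[t]\rightharpoonup[t]$ with $\mathrm{prom}_i(T)(u)=v$ iff $i\in M_{uv}$ (for each $u$ there is at most one such $v$), and $\mathrm{prom}_r(T):=\mathrm{prom}_0(T)$. For a general non-skew $T$, $\mathrm{prom}_i(T):=\mathrm{prom}_i(\mathrm{std}(T))$, a partial function on $[t]$, $t=\sum_k|c_k|$. -}

module Defs where

open import Data.Bool using (Bool; true; false; if_then_else_)
open import Data.Nat as ℕ using (ℕ; zero; suc; _≤_; _<_; _∸_; _≡ᵇ_; _<ᵇ_; _%_)
open import Data.Integer as ℤ using (ℤ; +_; -[1+_]; ∣_∣; _≥_)
open import Data.List using (List; []; _∷_; _++_; [_]; zipWith; replicate; upTo;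
  drop; reverse; concatMap; zip; map; length; foldr)
open import Data.List.Relation.Unary.All using (All)
open import Data.List.Relation.Unary.Linked using (Linked)
open import Data.Product using (Σ; _×_; ∃)
open import Data.Sum using (_⊎_)
open import Relation.Binary.PropositionalEquality using (_≡_; _≢_)
import Data.Integer.Properties as ℤP
import Data.List.Sort.MergeSort.Base as MS

-- r-row generalized partitions ("shapes") are lists of integers
-- (of length r, weakly decreasing).

Shape : Set
Shape = List ℤ

zeros : ℕ → Shape
zeros r = replicate r (+ 0)

_⊕_ : Shape → Shape → Shape
_⊕_ = zipWith ℤ._+_

_⊖_ : Shape → Shape → Shape
_⊖_ = zipWith ℤ._-_

Decreasing : Shape → Set
Decreasing = Linked _≥_

sortDesc : Shape → Shape
sortDesc α = reverse (MS.sort ℤP.≤-decTotalOrder α)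

-- e_{{a}} for a ∈ {±1,…,±r} (a signed integer); e_{{+k}} = e_k, e_{{-k}} = -e_k.
e : ℕ → ℤ → Shape
e r (+ k)      = map (λ p → if suc p ≡ᵇ k then + 1 else + 0) (upTo r)
e r -[1+ m ]   = map (λ p → if p ≡ᵇ m then -[1+ 0 ] else + 0) (upTo r)

-- Fluctuating tableaux: a tableau T = (λ⁰,…,λⁿ) is the list of its shapes.

-- the difference vector is e_S for some S ∈ 𝒜_r (all entries in {0,1}, or all in {0,-1})
ValidStep : Shape → Set
ValidStep d = All (λ x → x ≡ + 0 ⊎ x ≡ + 1) d ⊎ All (λ x → x ≡ + 0 ⊎ x ≡ -[1+ 0 ]) d

IsFluctuatingTableau : ℕ → List Shape → Set
IsFluctuatingTableau r T =
  All (λ μ → length μ ≡ r × Decreasing μ) T × Linked (λ α β → ValidStep (β ⊖ α)) T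

NonSkew : ℕ → List Shape → Set
NonSkew r T = Σ (List Shape) λ rest → T ≡ zeros r ∷ rest

lastOr : Shape → List Shape → Shape
lastOr d []       = d
lastOr d (x ∷ xs) = lastOr x xs

Rectangular : ℕ → List Shape → Set
Rectangular r T = NonSkew r T × Linked _≡_ (lastOr (zeros r) T)

at : List Shape → ℕ → Shape
at []       _       = []
at (x ∷ _)  zero    = x
at (_ ∷ xs) (suc k) = at xs k

headOr : List Shape → Shape
headOr []      = []
headOr (x ∷ _) = x

sumℤ : List ℤ → ℤ
sumℤ = foldr ℤ._+_ (+ 0)

typeOf : List Shape → List ℤ
typeOf []           = []
typeOf (_ ∷ [])     = []
typeOf (x ∷ y ∷ xs) = sumℤ (y ⊖ x) ∷ typeOf (y ∷ xs)

size : List Shape → ℕ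
size T = foldr (λ c s → ∣ c ∣ ℕ.+ s) 0 (typeOf T)

absC1 : List Shape → ℕ
absC1 T = ∣ sumℤ (at T 1 ⊖ at T 0) ∣

-- Promotion–evacuation diagram. Row i is (λ^{i,i}, λ^{i,i+1}, …, λ^{i,n+i}).

-- given q_{k-1} and (p_k, p_{k+1}, …, p_n) (row i-1), produce q_k, …, q_{n-1}
rowAux : Shape → List Shape → List Shape
rowAux q (a ∷ b ∷ rest) = let q′ = sortDesc ((b ⊕ q) ⊖ a) in q′ ∷ rowAux q′ (b ∷ rest)
rowAux q _              = []

nextRow : Shape → Shape → List Shape → List Shape
nextRow λ₀ λₙ prev = λ₀ ∷ rowAux λ₀ (drop 1 prev) ++ [ λₙ ]

row : List Shape → ℕ → List Shape
row T zero    = T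
row T (suc i) = nextRow (headOr T) (lastOr [] T) (row T i)

diag : List Shape → ℕ → ℕ → Shape
diag T i j = at (row T i) (j ∸ i)

promotion : List Shape → List Shape
promotion T = row T 1

evacuation : List Shape → List Shape
evacuation T = reverse (map (λ i → diag T i n) (upTo (suc n)))
  where n = length T ∸ 1

indexed : Shape → List (ℕ × ℤ)
indexed d = zip (upTo (length d)) d

-- S_k = {s_1 < ⋯ < s_m} as signed integers, in increasing order
singles : Shape → List ℤ
singles d =
  concatMap (λ { (p Data.Product., + suc _) → [ + suc p ] ; _ → [] }) (indexed d)
  ++ reverse (concatMap (λ { (p Data.Product., -[1+ _ ]) → [ -[1+ p ] ] ; _ → [] }) (indexed d))

expand : ℕ → Shape → List ℤ → List Shape
expand r cur []       = []
expand r cur (a ∷ as) = (cur ⊕ e r a) ∷ expand r (cur ⊕ e r a) as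

stdAux : ℕ → Shape → List Shape → List Shape
stdAux r cur []         = []
stdAux r cur (nx ∷ rest) = expand r cur (singles (nx ⊖ cur)) ++ stdAux r nx rest

std : ℕ → List Shape → List Shape
std r []         = []
std r (λ₀ ∷ rest) = λ₀ ∷ stdAux r λ₀ rest

-- Promotion matrix / promotion functions (as graphs of partial functions on ℕ,
-- supported in [t] × [t]).

InT : ℕ → ℕ → Set
InT t x = 1 ≤ x × x ≤ t

data InM : ℤ → ℤ → ℕ → Set where
  pos : ∀ {a b i} → a ≤ i → i < b → InM (+ a) (+ b) i
  neg : ∀ {a′ b′ i} → suc b′ ≤ i → i < suc a′ → InM -[1+ a′ ] -[1+ b′ ] i

Letter : ℕ → ℤ → Set
Letter r a = 1 ≤ ∣ a ∣ × ∣ a ∣ ≤ r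

jOf : ℕ → ℕ → ℕ → ℕ
jOf t u v = if u <ᵇ v then v else v ℕ.+ t

-- prom_i for T of oscillating type, 0 ≤ i ≤ r-1: PromOsc r T i u v  ⟺  prom_i(T)(u) = v
PromOsc : ℕ → List Shape → ℕ → ℕ → ℕ → Set
PromOsc r T i u v =
  InT t u × InT t v ×
  ((u ≡ v × i ≡ 0) ⊎
   (u ≢ v × Σ ℤ λ a → Σ ℤ λ b →
      Letter r a × Letter r b ×
      diag T (u ∸ 1) (j ∸ 1) ≡ diag T u (j ∸ 1) ⊕ e r a ×
      diag T (u ∸ 1) j ≡ diag T u j ⊕ e r b ×
      InM a b i))
  where
    t = length T ∸ 1
    j = jOf t u v

Prom : ℕ → List Shape → ℕ → ℕ → ℕ → Set
Prom r T i = PromOsc r (std r T) (if i ≡ᵇ r then 0 else i)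

IsPermutation : ℕ → (ℕ → ℕ → Set) → Set
IsPermutation t R =
  (∀ u v → R u v → InT t u × InT t v) ×
  (∀ u → InT t u → ∃ λ v → R u v) ×
  (∀ u v v′ → R u v → R u v′ → v ≡ v′) ×
  (∀ u u′ v → R u v → R u′ v → u ≡ u′) ×
  (∀ v → InT t v → ∃ λ u → R u v)

σpow : ℕ → ℕ → ℕ → ℕ
σpow zero    c x = x
σpow (suc t) c x = suc (((x ∸ 1) ℕ.+ c) % suc t)

w₀ : ℕ → ℕ → ℕ
w₀ t x = suc t ∸ x

{-# OPTIONS --safe #-}
module Submission where

-- In the diagram of an oscillating tableau every cell either repeats its letters or bends: a row
-- strip crossing the cell from lo to hi forces the column strip to do the same, and the bends are
-- the entries of the promotion matrix.  The letters of a row strip run through all rows, so each i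
-- labels exactly one bend of the strip.
--
-- Everything else rests on λ^{j,n+i} being the complement of λ^{i,j}.  Fix a rectangle of cells
-- whose lower left corner is the zero shape, and let a set of m rows move along a row of the
-- rectangle, only ever towards smaller rows, collecting the increments of the rows it occupies.
-- Deleting the row strip above never decreases what can be collected (at a bend, exchange hi
-- for lo), and on the lowest row one can collect at most the sum of the first m entries of the lower
-- right corner.  If the upper right corner is rectangular, this inequality for the last m rows and
-- its transpose for the last r - m rows pinch the partial sums of the lower right corner.
--
-- Complementing and transposing a cell turns the label i into r - i.  This gives (ii), the
-- periodicity of the diagram needed for (iii), and the half turn of the diagram behind (iv).
-- A block of cells with ascending sides computes the local rule of the fluctuating
-- tableau, hence oscillization commutes with promotion and evacuation.

open import Defs
open import Data.Bool using (true; false; if_then_else_; T)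
open import Data.Empty using (⊥; ⊥-elim)
open import Data.Integer as ℤ using (ℤ; +_; -[1+_]; 0ℤ; 1ℤ; _+_; _-_; -_; _*_)
import Data.Integer.Properties as ℤP
open import Data.Integer.Tactic.RingSolver using (solve-∀)
open import Data.List using (List; []; _∷_; _++_; [_]; length; map; reverse; replicate; upTo; applyUpTo; zipWith; zip; concatMap)
import Data.List.Properties as ListP
open import Data.List.Relation.Binary.Permutation.Propositional using (_↭_; ↭-trans)
import Data.List.Relation.Binary.Permutation.Propositional as Perm
open import Data.List.Relation.Binary.Permutation.Propositional.Properties using (↭-length; ↭-reverse)
open import Data.List.Relation.Unary.All using (All; []; _∷_)
open import Data.List.Relation.Unary.Linked using (Linked; []; [-]; _∷_)
import Data.List.Sort.MergeSort.Base as MS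
import Data.List.Sort.MergeSort.Properties as MSP
open import Data.Nat as ℕ using (ℕ; zero; suc; _≤_; _<_; _∸_; z≤n; s≤s)
open import Data.Nat.DivMod using (_%_; _/_; m%n<n; m<n⇒m%n≡m; [m+n]%n≡m%n; [m+kn]%n≡m%n; %-distribˡ-+; m%n%n≡m%n; m≡m%n+[m/n]*n)
import Data.Nat.Properties as ℕP
import Data.Nat.Tactic.RingSolver as ℕSolver
open import Data.Product using (Σ; ∃; _×_; _,_; proj₁; proj₂)
open import Data.Sum using (_⊎_; inj₁; inj₂)
open import Data.Unit using (tt)
open import Function using (_∘_)
open import Function.Bundles using (_⇔_; mk⇔)
open import Relation.Binary using (tri<; tri≈; tri>)
open import Relation.Binary.PropositionalEquality using (_≡_; _≢_; refl; sym; trans; cong; cong₂; subst; subst₂)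
open import Relation.Nullary using (Dec; yes; no; ¬_)

-- Sorting is never computed. A decreasing shape is determined by the multiset of its entries, and
-- multisets are compared through the sums of all functions of the entries; so every use of the
-- local rule amounts to exhibiting a decreasing shape with the right multiset.
--
-- The obstacle is that complementarity is no property of a single cell, where letters only stay or
-- bend, but of a whole rectangle with the zero shape and a rectangular shape in opposite corners.
-- Before the rectangle is complete an induction over cells has no complement to speak about; what
-- survives the removal of one strip is an inequality about moving sets of rows.
--
-- For fluctuating tableaux, `std` is not followed through promotion: a refinement into ascending
-- unit steps is unique, so it is enough to find one for the promoted tableau. Its last block lies
-- outside the blocks of cells that give the others and is supplied by complementation.
--
-- Rows are counted from 0 and letters from 1, so an interval from `a` to `b - 1` of the promotion
-- matrix reads `lo < i` and `i ≤ hi`.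

≤-by : ∀ {u v x y} → u ℤ.≤ v → v - u ≡ y - x → x ℤ.≤ y
≤-by u≤v eq = ℤP.0≤i-j⇒j≤i (subst (0ℤ ℤ.≤_) eq (ℤP.i≤j⇒0≤j-i u≤v))

≤-by₂ : ∀ {u v u′ v′ x y} → u ℤ.≤ v → u′ ℤ.≤ v′ → (v + v′) - (u + u′) ≡ y - x → x ℤ.≤ y
≤-by₂ p q = ≤-by (ℤP.+-mono-≤ p q)

1+≰ : ∀ {x} → ¬ (x + 1ℤ ℤ.≤ x)
1+≰ {x} p with ≤-by {x = 1ℤ} {0ℤ} p (lem x)
  where
  lem : ∀ x → x - (x + 1ℤ) ≡ 0ℤ - 1ℤ
  lem = solve-∀
... | ℤ.+≤+ ()

x+y-x≡y : ∀ x y → x + y - x ≡ y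
x+y-x≡y = solve-∀

x+y-y≡x : ∀ x y → x + y - y ≡ x
x+y-y≡x = solve-∀

+-cancelˡ : ∀ x {y z} → x + y ≡ x + z → y ≡ z
+-cancelˡ x {y} {z} eq = trans (sym (x+y-x≡y x y)) (trans (cong (_- x) eq) (x+y-x≡y x z))

-- Signs, unit vectors and the filling order

data Sgn : Set where
  ⊞ ⊟ : Sgn

δ : ℕ → ℕ → ℤ
δ zero    zero    = 1ℤ
δ zero    (suc p) = 0ℤ
δ (suc a) zero    = 0ℤ
δ (suc a) (suc p) = δ a p

δ-≡ : ∀ a → δ a a ≡ 1ℤ
δ-≡ zero    = refl
δ-≡ (suc a) = δ-≡ a

δ-≢ : ∀ {a p} → a ≢ p → δ a p ≡ 0ℤ
δ-≢ {zero}  {zero}  a≢p = ⊥-elim (a≢p refl)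
δ-≢ {zero}  {suc p} a≢p = refl
δ-≢ {suc a} {zero}  a≢p = refl
δ-≢ {suc a} {suc p} a≢p = δ-≢ (λ e → a≢p (cong suc e))

unit : Sgn → ℕ → ℕ → ℤ
unit ⊞ a p = δ a p
unit ⊟ a p = - δ a p

unit-≢ : ∀ ε {a p} → a ≢ p → unit ε a p ≡ 0ℤ
unit-≢ ⊞ a≢p = δ-≢ a≢p
unit-≢ ⊟ a≢p = cong -_ (δ-≢ a≢p)

-- The rows before and after a bend: an added cell slides from `lo` to `hi`, a removed one from `hi`
-- to `lo`, in both cases forward in the filling order.
src tgt : Sgn → ℕ → ℕ → ℕ
src ⊞ lo hi = lo
src ⊟ lo hi = hi
tgt ⊞ lo hi = hi
tgt ⊟ lo hi = lo

-- The change made by a bend does not depend on the sign; this is why strips of different signs can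
-- bend in the same cell.
unit-src-tgt : ∀ ε lo hi p → unit ε (src ε lo hi) p - unit ε (tgt ε lo hi) p ≡ δ lo p - δ hi p
unit-src-tgt ⊞ lo hi p = refl
unit-src-tgt ⊟ lo hi p = lem (δ lo p) (δ hi p)
  where
  lem : ∀ x y → - y - - x ≡ x - y
  lem = solve-∀

-- The order in which the cells of a step are filled: downwards when cells are added,
-- upwards when they are removed.
Le Lt : Sgn → ℕ → ℕ → Set
Le ⊞ a b = a ≤ b
Le ⊟ a b = b ≤ a
Lt ⊞ a b = a < b
Lt ⊟ a b = b < a

Le-refl : ∀ ε {a} → Le ε a a
Le-refl ⊞ = ℕP.≤-refl
Le-refl ⊟ = ℕP.≤-refl

Le-trans : ∀ ε {a b c} → Le ε a b → Le ε b c → Le ε a c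
Le-trans ⊞ p q = ℕP.≤-trans p q
Le-trans ⊟ p q = ℕP.≤-trans q p

Lt⇒Le : ∀ ε {a b} → Lt ε a b → Le ε a b
Lt⇒Le ⊞ = ℕP.<⇒≤
Lt⇒Le ⊟ = ℕP.<⇒≤

Le-Lt-trans : ∀ ε {a b c} → Le ε a b → Lt ε b c → Lt ε a c
Le-Lt-trans ⊞ p q = ℕP.≤-<-trans p q
Le-Lt-trans ⊟ p q = ℕP.<-≤-trans q p

Lt-Le-trans : ∀ ε {a b c} → Lt ε a b → Le ε b c → Lt ε a c
Lt-Le-trans ⊞ p q = ℕP.<-≤-trans p q
Lt-Le-trans ⊟ p q = ℕP.≤-<-trans q p

Lt⇒≢ : ∀ ε {a b} → Lt ε a b → a ≢ b
Lt⇒≢ ⊞ p refl = ℕP.<-irrefl refl p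
Lt⇒≢ ⊟ p refl = ℕP.<-irrefl refl p

src-Lt-tgt : ∀ ε {lo hi} → lo < hi → Lt ε (src ε lo hi) (tgt ε lo hi)
src-Lt-tgt ⊞ p = p
src-Lt-tgt ⊟ p = p

-- Cells of the diagram and their symmetries

V : Set
V = ℕ → ℤ

module Cells (r : ℕ) where

  Dom : V → Set
  Dom X = ∀ {p q} → p ≤ q → q < r → X q ℤ.≤ X p

  -- Values beyond the `r` rows carry no meaning.
  _≐_ : V → V → Set
  X ≐ Y = ∀ {p} → p < r → X p ≡ Y p

  record Step (ε : Sgn) (a : ℕ) (X Y : V) : Set where
    constructor step
    field
      bound : a < r
      eqn   : ∀ {p} → p < r → Y p ≡ X p + unit ε a p

  open Step public

  Step-resp : ∀ {ε a X Y X′ Y′} → X ≐ X′ → Y ≐ Y′ → Step ε a X Y → Step ε a X′ Y′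
  Step-resp {ε} {a} X≐ Y≐ (step a<r eq) =
    step a<r λ {p} p<r → trans (sym (Y≐ p<r)) (trans (eq p<r) (cong (_+ unit ε a p) (X≐ p<r)))

  -- A unit vector shows its sign and its row. This identifies letters hidden in existential
  -- witnesses with the letters of a given cell.
  Step-unique : ∀ {ε a ε′ a′ X Y} → Step ε a X Y → Step ε′ a′ X Y → ε ≡ ε′ × a ≡ a′
  Step-unique {ε} {a} {ε′} {a′} {X} {Y} s s′ = go ε ε′ same
    where
    same : unit ε a a ≡ unit ε′ a′ a
    same = +-cancelˡ (X a) (trans (sym (eqn s (bound s))) (eqn s′ (bound s)))
    go : ∀ ε ε′ → unit ε a a ≡ unit ε′ a′ a → ε ≡ ε′ × a ≡ a′
    go ε ε′ eq with a′ ℕ.≟ a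
    go ⊞ ε′ eq | no ne with trans (sym (δ-≡ a)) (trans eq (unit-≢ ε′ ne))
    ... | ()
    go ⊟ ε′ eq | no ne with trans (sym (cong -_ (δ-≡ a))) (trans eq (unit-≢ ε′ ne))
    ... | ()
    go ⊞ ⊞ eq | yes refl = refl , refl
    go ⊟ ⊟ eq | yes refl = refl , refl
    go ⊞ ⊟ eq | yes refl with trans (sym (δ-≡ a)) (trans eq (cong -_ (δ-≡ a)))
    ... | ()
    go ⊟ ⊞ eq | yes refl with trans (sym (δ-≡ a)) (trans (sym eq) (cong -_ (δ-≡ a)))
    ... | ()

  -- One cell of the promotion–evacuation diagram of an oscillating tableau:
  -- A B on the upper row, C D on the lower one.
  data Sq (C A D B : V) : Set where
    straight : ∀ ε a η d → Step ε a C A → Step ε a D B → Step η d C D → Step η d A B → Sq C A D B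
    bend : ∀ ε η lo hi → lo < hi → C lo ≡ C hi →
           Step ε (src ε lo hi) C A → Step ε (tgt ε lo hi) D B →
           Step η (src η lo hi) C D → Step η (tgt η lo hi) A B → Sq C A D B

  Sq-transpose : ∀ {C A D B} → Sq C A D B → Sq C D A B
  Sq-transpose (straight ε a η d l r b t) = straight η d ε a b t l r
  Sq-transpose (bend ε η lo hi lt fl l r b t) = bend η ε lo hi lt fl b t l r

  src-tgt-bound : ∀ ε {lo hi} → lo < hi → src ε lo hi < r → tgt ε lo hi < r → lo < r × hi < r
  src-tgt-bound ⊞ _ p q = p , q
  src-tgt-bound ⊟ _ p q = q , p

  gap-src : ∀ η {lo hi X Y} → lo < hi → lo < r → hi < r → Step η (src η lo hi) X Y →
            X lo ≡ X hi → Y lo ≡ Y hi + 1ℤ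
  gap-src ⊞ {lo} {hi} {X} lt lo<r hi<r s fl
    rewrite eqn s lo<r | eqn s hi<r | δ-≡ lo | δ-≢ {lo} {hi} (ℕP.<⇒≢ lt) | fl = lem (X hi)
    where
    lem : ∀ x → x + 1ℤ ≡ x + 0ℤ + 1ℤ
    lem = solve-∀
  gap-src ⊟ {lo} {hi} {X} lt lo<r hi<r s fl
    rewrite eqn s lo<r | eqn s hi<r | δ-≡ hi | δ-≢ {hi} {lo} (λ e → ℕP.<⇒≢ lt (sym e)) | fl = lem (X hi)
    where
    lem : ∀ x → x + 0ℤ ≡ x - 1ℤ + 1ℤ
    lem = solve-∀

  gap-tgt : ∀ η {lo hi X Y} → lo < hi → lo < r → hi < r → Step η (tgt η lo hi) X Y →
            X lo ≡ X hi + 1ℤ → Y lo ≡ Y hi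
  gap-tgt ⊞ {lo} {hi} {X} lt lo<r hi<r s fl
    rewrite eqn s lo<r | eqn s hi<r | δ-≡ hi | δ-≢ {hi} {lo} (λ e → ℕP.<⇒≢ lt (sym e)) | fl = lem (X hi)
    where
    lem : ∀ x → x + 1ℤ + 0ℤ ≡ x + 1ℤ
    lem = solve-∀
  gap-tgt ⊟ {lo} {hi} {X} lt lo<r hi<r s fl
    rewrite eqn s lo<r | eqn s hi<r | δ-≡ lo | δ-≢ {lo} {hi} (ℕP.<⇒≢ lt) | fl = lem (X hi)
    where
    lem : ∀ x → x + 1ℤ - 1ℤ ≡ x + 0ℤ
    lem = solve-∀

  rev : ℕ → ℕ
  rev p = r ∸ suc p

  rev-< : ∀ {p} → p < r → rev p < r
  rev-< {p} p<r = ℕP.∸-monoʳ-< {o = 0} (s≤s z≤n) p<r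

  rev-rev : ∀ {p} → p < r → rev (rev p) ≡ p
  rev-rev {p} p<r = trans (cong (r ∸_) (sym (ℕP.+-∸-assoc 1 p<r))) (ℕP.m∸[m∸n]≡n (ℕP.<⇒≤ p<r))

  rev-anti-≤ : ∀ {p q} → p ≤ q → rev q ≤ rev p
  rev-anti-≤ p≤q = ℕP.∸-monoʳ-≤ r (s≤s p≤q)

  rev-anti-< : ∀ {p q} → p < q → q < r → rev q < rev p
  rev-anti-< p<q q<r = ℕP.∸-monoʳ-< (s≤s p<q) q<r

  δ-rev : ∀ {a p} → a < r → p < r → δ a (rev p) ≡ δ (rev a) p
  δ-rev {a} {p} a<r p<r with a ℕ.≟ rev p
  ... | yes refl rewrite rev-rev p<r = trans (δ-≡ (rev p)) (sym (δ-≡ p))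
  ... | no ne = trans (δ-≢ ne) (sym (δ-≢ λ eq → ne (trans (sym (rev-rev a<r)) (cong rev eq))))

  unit-rev : ∀ ε {a p} → a < r → p < r → unit ε a (rev p) ≡ unit ε (rev a) p
  unit-rev ⊞ = δ-rev
  unit-rev ⊟ a<r p<r = cong -_ (δ-rev a<r p<r)

  -- complement in the r × k rectangle
  κ : ℤ → V → V
  κ k X p = k - X (rev p)

  κ-cong : ∀ k {X Y} → X ≐ Y → κ k X ≐ κ k Y
  κ-cong k X≐Y p<r = cong (λ x → k - x) (X≐Y (rev-< p<r))

  κ-κ : ∀ k {X} → κ k (κ k X) ≐ X
  κ-κ k {X} {p} p<r rewrite rev-rev p<r = lem k (X p)
    where
    lem : ∀ k x → k - (k - x) ≡ x
    lem = solve-∀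

  Dom-κ : ∀ k {X} → Dom X → Dom (κ k X)
  Dom-κ k {X} dX {p} {q} p≤q q<r =
    ℤP.+-monoʳ-≤ k (ℤP.neg-mono-≤ (dX (rev-anti-≤ p≤q) (rev-< (ℕP.≤-<-trans p≤q q<r))))

  -- Complementation turns an addition into a removal, and reading the step backwards turns it into
  -- an addition again: the sign survives and only the row is reflected.
  Step-κ : ∀ k {ε a X Y} → Step ε a X Y → Step ε (rev a) (κ k Y) (κ k X)
  Step-κ k {ε} {a} {X} {Y} (step a<r eq) = step (rev-< a<r) λ {p} p<r →
    trans (lem k (X (rev p)) (unit ε a (rev p)))
      (cong₂ (λ y u → k - y + u) (sym (eq (rev-< p<r))) (unit-rev ε a<r p<r))
    where
    lem : ∀ k x u → k - x ≡ k - (x + u) + u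
    lem = solve-∀

  rev-src : ∀ ε lo hi → rev (src ε lo hi) ≡ tgt ε (rev hi) (rev lo)
  rev-src ⊞ lo hi = refl
  rev-src ⊟ lo hi = refl

  rev-tgt : ∀ ε lo hi → rev (tgt ε lo hi) ≡ src ε (rev hi) (rev lo)
  rev-tgt ⊞ lo hi = refl
  rev-tgt ⊟ lo hi = refl

  bend-bounds : ∀ {ε lo hi C A D B} → lo < hi → Step ε (src ε lo hi) C A → Step ε (tgt ε lo hi) D B → lo < r × hi < r
  bend-bounds {ε} lt l r = src-tgt-bound ε lt (bound l) (bound r)

  -- The step from `C` to `A` opens a gap of one between the rows `lo` and `hi`, and the step from
  -- `A` to `B` closes it. Flatness at both corners makes a bend invariant under complementation.
  bend-upper-flat : ∀ {ε η lo hi C A D B} → lo < hi → C lo ≡ C hi →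
    Step ε (src ε lo hi) C A → Step ε (tgt ε lo hi) D B →
    Step η (src η lo hi) C D → Step η (tgt η lo hi) A B → B lo ≡ B hi
  bend-upper-flat {ε} {η} lt fl l r b t with bend-bounds lt l r
  ... | lo<r , hi<r = gap-tgt η lt lo<r hi<r t (gap-src ε lt lo<r hi<r l fl)

  -- All four arrows are reversed, so the cell undergoes a half turn; the flatness of its upper
  -- right corner becomes that of the new lower left corner.
  Sq-κ : ∀ k {C A D B} → Sq C A D B → Sq (κ k B) (κ k D) (κ k A) (κ k C)
  Sq-κ k (straight ε a η d l r b t) = straight ε (rev a) η (rev d) (Step-κ k r) (Step-κ k l) (Step-κ k t) (Step-κ k b)
  Sq-κ k {B = B} (bend ε η lo hi lt fl l r b t) with bend-bounds lt l r
  ... | lo<r , hi<r =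
    bend ε η (rev hi) (rev lo) (rev-anti-< lt hi<r)
      (cong (λ x → k - x) (trans (cong B (rev-rev hi<r)) (trans (sym (bend-upper-flat lt fl l r b t)) (cong B (sym (rev-rev lo<r))))))
      (subst (λ x → Step ε x _ _) (rev-tgt ε lo hi) (Step-κ k r))
      (subst (λ x → Step ε x _ _) (rev-src ε lo hi) (Step-κ k l))
      (subst (λ x → Step η x _ _) (rev-tgt η lo hi) (Step-κ k t))
      (subst (λ x → Step η x _ _) (rev-src η lo hi) (Step-κ k b))

  -- Sorting moves a unit change from row c to row d.
  Settled : Sgn → V → ℕ → ℕ → Set
  Settled η C c d = d < r × Le η d c × C d ≡ C c × (∀ {p} → p < r → Lt η p d → C p ≢ C c)

  -- Walk along the plateau of entries equal to `C c`, to its first row if a cell is added and to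
  -- its last row if one is removed.
  settle : ∀ η {C} → Dom C → ∀ {c} → c < r → ∃ (Settled η C c)
  settle ⊞ {C} dC {zero}  c<r = zero , c<r , z≤n , refl , λ _ ()
  settle ⊞ {C} dC {suc c} c<r with C c ℤ.≟ C (suc c)
  ... | yes eq with settle ⊞ dC (ℕP.<-trans (ℕP.n<1+n c) c<r)
  ...   | d , d<r , d≤c , e , min =
            d , d<r , ℕP.m≤n⇒m≤1+n d≤c , trans e eq , λ p<r p<d → subst (C _ ≢_) eq (min p<r p<d)
  settle ⊞ {C} dC {suc c} c<r | no ne = suc c , c<r , ℕP.≤-refl , refl , λ p<r p≤c eq →
    ne (ℤP.≤-antisym (subst (C c ℤ.≤_) eq (dC (ℕP.≤-pred p≤c) (ℕP.<-trans (ℕP.n<1+n c) c<r))) (dC (ℕP.n≤1+n c) c<r))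
  -- The fuel is the number of rows beyond `c`.
  settle ⊟ {C} dC {c} c<r = go (r ∸ suc c) (ℕP.m+[n∸m]≡n c<r)
    where
    go : ∀ f {c} → suc c ℕ.+ f ≡ r → ∃ (Settled ⊟ C c)
    go zero {c} eq = c , subst (c <_) eq (s≤s (ℕP.m≤m+n c 0)) , ℕP.≤-refl , refl ,
      λ p<r c<p _ → ℕP.<-irrefl refl (ℕP.<-≤-trans p<r (subst (_≤ _) (trans (cong suc (sym (ℕP.+-identityʳ c))) eq) c<p))
    go (suc f) {c} eq with C (suc c) ℤ.≟ C c
    ... | yes e with go f {suc c} (trans (sym (ℕP.+-suc (suc c) f)) eq)
    ...   | d , d<r , c≤d , e′ , min =
              d , d<r , ℕP.<⇒≤ c≤d , trans e′ e , λ p<r d<p → subst (C _ ≢_) e (min p<r d<p)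
    go (suc f) {c} eq | no ne = c , subst (c <_) eq (s≤s (ℕP.m≤m+n c _)) , ℕP.≤-refl , refl , λ {p} p<r c<p e′ →
      ne (ℤP.≤-antisym (dC (ℕP.n≤1+n c) (ℕP.≤-<-trans c<p p<r)) (subst (ℤ._≤ C (suc c)) e′ (dC c<p p<r)))

  add : Sgn → ℕ → V → V
  add η d X p = X p + unit η d p

  -- At the end of a plateau the next entry differs by at least one, which leaves room for the unit
  -- change.
  Dom-settled : ∀ η {C c d} → Dom C → Settled η C c d → Dom (add η d C)
  Dom-settled ⊞ {C} {c} {d} dC (d<r , d≤c , e , min) {p} {q} p≤q q<r with p ℕ.≟ d | d ℕ.≟ q
  ... | yes refl | yes refl = ℤP.≤-refl
  ... | yes refl | no d≢q rewrite δ-≢ d≢q | δ-≡ d = ℤP.+-mono-≤ (dC p≤q q<r) (ℤ.+≤+ z≤n)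
  ... | no p≢d | no d≢q rewrite δ-≢ d≢q | δ-≢ {d} (λ e → p≢d (sym e)) = ℤP.+-monoˡ-≤ 0ℤ (dC p≤q q<r)
  ... | no p≢d | yes refl rewrite δ-≡ d | δ-≢ {d} (λ e → p≢d (sym e)) =
    subst₂ ℤ._≤_ (ℤP.+-comm 1ℤ (C d)) (sym (ℤP.+-identityʳ (C p)))
      (ℤP.i<j⇒suc[i]≤j (ℤP.≤∧≢⇒< (dC p≤q q<r) (λ eq → min (ℕP.≤-<-trans p≤q q<r) (ℕP.≤∧≢⇒< p≤q p≢d) (trans (sym eq) e))))
  Dom-settled ⊟ {C} {c} {d} dC (d<r , d≤c , e , min) {p} {q} p≤q q<r with p ℕ.≟ d | d ℕ.≟ q
  ... | yes refl | yes refl = ℤP.≤-refl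
  ... | no p≢d | yes refl rewrite δ-≡ d | δ-≢ {d} (λ e → p≢d (sym e)) = ℤP.+-mono-≤ (dC p≤q q<r) ℤ.-≤+
  ... | no p≢d | no d≢q rewrite δ-≢ d≢q | δ-≢ {d} (λ e → p≢d (sym e)) = ℤP.+-monoˡ-≤ 0ℤ (dC p≤q q<r)
  ... | yes refl | no d≢q rewrite δ-≢ d≢q | δ-≡ d =
    ≤-by (ℤP.i<j⇒suc[i]≤j (ℤP.≤∧≢⇒< (dC p≤q q<r) (λ eq → min q<r (ℕP.≤∧≢⇒< p≤q d≢q) (trans eq e)))) (lem (C d) (C q))
    where
    lem : ∀ x y → x - (1ℤ + y) ≡ x - 1ℤ - (y + 0ℤ)
    lem = solve-∀

  src-by-gap : ∀ ε {a lo hi} → lo < hi → unit ε a hi + 1ℤ ℤ.≤ unit ε a lo → a ≡ src ε lo hi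
  src-by-gap ⊞ {a} {lo} {hi} lt le with a ℕ.≟ lo
  ... | yes eq = eq
  ... | no ne with a ℕ.≟ hi
  ...   | yes refl rewrite δ-≢ ne | δ-≡ a with le
  ...     | ℤ.+≤+ ()
  src-by-gap ⊞ {a} {lo} {hi} lt le | no ne | no ne′ rewrite δ-≢ ne | δ-≢ ne′ with le
  ...     | ℤ.+≤+ ()
  src-by-gap ⊟ {a} {lo} {hi} lt le with a ℕ.≟ hi
  ... | yes eq = eq
  ... | no ne with a ℕ.≟ lo
  ...   | yes refl rewrite δ-≢ ne | δ-≡ a with le
  ...     | ()
  src-by-gap ⊟ {a} {lo} {hi} lt le | no ne | no ne′ rewrite δ-≢ ne | δ-≢ ne′ with le
  ...     | ℤ.+≤+ ()

  private
    -- The top step moves row `hi` up by one relative to row `lo`, although both are equal in `C`.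
    -- Since `B` decreases, the left step must have opened a gap of one, and `src ε lo hi` is the
    -- only letter that does so.
    bend-of : ∀ {C A D B ε a} η {lo hi} → lo < hi → lo < r → hi < r → C lo ≡ C hi → Dom B →
              Step ε a C A → Step η (tgt η lo hi) A B → Step η (src η lo hi) C D → Sq C A D B
    bend-of {C} {A} {D} {B} {ε} {a} η {lo} {hi} lt lo<r hi<r fl dB l t b = go (src-by-gap ε lt gap) l
      where
      tgt-gap : ∀ η → unit η (tgt η lo hi) hi ≡ unit η (tgt η lo hi) lo + 1ℤ
      tgt-gap ⊞ rewrite δ-≡ hi | δ-≢ {hi} {lo} (λ e → ℕP.<⇒≢ lt (sym e)) = refl
      tgt-gap ⊟ rewrite δ-≡ lo | δ-≢ {lo} {hi} (ℕP.<⇒≢ lt) = refl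
      B-eq : ∀ {p} → p < r → B p ≡ C p + unit ε a p + unit η (tgt η lo hi) p
      B-eq p<r = trans (eqn t p<r) (cong (_+ unit η (tgt η lo hi) _) (eqn l p<r))
      gap : unit ε a hi + 1ℤ ℤ.≤ unit ε a lo
      gap = ≤-by (subst₂ ℤ._≤_ (trans (B-eq hi<r) (cong₂ (λ x y → x + unit ε a hi + y) (sym fl) (tgt-gap η))) (B-eq lo<r) (dB (ℕP.<⇒≤ lt) hi<r))
        (lem (C lo) (unit ε a lo) (unit ε a hi) (unit η (tgt η lo hi) lo))
        where
        lem : ∀ c x y u → (c + x + u) - (c + y + (u + 1ℤ)) ≡ x - (y + 1ℤ)
        lem = solve-∀
      go : a ≡ src ε lo hi → Step ε a C A → Sq C A D B
      go refl l = bend ε η lo hi lt fl l (step (tgt-bound ε) right) b t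
        where
        tgt-bound : ∀ ε → tgt ε lo hi < r
        tgt-bound ⊞ = hi<r
        tgt-bound ⊟ = lo<r
        right : ∀ {p} → p < r → B p ≡ D p + unit ε (tgt ε lo hi) p
        right {p} p<r = trans (B-eq p<r) (trans
          (lem (C p) (unit ε (src ε lo hi) p) (unit η (tgt η lo hi) p) (unit ε (tgt ε lo hi) p) (unit η (src η lo hi) p)
               (trans (unit-src-tgt ε lo hi p) (sym (unit-src-tgt η lo hi p))))
          (cong (_+ unit ε (tgt ε lo hi) p) (sym (eqn b p<r))))
          where
          lem₀ : ∀ c s t t′ → c + (s - t) + (t′ + t) ≡ c + s + t′
          lem₀ = solve-∀
          lem₁ : ∀ c s t t′ → c + s + t ≡ c + (s - t′) + (t + t′)
          lem₁ = solve-∀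
          lem : ∀ c s t t′ s′ → s - t′ ≡ s′ - t → c + s + t ≡ c + s′ + t′
          lem c s t t′ s′ eq = trans (lem₁ c s t t′) (trans (cong₂ (λ x y → c + x + y) eq (ℤP.+-comm t t′)) (lem₀ c s′ t t′))

  -- If sorting leaves the letter in place, the cell is straight; otherwise the old and the new row
  -- lie on one plateau of `C` and are the two rows of a bend.
  Sq-of-settled : ∀ {C A B D ε a η c d} → Dom B → Step ε a C A → Step η c A B → Settled η C c d →
                  Step η d C D → Sq C A D B
  Sq-of-settled {C} {A} {B} {D} {ε} {a} {η} {c} {d} dB l t set b with d ℕ.≟ c
  ... | yes refl = straight ε a η d l (step (bound l) right) b t
    where
    right : ∀ {p} → p < r → B p ≡ D p + unit ε a p
    right {p} p<r = trans (eqn t p<r) (trans (cong (_+ unit η d p) (eqn l p<r)) (trans (lem (C p) _ _) (cong (_+ unit ε a p) (sym (eqn b p<r)))))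
      where
      lem : ∀ x y z → x + y + z ≡ x + z + y
      lem = solve-∀
  Sq-of-settled {η = ⊞} dB l t (d<r , d≤c , e , _) b | no d≢c =
    bend-of ⊞ (ℕP.≤∧≢⇒< d≤c d≢c) d<r (bound t) e dB l t b
  Sq-of-settled {η = ⊟} dB l t (d<r , c≤d , e , _) b | no d≢c =
    bend-of ⊟ (ℕP.≤∧≢⇒< c≤d (λ e → d≢c (sym e))) (bound t) d<r (sym e) dB l t b

-- Finite sums

∑ : ℕ → (ℕ → ℤ) → ℤ
∑ zero    f = 0ℤ
∑ (suc n) f = ∑ n f + f n

∑-cong : ∀ n {f g} → (∀ {p} → p < n → f p ≡ g p) → ∑ n f ≡ ∑ n g
∑-cong zero    eq = refl
∑-cong (suc n) eq = cong₂ _+_ (∑-cong n (λ p<n → eq (ℕP.m<n⇒m<1+n p<n))) (eq (ℕP.n<1+n n))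

∑-zero : ∀ n {f} → (∀ {p} → p < n → f p ≡ 0ℤ) → ∑ n f ≡ 0ℤ
∑-zero zero    eq = refl
∑-zero (suc n) eq = cong₂ _+_ (∑-zero n (λ p<n → eq (ℕP.m<n⇒m<1+n p<n))) (eq (ℕP.n<1+n n))

∑-+ : ∀ n f g → ∑ n (λ p → f p + g p) ≡ ∑ n f + ∑ n g
∑-+ zero    f g = refl
∑-+ (suc n) f g = trans (cong (_+ (f n + g n)) (∑-+ n f g)) (lem (∑ n f) (∑ n g) (f n) (g n))
  where
  lem : ∀ a b c d → a + b + (c + d) ≡ a + c + (b + d)
  lem = solve-∀

∑-neg : ∀ n f → ∑ n (λ p → - f p) ≡ - ∑ n f
∑-neg zero    f = refl
∑-neg (suc n) f = trans (cong (_- f n) (∑-neg n f)) (lem (∑ n f) (f n))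
  where
  lem : ∀ a b → - a - b ≡ - (a + b)
  lem = solve-∀

∑-- : ∀ n f g → ∑ n (λ p → f p - g p) ≡ ∑ n f - ∑ n g
∑-- n f g = trans (∑-+ n f (λ p → - g p)) (cong (_+_ (∑ n f)) (∑-neg n g))

∑-δ : ∀ n {a} (f : ℕ → ℤ) → a < n → ∑ n (λ p → f p * δ a p) ≡ f a
∑-δ (suc n) {a} f a<1+n with a ℕ.≟ n
... | yes refl rewrite δ-≡ a = trans (cong (_+ f a * 1ℤ) (∑-zero n λ p<a → trans (cong (f _ *_) (δ-≢ (λ e → ℕP.<-irrefl (sym e) p<a))) (ℤP.*-zeroʳ (f _)))) (lem (f a))
  where
  lem : ∀ x → 0ℤ + x * 1ℤ ≡ x
  lem = solve-∀
... | no a≢n rewrite δ-≢ a≢n = trans (cong (_+ f n * 0ℤ) (∑-δ n f (ℕP.≤∧≢⇒< (ℕP.≤-pred a<1+n) a≢n))) (lem (f a) (f n))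
  where
  lem : ∀ x y → x + y * 0ℤ ≡ x
  lem = solve-∀

val : Sgn → ℤ → ℤ
val ⊞ x = x
val ⊟ x = - x

val-0 : ∀ ε → val ε 0ℤ ≡ 0ℤ
val-0 ⊞ = refl
val-0 ⊟ = refl

∑-unit : ∀ ε n {a} (f : ℕ → ℤ) → a < n → ∑ n (λ p → f p * unit ε a p) ≡ val ε (f a)
∑-unit ⊞ n f a<n = ∑-δ n f a<n
∑-unit ⊟ n {a} f a<n = trans (∑-cong n (λ {p} _ → sym (ℤP.neg-distribʳ-* (f p) (δ a p)))) (trans (∑-neg n _) (cong -_ (∑-δ n f a<n)))

-- When `N` counts the elements of a set below each row, this is the indicator function of the set.
slope : (ℕ → ℤ) → ℕ → ℤ
slope N p = N (suc p) - N p

-- Moving sets of rows and what they collect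

module Pairing (r : ℕ) where
  open Cells r

  -- Abel's form of the pairing of X with the set of rows p at which N jumps.
  ⟪_,_⟫ : (ℕ → ℤ) → V → ℤ
  ⟪ N , X ⟫ = ∑ r (λ p → slope N p * X p)

  pair-step : ∀ N {ε a X Y} → Step ε a X Y → ⟪ N , Y ⟫ ≡ ⟪ N , X ⟫ + val ε (slope N a)
  pair-step N {ε} {a} {X} {Y} s = trans
    (∑-cong r λ {p} p<r → trans (cong (slope N p *_) (eqn s p<r)) (ℤP.*-distribˡ-+ (slope N p) (X p) (unit ε a p)))
    (trans (∑-+ r _ _) (cong (_+_ ⟪ N , X ⟫) (∑-unit ε r (slope N) (bound s))))

  pair-+ : ∀ N M X → ⟪ (λ p → N p + M p) , X ⟫ ≡ ⟪ N , X ⟫ + ⟪ M , X ⟫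
  pair-+ N M X = trans (∑-cong r λ {p} _ → lem (N (suc p)) (M (suc p)) (N p) (M p) (X p)) (∑-+ r _ _)
    where
    lem : ∀ a b c d x → (a + b - (c + d)) * x ≡ (a - c) * x + (b - d) * x
    lem = solve-∀

  pair-- : ∀ N M X → ⟪ (λ p → N p - M p) , X ⟫ ≡ ⟪ N , X ⟫ - ⟪ M , X ⟫
  pair-- N M X = trans (∑-cong r λ {p} _ → lem (N (suc p)) (M (suc p)) (N p) (M p) (X p)) (∑-- r _ _)
    where
    lem : ∀ a b c d x → (a - b - (c - d)) * x ≡ (a - c) * x - (b - d) * x
    lem = solve-∀

  -- Summation by parts: as `M` vanishes at both ends, the pairing is the sum of the products of
  -- `M (suc p)` with the drop `X p - X (suc p)`. The partial sums keep the boundary term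
  -- `M (suc n) * X n`.
  pair-nonneg : ∀ {M X} → Dom X → (∀ {p} → p ≤ r → 0ℤ ℤ.≤ M p) → M 0 ≡ 0ℤ → M r ≡ 0ℤ → 0ℤ ℤ.≤ ⟪ M , X ⟫
  pair-nonneg {M} {X} dX M≥0 M0 Mr = go r ℕP.≤-refl Mr
    where
    partial : ∀ n → n < r → M (suc n) * X n ℤ.≤ ∑ (suc n) (λ p → slope M p * X p)
    partial zero    n<r rewrite M0 = ℤP.≤-reflexive (lem (M 1) (X 0))
      where
      lem : ∀ m x → m * x ≡ 0ℤ + (m - 0ℤ) * x
      lem = solve-∀
    partial (suc n) n<r = ≤-by₂ (partial n (ℕP.<-trans (ℕP.n<1+n n) n<r))
        (ℤP.*-monoˡ-≤-nonNeg (M (suc n)) {{ℤ.nonNegative (M≥0 (ℕP.<⇒≤ n<r))}} (dX (ℕP.n≤1+n n) n<r))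
        (lem (∑ (suc n) (λ p → slope M p * X p)) (M (suc n)) (M (suc (suc n))) (X n) (X (suc n)))
      where
      lem : ∀ s m m′ x y → s + m * x - (m * x + m * y) ≡ s + (m′ - m) * y - m′ * y
      lem = solve-∀
    go : ∀ n → n ≤ r → M n ≡ 0ℤ → 0ℤ ℤ.≤ ∑ n (λ p → slope M p * X p)
    go zero    _   _  = ℤP.≤-refl
    go (suc n) n<r Mn = subst (ℤ._≤ ∑ (suc n) (λ p → slope M p * X p)) (trans (cong (_* X n) Mn) (ℤP.*-zeroˡ (X n))) (partial n n<r)

  -- N p counts the elements < p of an m-element set of rows.
  record State (m : ℕ) (N : ℕ → ℤ) : Set where
    field
      start   : N 0 ≡ 0ℤ
      end     : N r ≡ + m
      slope≥0 : ∀ {p} → p < r → 0ℤ ℤ.≤ slope N p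
      slope≤1 : ∀ {p} → p < r → slope N p ℤ.≤ 1ℤ

  open State

  -- More elements below every row: for sets of equal size, the elements of `N` can be moved to
  -- smaller rows to give `M`.
  _≼_ : (ℕ → ℤ) → (ℕ → ℤ) → Set
  N ≼ M = ∀ {p} → p ≤ r → N p ℤ.≤ M p

  -- Smaller rows hold larger entries.
  pair-mono : ∀ {m N M X} → State m N → State m M → Dom X → N ≼ M → ⟪ N , X ⟫ ℤ.≤ ⟪ M , X ⟫
  pair-mono {m} {N} {M} {X} sN sM dX N≼M = ℤP.0≤i-j⇒j≤i (subst (0ℤ ℤ.≤_) (pair-- M N X)
    (pair-nonneg dX (λ p≤r → ℤP.i≤j⇒0≤j-i (N≼M p≤r))
      (cong₂ _-_ (start sM) (start sN)) (trans (cong₂ _-_ (end sM) (end sN)) (ℤP.+-inverseʳ (+ m)))))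

  -- The least set to which both given sets can move.
  join : (ℕ → ℤ) → (ℕ → ℤ) → ℕ → ℤ
  join N M p = N p ℤ.⊔ M p

  ≤+1 : ∀ {x y} → y - x ℤ.≤ 1ℤ → y ℤ.≤ x + 1ℤ
  ≤+1 {x} {y} p = ≤-by p (lem x y)
    where
    lem : ∀ x y → 1ℤ - (y - x) ≡ x + 1ℤ - y
    lem = solve-∀

  join-state : ∀ {m N M} → State m N → State m M → State m (join N M)
  join-state {m} {N} {M} sN sM = record
    { start = cong₂ ℤ._⊔_ (start sN) (start sM)
    ; end = trans (cong₂ ℤ._⊔_ (end sN) (end sM)) (ℤP.⊔-idem (+ m))
    ; slope≥0 = λ {p} p<r → ℤP.i≤j⇒0≤j-i (ℤP.⊔-mono-≤ {N (suc p)} {N p} {M (suc p)} {M p} (ℤP.0≤i-j⇒j≤i (slope≥0 sN p<r)) (ℤP.0≤i-j⇒j≤i (slope≥0 sM p<r)))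
    ; slope≤1 = λ {p} p<r → ≤-by {u = N (suc p) ℤ.⊔ M (suc p)} {v = (N p ℤ.⊔ M p) + 1ℤ}
        (ℤP.⊔-lub (ℤP.≤-trans (≤+1 (slope≤1 sN p<r)) (ℤP.+-monoˡ-≤ 1ℤ (ℤP.i≤i⊔j (N p) (M p))))
                  (ℤP.≤-trans (≤+1 (slope≤1 sM p<r)) (ℤP.+-monoˡ-≤ 1ℤ (ℤP.i≤j⊔i (N p) (M p)))))
        (lem (N (suc p) ℤ.⊔ M (suc p)) (N p ℤ.⊔ M p))
    }
    where
    lem : ∀ x y → y + 1ℤ - x ≡ 1ℤ - (x - y)
    lem = solve-∀

  -- The sum of `n₁` and `n′` less their maximum is their minimum, which is at least `n`.
  join-gain : ∀ n n₁ n′ → n ℤ.≤ n₁ → n ℤ.≤ n′ → 0ℤ ℤ.≤ (n′ - n) - ((n₁ ℤ.⊔ n′) - n₁)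
  join-gain n n₁ n′ p q with ℤP.⊔-sel n₁ n′
  ... | inj₁ e rewrite e = ≤-by q (lem n n₁ n′)
    where
    lem : ∀ n n₁ n′ → n′ - n ≡ n′ - n - (n₁ - n₁) - 0ℤ
    lem = solve-∀
  ... | inj₂ e rewrite e = ≤-by p (lem n n₁ n′)
    where
    lem : ∀ n n₁ n′ → n₁ - n ≡ n′ - n - (n′ - n₁) - 0ℤ
    lem = solve-∀

  -- Ach m X l N w: along the path X 0, …, X l a set of m rows, starting below the set N and only
  -- ever moving its elements to smaller rows, can collect at least w from the increments.
  data Ach (m : ℕ) (X : ℕ → V) : ℕ → (ℕ → ℤ) → ℤ → Set where
    stop : ∀ {N w} → w ℤ.≤ 0ℤ → Ach m X 0 N w
    move : ∀ {l N w} N₁ w₁ → State m N₁ → N ≼ N₁ → Ach m (X ∘ suc) l N₁ w₁ →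
           w ℤ.≤ (⟪ N₁ , X 1 ⟫ - ⟪ N₁ , X 0 ⟫) + w₁ → Ach m X (suc l) N w

  Ach-stay : ∀ {m N} X l → State m N → Ach m X l N (⟪ N , X l ⟫ - ⟪ N , X 0 ⟫)
  Ach-stay {N = N} X zero s = stop (ℤP.≤-reflexive (ℤP.+-inverseʳ ⟪ N , X 0 ⟫))
  Ach-stay {N = N} X (suc l) s = move N _ s (λ _ → ℤP.≤-refl) (Ach-stay (X ∘ suc) l s)
    (ℤP.≤-reflexive (lem ⟪ N , X (suc l) ⟫ ⟪ N , X 1 ⟫ ⟪ N , X 0 ⟫))
    where
    lem : ∀ a b c → a - c ≡ b - c + (a - b)
    lem = solve-∀

  -- Follow the old motion joined with `N′`. Each step alters the amount collected by the change of
  -- the lead, the difference of the two pairings. Taking joins only shrinks the lead, by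
  -- `join-gain`, and it ends non-negative; so at most the initial lead is lost.
  Ach-lower : ∀ {m N N′ w} X l → (∀ {j} → j ≤ l → Dom (X j)) → State m N → State m N′ → N ≼ N′ →
              Ach m X l N w → Ach m X l N′ ((w + ⟪ N , X 0 ⟫) - ⟪ N′ , X 0 ⟫)
  Ach-lower {N = N} {N′} {w} X zero dX s s′ N≼N′ (stop w≤0) =
    stop (≤-by₂ w≤0 (pair-mono s s′ (dX z≤n) N≼N′) (lem w ⟪ N , X 0 ⟫ ⟪ N′ , X 0 ⟫))
    where
    lem : ∀ w a b → 0ℤ + b - (w + a) ≡ 0ℤ - (w + a - b)
    lem = solve-∀
  Ach-lower {m} {N} {N′} {w} X (suc l) dX s s′ N≼N′ (move N₁ w₁ s₁ N≼N₁ rest w≤) =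
    move N₂ _ s₂ (λ {p} _ → ℤP.i≤j⊔i (N₁ p) (N′ p))
      (Ach-lower (X ∘ suc) l (λ j≤l → dX (s≤s j≤l)) s₁ s₂ (λ {p} _ → ℤP.i≤i⊔j (N₁ p) (N′ p)) rest)
      (≤-by₂ w≤ gain (lem w w₁ ⟪ N , X 0 ⟫ ⟪ N′ , X 0 ⟫ ⟪ N₁ , X 0 ⟫ ⟪ N₂ , X 0 ⟫ ⟪ N₁ , X 1 ⟫ ⟪ N₂ , X 1 ⟫))
    where
    N₂ : ℕ → ℤ
    N₂ = join N₁ N′
    s₂ : State m N₂
    s₂ = join-state s₁ s′
    gain : 0ℤ ℤ.≤ (⟪ N′ , X 0 ⟫ - ⟪ N , X 0 ⟫) - (⟪ N₂ , X 0 ⟫ - ⟪ N₁ , X 0 ⟫)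
    gain = subst (0ℤ ℤ.≤_)
      (trans (pair-- (λ p → N′ p - N p) (λ p → N₂ p - N₁ p) (X 0)) (cong₂ _-_ (pair-- N′ N (X 0)) (pair-- N₂ N₁ (X 0))))
      (pair-nonneg (dX z≤n) (λ {p} p≤r → join-gain (N p) (N₁ p) (N′ p) (N≼N₁ p≤r) (N≼N′ p≤r))
        (cong₂ _-_ (cong₂ _-_ (start s′) (start s)) (cong₂ _-_ (start s₂) (start s₁)))
        (trans (cong₂ _-_ (cong₂ _-_ (end s′) (end s)) (cong₂ _-_ (end s₂) (end s₁))) (lem₀ (+ m))))
      where
      lem₀ : ∀ m → m - m - (m - m) ≡ 0ℤ
      lem₀ = solve-∀
    lem : ∀ w w₁ a b c d e f → e - c + w₁ + (b - a - (d - c)) - (w + 0ℤ) ≡ f - d + (w₁ + e - f) - (w + a - b)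
    lem = solve-∀

  -- Collecting adds to the pairing of the moving set with the current shape exactly what is
  -- collected, and a move to smaller rows can only enlarge that pairing. At the end it is bounded
  -- by the pairing with the largest set.
  Ach-bound : ∀ {m N M w} X l → (∀ {j} → j ≤ l → Dom (X j)) → State m N → State m M →
              (∀ {L} → State m L → L ≼ M) → Ach m X l N w → w + ⟪ N , X 0 ⟫ ℤ.≤ ⟪ M , X l ⟫
  Ach-bound {N = N} {M} {w} X zero dX s sM max (stop w≤0) =
    ≤-by₂ w≤0 (pair-mono s sM (dX z≤n) (max s)) (lem w ⟪ N , X 0 ⟫ ⟪ M , X 0 ⟫)
    where
    lem : ∀ w a b → 0ℤ + b - (w + a) ≡ b - (w + a)
    lem = solve-∀
  Ach-bound {N = N} {M} {w} X (suc l) dX s sM max (move N₁ w₁ s₁ N≼N₁ rest w≤) =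
    ℤP.≤-trans (≤-by₂ w≤ (pair-mono s s₁ (dX z≤n) N≼N₁) (lem w w₁ ⟪ N , X 0 ⟫ ⟪ N₁ , X 0 ⟫ ⟪ N₁ , X 1 ⟫))
      (Ach-bound (X ∘ suc) l (λ j≤l → dX (s≤s j≤l)) s₁ sM max rest)
    where
    lem : ∀ w w₁ a b c → c - b + w₁ + b - (w + a) ≡ w₁ + c - (w + a)
    lem = solve-∀

  -- The counting function of the set whose only row is `a`.
  after : ℕ → ℕ → ℤ
  after a       zero    = 0ℤ
  after zero    (suc p) = 1ℤ
  after (suc a) (suc p) = after a p

  slope-after : ∀ a p → slope (after a) p ≡ δ a p
  slope-after zero    zero    = refl
  slope-after zero    (suc p) = refl
  slope-after (suc a) zero    = refl
  slope-after (suc a) (suc p) = slope-after a p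

  after-≤ : ∀ {a b} → a ≤ b → ∀ p → after b p ℤ.≤ after a p
  after-≤ {a}     {b}     a≤b zero    = ℤP.≤-refl
  after-≤ {zero}  {zero}  a≤b (suc p) = ℤP.≤-refl
  after-≤ {zero}  {suc b} a≤b (suc p) = lem b p
    where
    lem : ∀ b p → after b p ℤ.≤ 1ℤ
    lem b       zero    = ℤ.+≤+ z≤n
    lem zero    (suc p) = ℤP.≤-refl
    lem (suc b) (suc p) = lem b p
  after-≤ {suc a} {suc b} a≤b (suc p) = after-≤ (ℕP.≤-pred a≤b) p

  after-< : ∀ {a p} → a < p → after a p ≡ 1ℤ
  after-< {zero}  {suc p} _   = refl
  after-< {suc a} {suc p} a<p = after-< (ℕP.≤-pred a<p)

  pair-after : ∀ {a} X → a < r → ⟪ after a , X ⟫ ≡ X a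
  pair-after {a} X a<r = trans (∑-cong r λ {p} _ → trans (cong (_* X p) (slope-after a p)) (ℤP.*-comm (δ a p) (X p))) (∑-δ r X a<r)

  swap : ℕ → ℕ → (ℕ → ℤ) → ℕ → ℤ
  swap lo hi N p = N p + (after lo p - after hi p)

  slope-swap : ∀ lo hi N p → slope (swap lo hi N) p ≡ slope N p + (δ lo p - δ hi p)
  slope-swap lo hi N p = trans (lem (N (suc p)) (N p) (after lo (suc p)) (after hi (suc p)) (after lo p) (after hi p))
    (cong (_+_ (slope N p)) (cong₂ _-_ (slope-after lo p) (slope-after hi p)))
    where
    lem : ∀ a b c d e f → a + (c - d) - (b + (e - f)) ≡ a - b + (c - e - (d - f))
    lem = solve-∀

  slope-swap-lo : ∀ {lo hi} N → lo < hi → slope (swap lo hi N) lo ≡ slope N lo + 1ℤ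
  slope-swap-lo {lo} {hi} N lt rewrite slope-swap lo hi N lo | δ-≡ lo | δ-≢ {hi} {lo} (λ e → ℕP.<⇒≢ lt (sym e)) = refl

  slope-swap-hi : ∀ {lo hi} N → lo < hi → slope (swap lo hi N) hi ≡ slope N hi - 1ℤ
  slope-swap-hi {lo} {hi} N lt rewrite slope-swap lo hi N hi | δ-≡ hi | δ-≢ {lo} {hi} (ℕP.<⇒≢ lt) = refl

  -- The strict inequality of slopes says that `hi` is in the set and `lo` is not, so `hi` may be
  -- exchanged for `lo`.
  swap-state : ∀ {m N lo hi} → lo < hi → lo < r → hi < r → slope N lo ℤ.< slope N hi → State m N → State m (swap lo hi N)
  swap-state {m} {N} {lo} {hi} lt lo<r hi<r y<y s = record
    { start = trans (lem₀ (N 0)) (start s)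
    ; end = trans (cong₂ (λ x y → N r + (x - y)) (after-< lo<r) (after-< hi<r)) (trans (lem₀ (N r)) (end s))
    ; slope≥0 = λ {p} p<r → lower p p<r
    ; slope≤1 = λ {p} p<r → upper p p<r
    }
    where
    lem₀ : ∀ x → x + 0ℤ ≡ x
    lem₀ = solve-∀
    y+1 : 1ℤ + slope N lo ℤ.≤ slope N hi
    y+1 = ℤP.i<j⇒suc[i]≤j y<y
    other : ∀ {p} → lo ≢ p → hi ≢ p → slope (swap lo hi N) p ≡ slope N p
    other {p} a b rewrite slope-swap lo hi N p | δ-≢ a | δ-≢ b = lem₀ (slope N p)
    lower : ∀ p → p < r → 0ℤ ℤ.≤ slope (swap lo hi N) p
    lower p p<r with lo ℕ.≟ p | hi ℕ.≟ p
    ... | yes refl | _ = subst (0ℤ ℤ.≤_) (sym (slope-swap-lo N lt)) (≤-by₂ (slope≥0 s p<r) (ℤ.+≤+ (z≤n {1})) (lem (slope N p)))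
      where
      lem : ∀ x → x + 1ℤ - (0ℤ + 0ℤ) ≡ x + 1ℤ - 0ℤ
      lem = solve-∀
    ... | no a | yes refl = subst (0ℤ ℤ.≤_) (sym (slope-swap-hi N lt)) (≤-by₂ y+1 (slope≥0 s lo<r) (lem (slope N lo) (slope N p)))
      where
      lem : ∀ x y → y + x - (1ℤ + x + 0ℤ) ≡ y - 1ℤ - 0ℤ
      lem = solve-∀
    ... | no a | no b = subst (0ℤ ℤ.≤_) (sym (other a b)) (slope≥0 s p<r)
    upper : ∀ p → p < r → slope (swap lo hi N) p ℤ.≤ 1ℤ
    upper p p<r with lo ℕ.≟ p | hi ℕ.≟ p
    ... | yes refl | _ = subst (ℤ._≤ 1ℤ) (trans (ℤP.+-comm 1ℤ (slope N p)) (sym (slope-swap-lo N lt))) (ℤP.≤-trans y+1 (slope≤1 s hi<r))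
    ... | no a | yes refl = subst (ℤ._≤ 1ℤ) (sym (slope-swap-hi N lt)) (≤-by₂ (slope≤1 s p<r) (ℤ.+≤+ (z≤n {1})) (lem (slope N p)))
      where
      lem : ∀ y → 1ℤ + 1ℤ - (y + 0ℤ) ≡ 1ℤ - (y - 1ℤ)
      lem = solve-∀
    ... | no a | no b = subst (ℤ._≤ 1ℤ) (sym (other a b)) (slope≤1 s p<r)

  swap-≽ : ∀ {lo hi} N → lo ≤ hi → N ≼ swap lo hi N
  swap-≽ {lo} {hi} N lo≤hi {p} _ = ≤-by (after-≤ lo≤hi p) (lem (N p) (after lo p) (after hi p))
    where
    lem : ∀ n a b → a - b ≡ n + (a - b) - n
    lem = solve-∀

  pair-swap : ∀ {lo hi} N X → lo < r → hi < r → ⟪ swap lo hi N , X ⟫ ≡ ⟪ N , X ⟫ + (X lo - X hi)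
  pair-swap {lo} {hi} N X lo<r hi<r = trans (pair-+ N _ X)
    (cong (_+_ ⟪ N , X ⟫) (trans (pair-- (after lo) (after hi) X) (cong₂ _-_ (pair-after X lo<r) (pair-after X hi<r))))

  gain-eq : ∀ N {ε a X Y} → Step ε a X Y → ⟪ N , Y ⟫ - ⟪ N , X ⟫ ≡ val ε (slope N a)
  gain-eq N {ε} {a} {X} s = trans (cong (_- ⟪ N , X ⟫) (pair-step N s)) (x+y-x≡y ⟪ N , X ⟫ (val ε (slope N a)))

-- Rectangles of cells and the complement relation

module Grids (r : ℕ) where
  open Cells r
  open Pairing r

  val-src-tgt : ∀ ε {lo hi} (f : ℕ → ℤ) → val ε (f (tgt ε lo hi)) - val ε (f (src ε lo hi)) ≡ f hi - f lo
  val-src-tgt ⊞ f = refl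
  val-src-tgt ⊟ {lo} {hi} f = lem (f lo) (f hi)
    where
    lem : ∀ x y → - x - - y ≡ y - x
    lem = solve-∀

  -- The exchanged set contains `lo`, where the lower step adds its cell, and avoids `hi`, where the
  -- lower step removes one; no set does better on the upper step.
  swap-gain : ∀ η {m N lo hi} → State m N → lo < hi → lo < r → hi < r →
              val η (slope N (tgt η lo hi)) ℤ.≤ val η (slope (swap lo hi N) (src η lo hi))
  swap-gain ⊞ {N = N} {lo} {hi} s lt lo<r hi<r = subst (slope N hi ℤ.≤_) (sym (slope-swap-lo N lt))
    (≤-by₂ {0ℤ} {slope N lo} {slope N hi} {1ℤ} {slope N hi} {slope N lo + 1ℤ} (slope≥0 s lo<r) (slope≤1 s hi<r) (lem (slope N lo) (slope N hi)))
    where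
    open State
    lem : ∀ x y → x + 1ℤ - (0ℤ + y) ≡ x + 1ℤ - y
    lem = solve-∀
  swap-gain ⊟ {N = N} {lo} {hi} s lt lo<r hi<r = subst (λ x → - slope N lo ℤ.≤ - x) (sym (slope-swap-hi N lt))
    (≤-by₂ {0ℤ} {slope N lo} {slope N hi} {1ℤ} { - slope N lo} { - (slope N hi - 1ℤ)} (slope≥0 s lo<r) (slope≤1 s hi<r) (lem (slope N lo) (slope N hi)))
    where
    open State
    lem : ∀ x y → x + 1ℤ - (0ℤ + y) ≡ - (y - 1ℤ) - - x
    lem = solve-∀

  gain-mono : ∀ η N {lo hi C D A B} → slope N hi ℤ.≤ slope N lo → Step η (src η lo hi) C D → Step η (tgt η lo hi) A B →
              ⟪ N , B ⟫ - ⟪ N , A ⟫ ℤ.≤ ⟪ N , D ⟫ - ⟪ N , C ⟫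
  gain-mono η N {lo} {hi} le bo to = subst₂ ℤ._≤_ (sym (gain-eq N to)) (sym (gain-eq N bo))
    (≤-by {slope N hi} {slope N lo} {t} {s} le
      (trans (lem (slope N lo) (slope N hi)) (trans (cong -_ (sym (val-src-tgt η (slope N)))) (sym (lem s t)))))
    where
    s t : ℤ
    s = val η (slope N (src η lo hi))
    t = val η (slope N (tgt η lo hi))
    lem : ∀ x y → x - y ≡ - (y - x)
    lem = solve-∀

  Ach-strip : ∀ {m N w} X Y l → (∀ {j} → j ≤ l → Dom (Y j)) →
              (∀ {j} → j < l → Sq (X j) (Y j) (X (suc j)) (Y (suc j))) → Ach m Y l N w → Ach m X l N w
  Ach-strip X Y zero dY sq (stop w≤0) = stop w≤0
  Ach-strip {m} {N} {w} X Y (suc l) dY sq (move N₁ w₁ s₁ N≼N₁ rest w≤) = go (sq (s≤s z≤n))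
    where
    recur : ∀ {N w} → Ach m (Y ∘ suc) l N w → Ach m (X ∘ suc) l N w
    recur = Ach-strip (X ∘ suc) (Y ∘ suc) l (λ j≤l → dY (s≤s j≤l)) (λ j<l → sq (s≤s j<l))
    keep : ⟪ N₁ , Y 1 ⟫ - ⟪ N₁ , Y 0 ⟫ ℤ.≤ ⟪ N₁ , X 1 ⟫ - ⟪ N₁ , X 0 ⟫ → Ach m X (suc l) N w
    keep le = move N₁ w₁ s₁ N≼N₁ (recur rest) (ℤP.≤-trans w≤ (ℤP.+-monoˡ-≤ w₁ le))
    exchange : ∀ η {lo hi} → lo < hi → lo < r → hi < r → slope N₁ lo ℤ.< slope N₁ hi → Y 1 lo ≡ Y 1 hi →
               Step η (src η lo hi) (X 0) (X 1) → Step η (tgt η lo hi) (Y 0) (Y 1) → Ach m X (suc l) N w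
    exchange η {lo} {hi} lt lo<r hi<r y<y flat bo to =
      move N₂ w₁ s₂ (λ p≤r → ℤP.≤-trans (N≼N₁ p≤r) (swap-≽ N₁ (ℕP.<⇒≤ lt) p≤r)) (recur rest′)
        (ℤP.≤-trans w≤ (ℤP.+-monoˡ-≤ w₁ (subst₂ ℤ._≤_ (sym (gain-eq N₁ to)) (sym (gain-eq N₂ bo)) (swap-gain η s₁ lt lo<r hi<r))))
      where
      N₂ : ℕ → ℤ
      N₂ = swap lo hi N₁
      s₂ : State m N₂
      s₂ = swap-state lt lo<r hi<r y<y s₁
      -- The rows `lo` and `hi` agree in the upper right corner `Y 1`, so the lead of the exchanged
      -- set there is zero and `Ach-lower` loses nothing.
      free : w₁ + ⟪ N₁ , Y 1 ⟫ - ⟪ N₂ , Y 1 ⟫ ≡ w₁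
      free = trans (cong (λ x → w₁ + ⟪ N₁ , Y 1 ⟫ - x) (trans (pair-swap N₁ (Y 1) lo<r hi<r)
               (cong (λ x → ⟪ N₁ , Y 1 ⟫ + (x - Y 1 hi)) flat)))
             (lem w₁ ⟪ N₁ , Y 1 ⟫ (Y 1 hi))
        where
        lem : ∀ w a b → w + a - (a + (b - b)) ≡ w
        lem = solve-∀
      rest′ : Ach m (Y ∘ suc) l N₂ w₁
      rest′ = subst (Ach m (Y ∘ suc) l N₂) free
        (Ach-lower (Y ∘ suc) l (λ j≤l → dY (s≤s j≤l)) s₁ s₂ (swap-≽ N₁ (ℕP.<⇒≤ lt)) rest)
    go : Sq (X 0) (Y 0) (X 1) (Y 1) → Ach m X (suc l) N w
    go (straight ε a η d le ri bo to) = keep (ℤP.≤-reflexive (trans (gain-eq N₁ to) (sym (gain-eq N₁ bo))))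
    go (bend ε η lo hi lt fl le ri bo to) = choose (slope N₁ hi ℤ.≤? slope N₁ lo)
      where
      bounds : lo < r × hi < r
      bounds = bend-bounds lt le ri
      choose : Dec (slope N₁ hi ℤ.≤ slope N₁ lo) → Ach m X (suc l) N w
      choose (yes hi≤lo) = keep (gain-mono η N₁ hi≤lo bo to)
      choose (no hi≰lo) = exchange η lt (proj₁ bounds) (proj₂ bounds) (ℤP.≰⇒> hi≰lo) (bend-upper-flat lt fl le ri bo to) bo to

  Grid : ℕ → ℕ → (ℕ → ℕ → V) → Set
  Grid p q G = (∀ {i j} → i ≤ p → j ≤ q → Dom (G i j)) ×
               (∀ {i j} → i < p → j < q → Sq (G i j) (G (suc i) j) (G i (suc j)) (G (suc i) (suc j)))

  Grid-transpose : ∀ {p q G} → Grid p q G → Grid q p (λ i j → G j i)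
  Grid-transpose (d , sq) = (λ i≤q j≤p → d j≤p i≤q) , (λ i<q j<p → Sq-transpose (sq j<p i<q))

  Ach-grid : ∀ {m N w} p q G → Grid p q G → Ach m (G p) q N w → Ach m (G 0) q N w
  Ach-grid zero    q G g a = a
  Ach-grid (suc p) q G (d , sq) a = Ach-grid p q G ((λ i≤p → d (ℕP.m≤n⇒m≤1+n i≤p)) , (λ i<p → sq (ℕP.m<n⇒m<1+n i<p)))
    (Ach-strip (G p) (G (suc p)) q (λ j≤q → d ℕP.≤-refl j≤q) (λ j<q → sq ℕP.≤-refl j<q) a)

  open State

  -- The set of the first `m` rows.
  ramp : ℕ → ℕ → ℤ
  ramp m p = + (p ℕ.⊓ m)

  slope-ramp-< : ∀ {m p} → p < m → slope (ramp m) p ≡ 1ℤ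
  slope-ramp-< {m} {p} p<m rewrite ℕP.m≤n⇒m⊓n≡m p<m | ℕP.m≤n⇒m⊓n≡m (ℕP.<⇒≤ p<m) = lem (+ p)
    where
    lem : ∀ x → 1ℤ + x - x ≡ 1ℤ
    lem = solve-∀

  slope-ramp-≥ : ∀ {m p} → m ≤ p → slope (ramp m) p ≡ 0ℤ
  slope-ramp-≥ {m} {p} m≤p rewrite ℕP.m≥n⇒m⊓n≡n (ℕP.m≤n⇒m≤1+n m≤p) | ℕP.m≥n⇒m⊓n≡n m≤p = ℤP.+-inverseʳ (+ m)

  slope-ramp : ∀ m p → slope (ramp m) p ≡ 0ℤ ⊎ slope (ramp m) p ≡ 1ℤ
  slope-ramp m p with p ℕ.<? m
  ... | yes p<m = inj₂ (slope-ramp-< p<m)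
  ... | no p≮m = inj₁ (slope-ramp-≥ (ℕP.≮⇒≥ p≮m))

  ramp-state : ∀ {m} → m ≤ r → State m (ramp m)
  ramp-state {m} m≤r = record
    { start = refl
    ; end = cong +_ (ℕP.m≥n⇒m⊓n≡n m≤r)
    ; slope≥0 = λ {p} _ → lower (slope-ramp m p)
    ; slope≤1 = λ {p} _ → upper (slope-ramp m p)
    }
    where
    lower : ∀ {x} → x ≡ 0ℤ ⊎ x ≡ 1ℤ → 0ℤ ℤ.≤ x
    lower (inj₁ refl) = ℤP.≤-refl
    lower (inj₂ refl) = ℤ.+≤+ z≤n
    upper : ∀ {x} → x ≡ 0ℤ ⊎ x ≡ 1ℤ → x ℤ.≤ 1ℤ
    upper (inj₁ refl) = ℤ.+≤+ z≤n
    upper (inj₂ refl) = ℤP.≤-refl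

  -- Slopes of at most one give the bound `p`; slopes of at least zero together with the end value
  -- give the bound `m`.
  ramp-max : ∀ {m N} → m ≤ r → State m N → N ≼ ramp m
  ramp-max {m} {N} m≤r s {p} p≤r with p ℕ.≤? m
  ... | yes p≤m rewrite ℕP.m≤n⇒m⊓n≡m p≤m = le p p≤r
    where
    le : ∀ p → p ≤ r → N p ℤ.≤ + p
    le zero    _   = ℤP.≤-reflexive (start s)
    le (suc p) p<r = ≤-by₂ (slope≤1 s p<r) (le p (ℕP.<⇒≤ p<r)) (lem (N (suc p)) (N p) (+ p))
      where
      lem : ∀ a b p → 1ℤ + p - (a - b + b) ≡ 1ℤ + p - a
      lem = solve-∀
  ... | no p≰m rewrite ℕP.m≥n⇒m⊓n≡n (ℕP.<⇒≤ (ℕP.≰⇒> p≰m)) = ge (r ∸ p) (ℕP.m+[n∸m]≡n p≤r)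
    where
    ge : ∀ f {p} → p ℕ.+ f ≡ r → N p ℤ.≤ + m
    ge zero    {p} eq = ℤP.≤-reflexive (trans (cong N (trans (sym (ℕP.+-identityʳ p)) eq)) (end s))
    ge (suc f) {p} eq = ≤-by₂ (slope≥0 s (subst (p <_) eq (ℕP.m<m+n p (s≤s z≤n)))) (ge f {suc p} (trans (sym (ℕP.+-suc p f)) eq))
        (lem (N (suc p)) (N p) (+ m))
      where
      lem : ∀ a b p → a - b + p - (0ℤ + a) ≡ p - b
      lem = solve-∀

  pair-ramp : ∀ {m} X → m ≤ r → ⟪ ramp m , X ⟫ ≡ ∑ m X
  pair-ramp {m} X m≤r = trans (cong (λ n → ∑ n (λ p → slope (ramp m) p * X p)) (sym (ℕP.m+[n∸m]≡n m≤r))) (go (r ∸ m))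
    where
    go : ∀ k → ∑ (m ℕ.+ k) (λ p → slope (ramp m) p * X p) ≡ ∑ m X
    go zero rewrite ℕP.+-identityʳ m = ∑-cong m λ {p} p<m → trans (cong (_* X p) (slope-ramp-< p<m)) (ℤP.*-identityˡ (X p))
    go (suc k) rewrite ℕP.+-suc m k | slope-ramp-≥ (ℕP.m≤m+n m k) = trans (lem (∑ (m ℕ.+ k) (λ p → slope (ramp m) p * X p)) (X (m ℕ.+ k))) (go k)
      where
      lem : ∀ s x → s + 0ℤ * x ≡ s
      lem = solve-∀

  -- the last m rows
  coramp : ℕ → ℕ → ℤ
  coramp m p = ramp r p - ramp (r ∸ m) p

  coramp-state : ∀ {m} → m ≤ r → State m (coramp m)
  coramp-state {m} m≤r = record
    { start = refl
    ; end = trans (cong₂ _-_ (end (ramp-state ℕP.≤-refl)) (end (ramp-state (ℕP.m∸n≤m r m))))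
              (trans (cong (_- + (r ∸ m)) (cong +_ (sym (ℕP.m+[n∸m]≡n m≤r)))) (x+y-y≡x (+ m) (+ (r ∸ m))))
    ; slope≥0 = λ {p} p<r → subst (0ℤ ℤ.≤_) (sym (eq p<r)) (lower (slope-ramp (r ∸ m) p))
    ; slope≤1 = λ {p} p<r → subst (ℤ._≤ 1ℤ) (sym (eq p<r)) (upper (slope-ramp (r ∸ m) p))
    }
    where
    lem : ∀ a b c d → a - c - (b - d) ≡ a - b - (c - d)
    lem = solve-∀
    eq : ∀ {p} → p < r → slope (coramp m) p ≡ 1ℤ - slope (ramp (r ∸ m)) p
    eq {p} p<r = trans (lem (ramp r (suc p)) (ramp r p) (ramp (r ∸ m) (suc p)) (ramp (r ∸ m) p)) (cong (_- slope (ramp (r ∸ m)) p) (slope-ramp-< p<r))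
    lower : ∀ {x} → x ≡ 0ℤ ⊎ x ≡ 1ℤ → 0ℤ ℤ.≤ 1ℤ - x
    lower (inj₁ refl) = ℤ.+≤+ z≤n
    lower (inj₂ refl) = ℤP.≤-refl
    upper : ∀ {x} → x ≡ 0ℤ ⊎ x ≡ 1ℤ → 1ℤ - x ℤ.≤ 1ℤ
    upper (inj₁ refl) = ℤP.≤-refl
    upper (inj₂ refl) = ℤ.+≤+ z≤n

  pair-coramp : ∀ {m} X → m ≤ r → ⟪ coramp m , X ⟫ ≡ ∑ r X - ∑ (r ∸ m) X
  pair-coramp {m} X m≤r = trans (pair-- (ramp r) (ramp (r ∸ m)) X)
    (cong₂ _-_ (pair-ramp X ℕP.≤-refl) (pair-ramp X (ℕP.m∸n≤m r m)))

  -- Let the set rest along the top row, carry what it collects down to the bottom row with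
  -- `Ach-grid`, and bound it there. The zero corner removes the starting term, and the largest set
  -- is that of the first `m` rows.
  grid-inequality : ∀ {p q G m N} → Grid p q G → G 0 0 ≐ (λ _ → 0ℤ) → m ≤ r → State m N →
                    ⟪ N , G p q ⟫ - ⟪ N , G p 0 ⟫ ℤ.≤ ∑ m (G 0 q)
  grid-inequality {p} {q} {G} {m} {N} (d , sq) G₀ m≤r s = subst₂ ℤ._≤_
    (trans (cong (_+_ (⟪ N , G p q ⟫ - ⟪ N , G p 0 ⟫)) (∑-zero r λ {x} x<r → trans (cong (slope N x *_) (G₀ x<r)) (ℤP.*-zeroʳ (slope N x)))) (ℤP.+-identityʳ _))
    (pair-ramp (G 0 q) m≤r)
    (Ach-bound (G 0) q (λ j≤q → d z≤n j≤q) s (ramp-state m≤r) (ramp-max m≤r)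
      (Ach-grid p q G (d , sq) (Ach-stay (G p) q s)))

  sum-Sq : ∀ {C A D B} → Sq C A D B → ∑ r B + ∑ r C ≡ ∑ r A + ∑ r D
  sum-Sq {C} {A} {D} {B} s = trans (cong₂ _+_ (sym (id B)) (sym (id C))) (trans (go s) (cong₂ _+_ (id A) (id D)))
    where
    id : ∀ X → ⟪ ramp r , X ⟫ ≡ ∑ r X
    id X = pair-ramp X ℕP.≤-refl
    lem : ∀ a c e e′ → e ≡ e′ → a + e + c ≡ a + (c + e′)
    lem a c e _ refl = lem₀ a c e
      where
      lem₀ : ∀ a c e → a + e + c ≡ a + (c + e)
      lem₀ = solve-∀
    go : Sq C A D B → ⟪ ramp r , B ⟫ + ⟪ ramp r , C ⟫ ≡ ⟪ ramp r , A ⟫ + ⟪ ramp r , D ⟫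
    go (straight ε a η d le ri bo to) = trans (cong (_+ ⟪ ramp r , C ⟫) (pair-step (ramp r) to))
      (trans (lem ⟪ ramp r , A ⟫ ⟪ ramp r , C ⟫ (val η (slope (ramp r) d)) (val η (slope (ramp r) d)) refl) (cong (_+_ ⟪ ramp r , A ⟫) (sym (pair-step (ramp r) bo))))
    go (bend ε η lo hi lt fl le ri bo to) = trans (cong (_+ ⟪ ramp r , C ⟫) (pair-step (ramp r) to))
      (trans (lem ⟪ ramp r , A ⟫ ⟪ ramp r , C ⟫ (val η (slope (ramp r) (tgt η lo hi))) (val η (slope (ramp r) (src η lo hi)))
        (cong (val η) (trans (slope-ramp-< (bound to)) (sym (slope-ramp-< (bound bo)))))) (cong (_+_ ⟪ ramp r , A ⟫) (sym (pair-step (ramp r) bo))))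

  sum-grid : ∀ p q G → Grid p q G → ∑ r (G p q) + ∑ r (G 0 0) ≡ ∑ r (G p 0) + ∑ r (G 0 q)
  sum-grid zero q G g = ℤP.+-comm (∑ r (G 0 q)) _
  sum-grid (suc p) q G (d , sq) = lem (S (suc p) q) (S p 0) (S (suc p) 0) (S p q) (S 0 0) (S 0 q) (strip q ℕP.≤-refl)
    (sum-grid p q G ((λ i≤p → d (ℕP.m≤n⇒m≤1+n i≤p)) , (λ i<p → sq (ℕP.m<n⇒m<1+n i<p))))
    where
    S : ℕ → ℕ → ℤ
    S i j = ∑ r (G i j)
    lem : ∀ a b c d e f → a + b ≡ c + d → d + e ≡ b + f → a + e ≡ c + f
    lem a b c d e f p q = +-cancelˡ (b + d) (trans (l₁ a b d e) (trans (cong₂ _+_ p q) (l₂ c d b f)))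
      where
      l₁ : ∀ a b d e → b + d + (a + e) ≡ a + b + (d + e)
      l₁ = solve-∀
      l₂ : ∀ c d b f → c + d + (b + f) ≡ b + d + (c + f)
      l₂ = solve-∀
    strip : ∀ j → j ≤ q → ∑ r (G (suc p) j) + ∑ r (G p 0) ≡ ∑ r (G (suc p) 0) + ∑ r (G p j)
    strip zero    _   = refl
    strip (suc j) j<q = lem′ (S (suc p) (suc j)) (S p j) (S (suc p) j) (S p (suc j)) (S p 0) (S (suc p) 0) (sum-Sq (sq ℕP.≤-refl j<q)) (strip j (ℕP.<⇒≤ j<q))
      where
      lem′ : ∀ a b c d e f → a + b ≡ c + d → c + e ≡ f + b → a + e ≡ f + d
      lem′ a b c d e f p q = +-cancelˡ (b + c) (trans (l₁ a b c e) (trans (cong₂ _+_ p q) (l₂ c d b f)))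
        where
        l₁ : ∀ a b d e → b + d + (a + e) ≡ a + b + (d + e)
        l₁ = solve-∀
        l₂ : ∀ c d b f → c + d + (f + b) ≡ b + c + (f + d)
        l₂ = solve-∀

  -- The inequality for the last m rows and, transposed, for the last r − m rows
  -- pinches the partial sums of G 0 q.
  grid-complement : ∀ {p q G k} → Grid p q G → G 0 0 ≐ (λ _ → 0ℤ) → G p q ≐ (λ _ → k) → G 0 q ≐ κ k (G p 0)
  grid-complement {p} {q} {G} {k} g G₀ Gpq {m} m<r =
    trans (sym (x+y-x≡y (∑ m ν) (ν m))) (trans (cong₂ _-_ (partial (suc m) m<r) (partial m (ℕP.<⇒≤ m<r)))
      (trans (cong (λ n → K (suc m) - ∑ r μ + ∑ (rev m) μ - (K m - ∑ r μ + ∑ n μ)) (ℕP.+-∸-assoc 1 m<r))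
      (lem₂ (K m) k (∑ r μ) (∑ (rev m) μ) (μ (rev m)))))
    where
    μ ν : V
    μ = G p 0
    ν = G 0 q
    K : ℕ → ℤ
    K n = ∑ n (λ _ → k)
    K-+ : ∀ a b → K (a ℕ.+ b) ≡ K a + K b
    K-+ a zero    = trans (cong K (ℕP.+-identityʳ a)) (sym (ℤP.+-identityʳ (K a)))
    K-+ a (suc b) = trans (cong K (ℕP.+-suc a b)) (trans (cong (_+ k) (K-+ a b)) (ℤP.+-assoc (K a) (K b) k))
    K-∸ : ∀ {m} → m ≤ r → K r - K (r ∸ m) ≡ K m
    K-∸ {m} m≤r = trans (cong (_- K (r ∸ m)) (trans (cong K (sym (ℕP.m+[n∸m]≡n m≤r))) (K-+ m (r ∸ m)))) (x+y-y≡x (K m) (K (r ∸ m)))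
    corner-sum : ∑ r (G p q) + ∑ r (G 0 0) ≡ K r
    corner-sum = trans (cong₂ _+_ (∑-cong r Gpq) (∑-zero r G₀)) (ℤP.+-identityʳ (K r))
    total : ∑ r ν ≡ K r - ∑ r μ
    total = trans (sym (x+y-x≡y (∑ r μ) (∑ r ν))) (cong (_- ∑ r μ) (trans (sym (sum-grid p q G g)) corner-sum))
    corner : ∀ {m} → m ≤ r → ⟪ coramp m , G p q ⟫ ≡ K m
    corner {m} m≤r = trans (pair-coramp (G p q) m≤r) (trans (cong₂ _-_ (∑-cong r Gpq)
      (∑-cong (r ∸ m) λ x<n → Gpq (ℕP.<-≤-trans x<n (ℕP.m∸n≤m r m)))) (K-∸ m≤r))
    partial : ∀ m → m ≤ r → ∑ m ν ≡ K m - ∑ r μ + ∑ (r ∸ m) μ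
    -- The transposed inequality involves the last `r ∸ m` entries of `ν`; as the total of `ν` is
    -- known from the corners, it bounds the first `m` from above. The direct inequality bounds them
    -- from below.
    partial m m≤r = ℤP.≤-antisym
      (≤-by (subst₂ (λ x y → x - y ℤ.≤ ∑ (r ∸ m) μ) (corner (ℕP.m∸n≤m r m))
               (trans (pair-coramp ν (ℕP.m∸n≤m r m)) (cong₂ _-_ total (cong (λ n → ∑ n ν) (ℕP.m∸[m∸n]≡n m≤r))))
               (grid-inequality (Grid-transpose g) G₀ (ℕP.m∸n≤m r m) (coramp-state (ℕP.m∸n≤m r m))))
             (trans (cong (λ x → ∑ (r ∸ m) μ - (K (r ∸ m) - (x - ∑ r μ - ∑ m ν))) (trans (l₀ (K r) (K (r ∸ m))) (cong (_+ K (r ∸ m)) (K-∸ m≤r))))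
               (l₁ (∑ (r ∸ m) μ) (K m) (K (r ∸ m)) (∑ r μ) (∑ m ν))))
      (≤-by (subst₂ (λ x y → x - y ℤ.≤ ∑ m ν) (corner m≤r) (pair-coramp μ m≤r) (grid-inequality g G₀ m≤r (coramp-state m≤r)))
        (l₂ (K m) (∑ r μ) (∑ (r ∸ m) μ) (∑ m ν)))
      where
      l₀ : ∀ x y → x ≡ x - y + y
      l₀ = solve-∀
      l₁ : ∀ t k k′ s n → t - (k′ - (k + k′ - s - n)) ≡ k - s + t - n
      l₁ = solve-∀
      l₂ : ∀ k s t n → n - (k - (s - t)) ≡ n - (k - s + t)
      l₂ = solve-∀
    lem₂ : ∀ K k s t x → K + k - s + t - (K - s + (t + x)) ≡ k - x
    lem₂ = solve-∀

-- Lists read as functions of the index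

nth : ∀ {A : Set} → A → List A → ℕ → A
nth d []       _       = d
nth d (x ∷ xs) zero    = x
nth d (x ∷ xs) (suc k) = nth d xs k

get : Shape → V
get = nth 0ℤ

at-nth : ∀ T k → at T k ≡ nth [] T k
at-nth []      k       = refl
at-nth (x ∷ T) zero    = refl
at-nth (x ∷ T) (suc k) = at-nth T k

nth-++ˡ : ∀ {A : Set} (d : A) xs ys {k} → k < length xs → nth d (xs ++ ys) k ≡ nth d xs k
nth-++ˡ d (x ∷ xs) ys {zero}  _  = refl
nth-++ˡ d (x ∷ xs) ys {suc k} lt = nth-++ˡ d xs ys (ℕP.≤-pred lt)

nth-++ʳ : ∀ {A : Set} (d : A) xs ys k → nth d (xs ++ ys) (length xs ℕ.+ k) ≡ nth d ys k
nth-++ʳ d []       ys k = refl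
nth-++ʳ d (x ∷ xs) ys k = nth-++ʳ d xs ys k

nth-reverse : ∀ {A : Set} (d : A) xs {k} → k < length xs → nth d (reverse xs) k ≡ nth d xs (length xs ∸ suc k)
nth-reverse d (x ∷ xs) {k} k≤n rewrite ListP.unfold-reverse x xs with k ℕ.<? length xs
... | yes k<n = trans (nth-++ˡ d (reverse xs) [ x ] (subst (k <_) (sym (ListP.length-reverse xs)) k<n))
                (trans (nth-reverse d xs k<n) (sym (cong (nth d (x ∷ xs)) (ℕP.+-∸-assoc 1 k<n))))
... | no k≮n with ℕP.≤-antisym (ℕP.≤-pred k≤n) (ℕP.≮⇒≥ k≮n)
...   | refl rewrite ℕP.n∸n≡0 (length xs) =
        trans (cong (nth d (reverse xs ++ [ x ])) (sym (trans (ℕP.+-identityʳ _) (ListP.length-reverse xs))))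
              (nth-++ʳ d (reverse xs) [ x ] 0)

nth-map : ∀ {A B : Set} (d : A) (d′ : B) (f : A → B) xs {k} → k < length xs → nth d′ (map f xs) k ≡ f (nth d xs k)
nth-map d d′ f (x ∷ xs) {zero}  _  = refl
nth-map d d′ f (x ∷ xs) {suc k} lt = nth-map d d′ f xs (ℕP.≤-pred lt)

nth-applyUpTo : ∀ {A : Set} (d : A) (f : ℕ → A) n {k} → k < n → nth d (applyUpTo f n) k ≡ f k
nth-applyUpTo d f (suc n) {zero}  _  = refl
nth-applyUpTo d f (suc n) {suc k} lt = nth-applyUpTo d (f ∘ suc) n (ℕP.≤-pred lt)

nth-ext : ∀ {A : Set} (d : A) xs ys → length xs ≡ length ys → (∀ {k} → k < length xs → nth d xs k ≡ nth d ys k) → xs ≡ ys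
nth-ext d []       []       _  _  = refl
nth-ext d (x ∷ xs) (y ∷ ys) le eq =
  cong₂ _∷_ (eq (s≤s z≤n)) (nth-ext d xs ys (ℕP.suc-injective le) (λ k<n → eq (s≤s k<n)))

module _ (_∙_ : ℤ → ℤ → ℤ) (0∙0 : 0ℤ ∙ 0ℤ ≡ 0ℤ) where

  -- Past the end of both lists the default value has to reproduce itself, hence the condition
  -- `0∙0`.
  get-zipWith : ∀ xs ys → length xs ≡ length ys → ∀ p → get (zipWith _∙_ xs ys) p ≡ get xs p ∙ get ys p
  get-zipWith []       []       _  p       = sym 0∙0
  get-zipWith (x ∷ xs) (y ∷ ys) le zero    = refl
  get-zipWith (x ∷ xs) (y ∷ ys) le (suc p) = get-zipWith xs ys (ℕP.suc-injective le) p

get-⊕ : ∀ {xs ys} → length xs ≡ length ys → ∀ p → get (xs ⊕ ys) p ≡ get xs p + get ys p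
get-⊕ {xs} {ys} = get-zipWith _+_ refl xs ys

get-⊖ : ∀ {xs ys} → length xs ≡ length ys → ∀ p → get (xs ⊖ ys) p ≡ get xs p - get ys p
get-⊖ {xs} {ys} = get-zipWith _-_ refl xs ys

length-zipWith-≡ : ∀ (f : ℤ → ℤ → ℤ) xs ys → length xs ≡ length ys → length (zipWith f xs ys) ≡ length xs
length-zipWith-≡ f []       []       _  = refl
length-zipWith-≡ f (x ∷ xs) (y ∷ ys) le = cong suc (length-zipWith-≡ f xs ys (ℕP.suc-injective le))

get-replicate : ∀ n x {p} → p < n → get (replicate n x) p ≡ x
get-replicate (suc n) x {zero}  _  = refl
get-replicate (suc n) x {suc p} lt = get-replicate n x (ℕP.≤-pred lt)

letter : Sgn → ℕ → ℤ
letter ⊞ a = + suc a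
letter ⊟ a = -[1+ a ]

δ-≡ᵇ : ∀ a p → (if p ℕ.≡ᵇ a then 1ℤ else 0ℤ) ≡ δ a p
δ-≡ᵇ zero    zero    = refl
δ-≡ᵇ zero    (suc p) = refl
δ-≡ᵇ (suc a) zero    = refl
δ-≡ᵇ (suc a) (suc p) = δ-≡ᵇ a p

-δ-≡ᵇ : ∀ a p → (if p ℕ.≡ᵇ a then -[1+ 0 ] else 0ℤ) ≡ - δ a p
-δ-≡ᵇ zero    zero    = refl
-δ-≡ᵇ zero    (suc p) = refl
-δ-≡ᵇ (suc a) zero    = refl
-δ-≡ᵇ (suc a) (suc p) = -δ-≡ᵇ a p

get-e : ∀ r ε a {p} → p < r → get (e r (letter ε a)) p ≡ unit ε a p
get-e r ε a {p} p<r = go ε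
  where
  go : ∀ ε → get (e r (letter ε a)) p ≡ unit ε a p
  go ⊞ = trans (nth-map 0 0ℤ _ (upTo r) (subst (p <_) (sym (ListP.length-upTo r)) p<r))
               (trans (cong (λ q → if q ℕ.≡ᵇ a then 1ℤ else 0ℤ) (nth-applyUpTo 0 (λ x → x) r p<r)) (δ-≡ᵇ a p))
  go ⊟ = trans (nth-map 0 0ℤ _ (upTo r) (subst (p <_) (sym (ListP.length-upTo r)) p<r))
               (trans (cong (λ q → if q ℕ.≡ᵇ a then -[1+ 0 ] else 0ℤ) (nth-applyUpTo 0 (λ x → x) r p<r)) (-δ-≡ᵇ a p))

length-e : ∀ r ε a → length (e r (letter ε a)) ≡ r
length-e r ⊞ a = trans (ListP.length-map _ (upTo r)) (ListP.length-upTo r)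
length-e r ⊟ a = trans (ListP.length-map _ (upTo r)) (ListP.length-upTo r)

∑-cons : ∀ n f → ∑ (suc n) f ≡ f 0 + ∑ n (f ∘ suc)
∑-cons zero    f = ℤP.+-comm 0ℤ (f 0)
∑-cons (suc n) f = trans (cong (_+ f (suc n)) (∑-cons n f)) (ℤP.+-assoc (f 0) (∑ n (f ∘ suc)) (f (suc n)))

∑-list : (ℤ → ℤ) → List ℤ → ℤ
∑-list f []       = 0ℤ
∑-list f (x ∷ xs) = f x + ∑-list f xs

∑-list-get : ∀ f xs → ∑ (length xs) (f ∘ get xs) ≡ ∑-list f xs
∑-list-get f []       = refl
∑-list-get f (x ∷ xs) = trans (∑-cons (length xs) (f ∘ get (x ∷ xs))) (cong (_+_ (f x)) (∑-list-get f xs))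

∑-list-↭ : ∀ f {xs ys} → xs ↭ ys → ∑-list f xs ≡ ∑-list f ys
∑-list-↭ f Perm.refl = refl
∑-list-↭ f (Perm.prep x p) = cong (_+_ (f x)) (∑-list-↭ f p)
∑-list-↭ f (Perm.swap {xs} {ys} x y p) = trans (cong (λ s → f x + (f y + s)) (∑-list-↭ f p)) (lem (f x) (f y) (∑-list f ys))
  where
  lem : ∀ a b c → a + (b + c) ≡ b + (a + c)
  lem = solve-∀
∑-list-↭ f (Perm.trans p q) = trans (∑-list-↭ f p) (∑-list-↭ f q)

-- Sorting and multisets of entries

module Shapes (r : ℕ) where
  open Cells r

  Dom-of-steps : ∀ {X} → (∀ {p} → suc p < r → X (suc p) ℤ.≤ X p) → Dom X
  Dom-of-steps {X} st {p} {q} p≤q = go (ℕP.≤⇒≤′ p≤q)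
    where
    go : ∀ {q} → p ℕ.≤′ q → q < r → X q ℤ.≤ X p
    go ℕ.≤′-refl q<r = ℤP.≤-refl
    go (ℕ.≤′-step le) q<r = ℤP.≤-trans (st q<r) (go le (ℕP.<-trans (ℕP.n<1+n _) q<r))

  Linked-get : ∀ {R : ℤ → ℤ → Set} {xs} → Linked R xs → ∀ {p} → suc p < length xs → R (get xs p) (get xs (suc p))
  Linked-get [-] (s≤s ())
  Linked-get (x ∷ l) {zero}  _  = x
  Linked-get (x ∷ l) {suc p} lt = Linked-get l (ℕP.≤-pred lt)

  Dom-Decreasing : ∀ {μ} → length μ ≡ r → Decreasing μ → Dom (get μ)
  Dom-Decreasing le d = Dom-of-steps λ {p} lt → Linked-get d (subst (suc p <_) (sym le) lt)

  -- X and Y have the same entries up to order.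
  infix 4 _≈_
  record _≈_ (X Y : V) : Set where
    constructor same-sums
    field
      sums : ∀ f → ∑ r (f ∘ X) ≡ ∑ r (f ∘ Y)

  open _≈_

  ≐⇒≈ : ∀ {X Y} → X ≐ Y → X ≈ Y
  ≐⇒≈ eq = same-sums λ f → ∑-cong r λ p<r → cong f (eq p<r)

  ≈-trans : ∀ {X Y Z} → X ≈ Y → Y ≈ Z → X ≈ Z
  ≈-trans p q = same-sums λ f → trans (sums p f) (sums q f)

  ≈-sym : ∀ {X Y} → X ≈ Y → Y ≈ X
  ≈-sym p = same-sums λ f → sym (sums p f)

  -- Both changes replace one occurrence of the same value by the same new value.
  ≈-add : ∀ η {c d Z} → c < r → d < r → Z c ≡ Z d → add η c Z ≈ add η d Z
  ≈-add η {c} {d} {Z} c<r d<r eq = same-sums λ f →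
      trans (one f c<r) (trans (cong (λ z → ∑ r (f ∘ Z) + (f (z + val η 1ℤ) - f z)) eq) (sym (one f d<r)))
    where
    term : ∀ (f : ℤ → ℤ) c p → f (Z p + unit η c p) ≡ f (Z p) + (f (Z c + val η 1ℤ) - f (Z c)) * δ c p
    term f c p with c ℕ.≟ p
    ... | no ne = trans (cong (λ u → f (Z p + u)) (unit-≢ η ne))
                  (trans (cong f (ℤP.+-identityʳ (Z p)))
                  (trans (l (f (Z p)) (f (Z c + val η 1ℤ) - f (Z c))) (cong (λ u → f (Z p) + (f (Z c + val η 1ℤ) - f (Z c)) * u) (sym (δ-≢ ne)))))
      where
      l : ∀ x y → x ≡ x + y * 0ℤ
      l = solve-∀
    ... | yes refl = trans (cong (λ u → f (Z c + u)) (unit-val η)) (trans (l (f (Z c)) (f (Z c + val η 1ℤ)))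
                     (cong (λ u → f (Z c) + (f (Z c + val η 1ℤ) - f (Z c)) * u) (sym (δ-≡ c))))
      where
      l : ∀ x y → y ≡ x + (y - x) * 1ℤ
      l = solve-∀
      unit-val : ∀ η → unit η c c ≡ val η 1ℤ
      unit-val ⊞ = δ-≡ c
      unit-val ⊟ = cong -_ (δ-≡ c)
    one : ∀ f {c} → c < r → ∑ r (f ∘ add η c Z) ≡ ∑ r (f ∘ Z) + (f (Z c + val η 1ℤ) - f (Z c))
    one f {c} c<r = trans (∑-cong r λ {p} _ → term f c p) (trans (∑-+ r (f ∘ Z) _)
      (cong (_+_ (∑ r (f ∘ Z))) (∑-δ r (λ _ → f (Z c + val η 1ℤ) - f (Z c)) c<r)))

  -- The unsorted local rule puts the unit in row `c` of `C`; sorting puts it in row `d`, where the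
  -- entry of `C` is the same.
  ≈-local : ∀ {η c d C A D B} → Step η d C D → Step η c A B → C d ≡ C c → D ≈ (λ p → C p + (B p - A p))
  ≈-local {η} {c} {d} {C} {A} b t flat = ≈-trans (≐⇒≈ (eqn b)) (≈-trans (≈-add η (bound b) (bound t) flat)
    (≐⇒≈ λ {p} p<r → cong (_+_ (C p)) (sym (trans (cong (_- A p) (eqn t p<r)) (x+y-x≡y (A p) (unit η c p))))))

  ind : ℤ → ℤ → ℤ
  ind z x with z ℤ.≤? x
  ... | yes _ = 1ℤ
  ... | no  _ = 0ℤ

  ind-≤ : ∀ {z x} → z ℤ.≤ x → ind z x ≡ 1ℤ
  ind-≤ {z} {x} le with z ℤ.≤? x
  ... | yes _ = refl
  ... | no nle = ⊥-elim (nle le)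

  ind-≰ : ∀ {z x} → ¬ (z ℤ.≤ x) → ind z x ≡ 0ℤ
  ind-≰ {z} {x} nle with z ℤ.≤? x
  ... | yes le = ⊥-elim (nle le)
  ... | no _ = refl

  ind-range : ∀ z x → 0ℤ ℤ.≤ ind z x × ind z x ℤ.≤ 1ℤ
  ind-range z x with z ℤ.≤? x
  ... | yes _ = ℤ.+≤+ z≤n , ℤP.≤-refl
  ... | no _ = ℤP.≤-refl , ℤ.+≤+ z≤n

  ∑-mono : ∀ n {f g} → (∀ {p} → p < n → f p ℤ.≤ g p) → ∑ n f ℤ.≤ ∑ n g
  ∑-mono zero    le = ℤP.≤-refl
  ∑-mono (suc n) le = ℤP.+-mono-≤ (∑-mono n (λ p<n → le (ℕP.m<n⇒m<1+n p<n))) (le (ℕP.n<1+n n))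

  -- Compare the numbers of entries ≥ Y q.
  Dom-≈-≤ : ∀ {X Y} → Dom X → Dom Y → X ≈ Y → ∀ {q} → q < r → Y q ℤ.≤ X q
  Dom-≈-≤ {X} {Y} dX dY eq {q} q<r with Y q ℤ.≤? X q
  ... | yes le = le
  ... | no nle = ⊥-elim (1+≰ {∑ r c} (ℤP.≤-trans bigger (ℤP.≤-reflexive (sym (sums eq (ind (Y q)))))))
    where
    c : ℕ → ℤ
    c p = ind (Y q) (X p)
    -- Suppose `X q < Y q`. Before `q` all entries of `Y` count, from `q` on no entry of `X` does,
    -- and at `q` itself `Y` has one more: hence the extra `δ q p`.
    pointwise : ∀ {p} → p < r → c p + δ q p ℤ.≤ ind (Y q) (Y p)
    pointwise {p} p<r with q ℕ.≟ p
    ... | yes refl = ℤP.≤-reflexive (trans (cong₂ _+_ (ind-≰ nle) (δ-≡ q)) (sym (ind-≤ {Y q} ℤP.≤-refl)))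
    ... | no q≢p with ℕP.<-cmp p q
    ...   | tri< p<q _ _ = ℤP.≤-trans (ℤP.≤-reflexive (trans (cong (_+_ (c p)) (δ-≢ q≢p)) (ℤP.+-identityʳ (c p))))
              (ℤP.≤-trans (proj₂ (ind-range (Y q) (X p))) (ℤP.≤-reflexive (sym (ind-≤ (dY (ℕP.<⇒≤ p<q) q<r)))))
    ...   | tri≈ _ p≡q _ = ⊥-elim (q≢p (sym p≡q))
    ...   | tri> _ _ q<p = ℤP.≤-trans (ℤP.≤-reflexive (trans (cong₂ _+_ (ind-≰ (λ le → nle (ℤP.≤-trans le (dX (ℕP.<⇒≤ q<p) p<r)))) (δ-≢ q≢p)) refl))
              (proj₁ (ind-range (Y q) (Y p)))
    one : ∑ r (λ p → δ q p) ≡ 1ℤ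
    one = trans (∑-cong r λ {p} _ → sym (ℤP.*-identityˡ (δ q p))) (∑-δ r (λ _ → 1ℤ) q<r)
    bigger : ∑ r c + 1ℤ ℤ.≤ ∑ r (ind (Y q) ∘ Y)
    bigger = subst (ℤ._≤ ∑ r (ind (Y q) ∘ Y)) (trans (∑-+ r c (δ q)) (cong (_+_ (∑ r c)) one)) (∑-mono r pointwise)

  Dom-≈⇒≐ : ∀ {X Y} → Dom X → Dom Y → X ≈ Y → X ≐ Y
  Dom-≈⇒≐ {X} {Y} dX dY eq p<r = ℤP.≤-antisym (Dom-≈-≤ dY dX (≈-sym eq) p<r) (Dom-≈-≤ dX dY eq p<r)

  sortDesc-↭ : ∀ α → sortDesc α ↭ α
  sortDesc-↭ α = ↭-trans (↭-reverse _) (MSP.sort-↭ ℤP.≤-decTotalOrder α)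

  length-sortDesc : ∀ α → length α ≡ r → length (sortDesc α) ≡ r
  length-sortDesc α le = trans (↭-length (sortDesc-↭ α)) le

  sortDesc-≈ : ∀ {α} → length α ≡ r → get (sortDesc α) ≈ get α
  sortDesc-≈ {α} le = same-sums λ f → trans (trans (cong (λ n → ∑ n (f ∘ get (sortDesc α))) (sym (length-sortDesc α le))) (∑-list-get f (sortDesc α)))
    (trans (∑-list-↭ f (sortDesc-↭ α)) (trans (sym (∑-list-get f α)) (cong (λ n → ∑ n (f ∘ get α)) le)))

  Dom-sortDesc : ∀ {α} → length α ≡ r → Dom (get (sortDesc α))
  Dom-sortDesc {α} le = Dom-of-steps λ {p} lt → subst₂ ℤ._≤_
      (sym (nth-reverse 0ℤ β (subst (suc p <_) (sym lenβ) lt)))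
      (sym (trans (nth-reverse 0ℤ β (subst (p <_) (sym lenβ) (ℕP.<-trans (ℕP.n<1+n p) lt)))
                  (cong (get β) (trans (cong (_∸ suc p) lenβ) (trans (ℕP.+-∸-assoc 1 lt) (cong (λ n → suc (n ∸ suc (suc p))) (sym lenβ)))))))
      (Linked-get (MSP.sort-↗ ℤP.≤-decTotalOrder α) (bound′ p lt))
    where
    β : Shape
    β = MS.sort ℤP.≤-decTotalOrder α
    lenβ : length β ≡ r
    lenβ = trans (↭-length (MSP.sort-↭ ℤP.≤-decTotalOrder α)) le
    bound′ : ∀ p → suc p < r → suc (length β ∸ suc (suc p)) < length β
    bound′ p lt rewrite lenβ = subst (_< r) (ℕP.+-∸-assoc 1 lt) (ℕP.∸-monoʳ-< {o = 0} (s≤s z≤n) (ℕP.<⇒≤ lt))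

  shape-ext : ∀ {μ ν} → length μ ≡ r → length ν ≡ r → get μ ≐ get ν → μ ≡ ν
  shape-ext {μ} {ν} lμ lν eq = nth-ext 0ℤ μ ν (trans lμ (sym lν)) (λ {k} lt → eq (subst (k <_) lμ lt))

  module _ (a b c : Shape) (la : length a ≡ r) (lb : length b ≡ r) (lc : length c ≡ r) where

    length-⊕ : length (b ⊕ c) ≡ r
    length-⊕ = trans (length-zipWith-≡ _+_ b c (trans lb (sym lc))) lb

    length-local : length ((b ⊕ c) ⊖ a) ≡ r
    length-local = trans (length-zipWith-≡ _-_ (b ⊕ c) a (trans length-⊕ (sym la))) length-⊕

    get-local : ∀ p → get ((b ⊕ c) ⊖ a) p ≡ get c p + (get b p - get a p)
    get-local p = trans (get-⊖ {b ⊕ c} {a} (trans length-⊕ (sym la)) p)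
      (trans (cong (_- get a p) (get-⊕ {b} {c} (trans lb (sym lc)) p)) (l (get b p) (get c p) (get a p)))
      where
      l : ∀ x y z → x + y - z ≡ y + (x - z)
      l = solve-∀

    -- The sorted rearrangement is the only decreasing vector with its multiset, so any decreasing
    -- candidate with the right multiset is the shape prescribed by the diagram.
    local-rule : ∀ {Y} → Dom Y → Y ≈ (λ p → get c p + (get b p - get a p)) → get (sortDesc ((b ⊕ c) ⊖ a)) ≐ Y
    local-rule {Y} dY eq = Dom-≈⇒≐ {get (sortDesc ((b ⊕ c) ⊖ a))} {Y} (Dom-sortDesc {(b ⊕ c) ⊖ a} length-local) dY
      (≈-trans (sortDesc-≈ {(b ⊕ c) ⊖ a} length-local) (≈-trans (≐⇒≈ λ {p} _ → get-local p) (≈-sym eq)))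

-- Rows of the promotion-evacuation diagram

rowAux-spec : ∀ q b L n → length L ≡ suc n → let R = q ∷ rowAux q L ++ [ b ] in
  length R ≡ suc (suc n) × at R (suc n) ≡ b ×
  (∀ {k} → k < n → at R (suc k) ≡ sortDesc ((at L (suc k) ⊕ at R k) ⊖ at L k))
rowAux-spec q b (x ∷ [])     zero    le = refl , refl , λ ()
rowAux-spec q b (x ∷ y ∷ L) (suc n) le with rowAux-spec (sortDesc ((y ⊕ q) ⊖ x)) b (y ∷ L) n (ℕP.suc-injective le)
... | len , last , inner = cong suc len , last , λ { {zero} _ → refl ; {suc k} lt → inner (ℕP.≤-pred lt) }

-- Positions count from the start of each row: position `j` of row `i` is column `i + j`. Hence the
-- shape above `at R j` is `at T (suc j)`.
nextRow-spec : ∀ a b T {n} → length T ≡ suc (suc n) → let R = nextRow a b T in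
  length R ≡ suc (suc n) × at R (suc n) ≡ b ×
  (∀ {j} → j < n → at R (suc j) ≡ sortDesc ((at T (suc (suc j)) ⊕ at R j) ⊖ at T (suc j)))
nextRow-spec a b (x ∷ T) le = rowAux-spec a b T _ (ℕP.suc-injective le)

headOr-at : ∀ T → headOr T ≡ at T 0
headOr-at []      = refl
headOr-at (x ∷ T) = refl

lastOr-at : ∀ d T {n} → length T ≡ suc n → lastOr d T ≡ at T n
lastOr-at d (x ∷ [])    {zero}  le = refl
lastOr-at d (x ∷ y ∷ T) {suc n} le = lastOr-at x (y ∷ T) (ℕP.suc-injective le)

at-ext : ∀ S T → length S ≡ length T → (∀ {k} → k < length S → at S k ≡ at T k) → S ≡ T
at-ext S T le eq = nth-ext [] S T le (λ {k} lt → trans (sym (at-nth S k)) (trans (eq lt) (at-nth T k)))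

module Diagrams (r : ℕ) where
  open Cells r
  open Pairing r
  open Grids r
  open Shapes r

  AStep : V → V → Set
  AStep X Y = ∃ λ ε → ∃ λ a → Step ε a X Y

  Sq-left : ∀ {C A D B} → Sq C A D B → AStep C A
  Sq-left (straight ε a η d l r b t) = ε , a , l
  Sq-left (bend ε η lo hi _ _ l r b t) = ε , _ , l

  Sq-right : ∀ {C A D B} → Sq C A D B → AStep D B
  Sq-right (straight ε a η d l r b t) = ε , a , r
  Sq-right (bend ε η lo hi _ _ l r b t) = ε , _ , r

  Sq-bottom : ∀ {C A D B} → Sq C A D B → AStep C D
  Sq-bottom s = Sq-left (Sq-transpose s)

  -- An oscillating tableau from the zero shape to a constant shape. Every row of its diagram is
  -- again of this kind, so a statement proved for row 0 can be reused on every row.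
  record Path (t : ℕ) (k : ℤ) (U : List Shape) : Set where
    field
      length-path  : length U ≡ suc t
      length-shape : ∀ {j} → j ≤ t → length (at U j) ≡ r
      dom          : ∀ {j} → j ≤ t → Dom (get (at U j))
      steps        : ∀ {j} → j < t → AStep (get (at U j)) (get (at U (suc j)))
      first        : at U 0 ≡ zeros r
      last         : at U t ≡ replicate r k

  open Path

  get-zeros : get (zeros r) ≐ (λ _ → 0ℤ)
  get-zeros p<r = get-replicate r 0ℤ p<r

  module NextRow {t k U} (P : Path (suc t) k U) where

    R : List Shape
    R = nextRow (zeros r) (replicate r k) U

    spec : length R ≡ suc (suc t) × at R (suc t) ≡ replicate r k ×
           (∀ {j} → j < t → at R (suc j) ≡ sortDesc ((at U (suc (suc j)) ⊕ at R j) ⊖ at U (suc j)))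
    spec = nextRow-spec (zeros r) (replicate r k) U (length-path P)

    at-R-suc : ∀ {j} → j < t → at R (suc j) ≡ sortDesc ((at U (suc (suc j)) ⊕ at R j) ⊖ at U (suc j))
    at-R-suc = proj₂ (proj₂ spec)

    Inv : ℕ → Set
    Inv j = length (at R j) ≡ r × Dom (get (at R j)) × AStep (get (at R j)) (get (at U (suc j)))

    Cell : ℕ → Set
    Cell j = Sq (get (at R j)) (get (at U (suc j))) (get (at R (suc j))) (get (at U (suc (suc j))))

    -- Settle the letter of the upper step in the lower left shape: the result is decreasing with
    -- the right multiset, hence the next shape of the row. The right side of the cell so obtained
    -- is the left side of the next one.
    advance : ∀ {j} → j < t → Inv j → Cell j × Inv (suc j)
    advance {j} j<t (lenC , dC , ε , x , left) = cell , lenD , dD , Sq-right cell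
      where
      a b c : Shape
      a = at U (suc j)
      b = at U (suc (suc j))
      c = at R j
      A B C D : V
      A = get a
      B = get b
      C = get c
      D = get (at R (suc j))
      lenA : length (at U (suc j)) ≡ r
      lenA = length-shape P (s≤s (ℕP.<⇒≤ j<t))
      lenB : length (at U (suc (suc j))) ≡ r
      lenB = length-shape P (s≤s j<t)
      top : AStep A B
      top = steps P (s≤s j<t)
      η : Sgn
      η = proj₁ top
      y : ℕ
      y = proj₁ (proj₂ top)
      top-step : Step η y A B
      top-step = proj₂ (proj₂ top)
      settled : ∃ (Settled η C y)
      settled = settle η dC (bound top-step)
      d : ℕ
      d = proj₁ settled
      d<r : d < r
      d<r = proj₁ (proj₂ settled)
      Y : V
      Y = add η d C
      dY : Dom Y
      dY = Dom-settled η dC (proj₂ settled)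
      Y≈ : Y ≈ (λ p → C p + (B p - A p))
      Y≈ = ≈-local {C = C} (step d<r (λ _ → refl)) top-step (proj₁ (proj₂ (proj₂ (proj₂ settled))))
      D≐ : D ≐ Y
      D≐ {p} p<r = trans (cong (λ s → get s p) (at-R-suc j<t)) (local-rule a b c lenA lenB lenC {Y} dY Y≈ p<r)
      lenD : length (at R (suc j)) ≡ r
      lenD = trans (cong length (at-R-suc j<t)) (length-sortDesc ((b ⊕ c) ⊖ a) (length-local a b c lenA lenB lenC))
      dD : Dom D
      dD {p} {q} p≤q q<r = subst₂ ℤ._≤_ (sym (D≐ q<r)) (sym (D≐ (ℕP.≤-<-trans p≤q q<r))) (dY p≤q q<r)
      cell : Cell j
      cell = Sq-of-settled (dom P (s≤s j<t)) left top-step (proj₂ settled) (step d<r D≐)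

    inv : ∀ j → j ≤ t → Inv j
    -- The lower row starts at the shape that opens `U`, so the first vertical step is the first
    -- step of `U`.
    inv zero    _   = subst (λ s → length s ≡ r × Dom (get s) × AStep (get s) (get (at U 1))) (first P)
                        (length-shape P z≤n , dom P z≤n , steps P (s≤s z≤n))
    inv (suc j) j<t = proj₂ (advance j<t (inv j (ℕP.<⇒≤ j<t)))

    cells : ∀ {j} → j < t → Cell j
    cells {j} j<t = proj₁ (advance j<t (inv j (ℕP.<⇒≤ j<t)))

    left-step : ∀ {j} → j ≤ t → AStep (get (at R j)) (get (at U (suc j)))
    left-step {j} j≤t = proj₂ (proj₂ (inv j j≤t))

    last-R : at R (suc t) ≡ at U (suc t)
    last-R = trans (proj₁ (proj₂ spec)) (sym (last P))

    path : Path (suc t) k R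
    path = record
      { length-path = proj₁ spec
      ; length-shape = λ {j} j≤ → proj₁ (len-dom j j≤)
      ; dom = λ {j} j≤ → proj₂ (len-dom j j≤)
      ; steps = λ {j} j< → st j (ℕP.≤-pred j<)
      ; first = refl
      ; last = proj₁ (proj₂ spec)
      }
      where
      len-dom : ∀ j → j ≤ suc t → length (at R j) ≡ r × Dom (get (at R j))
      len-dom j j≤ with j ℕ.≤? t
      ... | yes j≤t = proj₁ (inv j j≤t) , proj₁ (proj₂ (inv j j≤t))
      ... | no j≰t with ℕP.≤-antisym j≤ (ℕP.≰⇒> j≰t)
      ...   | refl = subst (λ s → length s ≡ r × Dom (get s)) (sym last-R) (length-shape P ℕP.≤-refl , dom P ℕP.≤-refl)
      -- Both rows end in the same shape, so the last step of the lower row is the last vertical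
      -- step.
      st : ∀ j → j ≤ t → AStep (get (at R j)) (get (at R (suc j)))
      st j j≤t with j ℕ.<? t
      ... | yes j<t = Sq-bottom (cells j<t)
      ... | no j≮t with ℕP.≤-antisym j≤t (ℕP.≮⇒≥ j≮t)
      ...   | refl = subst (λ s → AStep (get (at R j)) (get s)) (sym last-R) (left-step ℕP.≤-refl)

  headOr-path : ∀ {t k U} → Path t k U → headOr U ≡ zeros r
  headOr-path {U = U} P = trans (headOr-at U) (first P)

  lastOr-path : ∀ {t k U} → Path t k U → lastOr [] U ≡ replicate r k
  lastOr-path {U = U} P = trans (lastOr-at [] U (length-path P)) (last P)

  module Rows {t k U} (P : Path (suc t) k U) where

    row-suc : ∀ i → row U (suc i) ≡ nextRow (zeros r) (replicate r k) (row U i)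
    row-suc i = cong₂ (λ a b → nextRow a b (row U i)) (headOr-path P) (lastOr-path P)

    row-path : ∀ i → Path (suc t) k (row U i)
    row-path zero    = P
    row-path (suc i) = subst (Path (suc t) k) (sym (row-suc i)) (NextRow.path (row-path i))

    Λ : ℕ → ℕ → V
    Λ i j = get (at (row U i) j)

    square : ∀ i {j} → j < t → Sq (Λ (suc i) j) (Λ i (suc j)) (Λ (suc i) (suc j)) (Λ i (suc (suc j)))
    square i {j} j<t = subst (λ R → Sq (get (at R j)) (Λ i (suc j)) (get (at R (suc j))) (Λ i (suc (suc j)))) (sym (row-suc i))
      (NextRow.cells (row-path i) j<t)

    vertical : ∀ i {j} → j ≤ t → AStep (Λ (suc i) j) (Λ i (suc j))
    vertical i {j} j≤t = subst (λ R → AStep (get (at R j)) (Λ i (suc j))) (sym (row-suc i))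
      (NextRow.left-step (row-path i) j≤t)

    Λ-first : ∀ i → Λ i 0 ≐ (λ _ → 0ℤ)
    Λ-first i {p} p<r = trans (cong (λ s → get s p) (first (row-path i))) (get-zeros p<r)

    Λ-last : ∀ i → Λ i (suc t) ≐ (λ _ → k)
    Λ-last i {p} p<r = trans (cong (λ s → get s p) (last (row-path i))) (get-replicate r k p<r)

    -- Besides the row above, `nextRow` only reads the first and the last shape, and these are
    -- common to all rows.
    row-+ : ∀ c i → row (row U c) i ≡ row U (i ℕ.+ c)
    row-+ c zero    = refl
    row-+ c (suc i) = trans (cong₂ (λ a b → nextRow a b (row (row U c) i)) (headOr-path (row-path c)) (lastOr-path (row-path c)))
      (trans (cong (nextRow (zeros r) (replicate r k)) (row-+ c i)) (sym (row-suc (i ℕ.+ c))))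

    -- The rectangle consists of rows 0 to `j` and columns `j` to `suc t`. Its lower left corner is
    -- the start of row `j`, its upper right corner the end of row 0, and the other two corners are
    -- the shapes compared.
    complement₀ : ∀ {j} → j ≤ suc t → Λ j (suc t ∸ j) ≐ κ k (Λ 0 j)
    complement₀ {j} j≤ {p} p<r = trans (grid-complement {j} {suc t ∸ j} {G} {k} (doms , cells)
        (Λ-first j) corner p<r) (cong (λ x → k - x (rev p)) (cong₂ Λ (ℕP.n∸n≡0 j) (ℕP.+-identityʳ j)))
      where
      G : ℕ → ℕ → V
      G p q = Λ (j ∸ p) (p ℕ.+ q)
      le : ∀ {p q} → p ≤ j → q ≤ suc t ∸ j → p ℕ.+ q ≤ suc t
      le p≤ q≤ = ℕP.≤-trans (ℕP.+-mono-≤ p≤ q≤) (ℕP.≤-reflexive (ℕP.m+[n∸m]≡n j≤))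
      doms : ∀ {p q} → p ≤ j → q ≤ suc t ∸ j → Dom (G p q)
      doms {p} p≤ q≤ = dom (row-path (j ∸ p)) (le p≤ q≤)
      cells : ∀ {p q} → p < j → q < suc t ∸ j → Sq (G p q) (G (suc p) q) (G p (suc q)) (G (suc p) (suc q))
      cells {p} {q} p<j q< rewrite ℕP.+-suc p q | ℕP.+-∸-assoc 1 p<j =
        square (j ∸ suc p) (ℕP.≤-pred (subst (_≤ suc t) (cong suc (ℕP.+-suc p q)) (le p<j q<)))
      corner : G j (suc t ∸ j) ≐ (λ _ → k)
      corner {p} p<r = trans (cong (λ x → x p) (cong₂ Λ (ℕP.n∸n≡0 j) (ℕP.m+[n∸m]≡n j≤))) (Λ-last 0 p<r)

  module Periodic {t k U} (P : Path (suc t) k U) where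
    open Rows P

    complement : ∀ i {j} → j ≤ suc t → Λ (j ℕ.+ i) (suc t ∸ j) ≐ κ k (Λ i j)
    complement i {j} j≤ {p} p<r = trans (cong (λ R → get (at R (suc t ∸ j)) p) (sym (row-+ i j)))
      (Rows.complement₀ (row-path i) j≤ p<r)

    -- Complement twice: the first time descends `j` rows and the second time the remaining
    -- `suc t ∸ j`, and the two complements cancel.
    row-period : ∀ i → row U (suc t ℕ.+ i) ≡ row U i
    row-period i = at-ext _ _ (trans (length-path (row-path (suc t ℕ.+ i))) (sym (length-path (row-path i))))
      λ {j} lt → same (ℕP.≤-pred (subst (j <_) (length-path (row-path (suc t ℕ.+ i))) lt))
      where
      same : ∀ {j} → j ≤ suc t → at (row U (suc t ℕ.+ i)) j ≡ at (row U i) j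
      same {j} j≤ = shape-ext (length-shape (row-path (suc t ℕ.+ i)) j≤) (length-shape (row-path i) j≤) λ {p} p<r →
        trans (cong (λ x → x p) (cong₂ Λ idx (sym (ℕP.m∸[m∸n]≡n j≤))))
          (trans (complement (j ℕ.+ i) (ℕP.m∸n≤m (suc t) j) p<r) (trans (κ-cong k (complement i j≤) p<r) (κ-κ k {Λ i j} p<r)))
        where
        idx : suc t ℕ.+ i ≡ (suc t ∸ j) ℕ.+ (j ℕ.+ i)
        idx = trans (cong (ℕ._+ i) (sym (ℕP.m∸n+n≡m j≤))) (ℕP.+-assoc (suc t ∸ j) j i)

-- Cyclic arithmetic and monotone switches

%-+ˡ : ∀ a b n → (a % suc n ℕ.+ b) % suc n ≡ (a ℕ.+ b) % suc n
%-+ˡ a b n = trans (%-distribˡ-+ (a % suc n) b (suc n))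
  (trans (cong (λ z → (z ℕ.+ b % suc n) % suc n) (m%n%n≡m%n a (suc n))) (sym (%-distribˡ-+ a b (suc n))))

%-+ʳ : ∀ a b n → (a ℕ.+ b % suc n) % suc n ≡ (a ℕ.+ b) % suc n
%-+ʳ a b n = trans (cong (_% suc n) (ℕP.+-comm a (b % suc n))) (trans (%-+ˡ b a n) (cong (_% suc n) (ℕP.+-comm b a)))

-- Adding `c * n` undoes the addition of `c`, since together they make a multiple of `suc n`.
%-cancelʳ : ∀ {a b} c n → (a ℕ.+ c) % suc n ≡ (b ℕ.+ c) % suc n → a % suc n ≡ b % suc n
%-cancelʳ {a} {b} c n eq = trans (sym (undo a)) (trans (cong (λ z → (z ℕ.+ c ℕ.* n) % suc n) eq) (undo b))
  where
  undo : ∀ a → ((a ℕ.+ c) % suc n ℕ.+ c ℕ.* n) % suc n ≡ a % suc n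
  undo a = trans (%-+ˡ (a ℕ.+ c) (c ℕ.* n) n)
    (trans (cong (_% suc n) (trans (ℕP.+-assoc a c (c ℕ.* n)) (cong (a ℕ.+_) (sym (ℕP.*-suc c n))))) ([m+kn]%n≡m%n a c (suc n)))

switch : ∀ {P : ℕ → Set} t → (∀ {j} → j ≤ t → Dec (P j)) → ¬ P 0 → P t → ∃ λ m → m < t × ¬ P m × P (suc m)
switch zero    dec n0 pt = ⊥-elim (n0 pt)
switch (suc t) dec n0 pt with dec (ℕP.n≤1+n t)
... | no nt = t , ℕP.≤-refl , nt , pt
... | yes qt with switch t (λ j≤t → dec (ℕP.m≤n⇒m≤1+n j≤t)) n0 qt
...   | m , m<t , nm , pm = m , ℕP.m<n⇒m<1+n m<t , nm , pm

persist : ∀ {P : ℕ → Set} t → (∀ {j} → j < t → P j → P (suc j)) → ∀ {i j} → i ≤ j → j ≤ t → P i → P j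
persist {P} t up {i} i≤j = go (ℕP.≤⇒≤′ i≤j)
  where
  go : ∀ {j} → i ℕ.≤′ j → j ≤ t → P i → P j
  go ℕ.≤′-refl _ p = p
  go (ℕ.≤′-step le) lt p = up lt (go le (ℕP.<⇒≤ lt) p)

switch-unique : ∀ {P : ℕ → Set} t → (∀ {j} → j < t → P j → P (suc j)) → ∀ {m m′} → m < t → m′ < t →
                ¬ P m → P (suc m) → ¬ P m′ → P (suc m′) → m ≡ m′
switch-unique t up {m} {m′} m<t m′<t nm pm nm′ pm′ with ℕP.<-cmp m m′
... | tri< m<m′ _ _ = ⊥-elim (nm′ (persist t up m<m′ (ℕP.<⇒≤ m′<t) pm))
... | tri≈ _ eq _ = eq
... | tri> _ _ m′<m = ⊥-elim (nm (persist t up m′<m (ℕP.<⇒≤ m<t) pm′))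

-- Labels of cells and the partner of an index

module Jumps (r : ℕ) where
  open Cells r
  open Grids r
  open Shapes r
  open Diagrams r
  open Path

  Between : Sgn → ℕ → ℕ → ℕ → Set
  Between ⊞ a b i = a < i × i ≤ b
  Between ⊟ a b i = b < i × i ≤ a

  Jump : V → V → V → V → ℕ → Set
  Jump C A D B i = ∃ λ ε → ∃ λ a → ∃ λ b → Step ε a C A × Step ε b D B × Between ε a b i

  Jump-resp : ∀ {C A D B C′ A′ D′ B′ i} → C ≐ C′ → A ≐ A′ → D ≐ D′ → B ≐ B′ → Jump C A D B i → Jump C′ A′ D′ B′ i
  Jump-resp c a d b (ε , x , y , l , r , bt) = ε , x , y , Step-resp c a l , Step-resp d b r , bt

  -- The label names no side of the cell and so passes to the transposed and the complemented cell.
  -- `Jump` is the same information as the promotion matrix reads it, from the two vertical letters.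
  Label : ∀ {C A D B} → Sq C A D B → ℕ → Set
  Label (straight _ _ _ _ _ _ _ _) i = ⊥
  Label (bend _ _ lo hi _ _ _ _ _ _) i = lo < i × i ≤ hi

  Label⇒Jump : ∀ {C A D B} (s : Sq C A D B) {i} → Label s i → Jump C A D B i
  Label⇒Jump (bend ⊞ η lo hi _ _ l r _ _) bt = ⊞ , lo , hi , l , r , bt
  Label⇒Jump (bend ⊟ η lo hi _ _ l r _ _) bt = ⊟ , hi , lo , l , r , bt

  Jump⇒Label : ∀ {C A D B} (s : Sq C A D B) {i} → Jump C A D B i → Label s i
  Jump⇒Label (straight ε a η d l r _ _) (ε′ , x , y , l′ , r′ , bt) with Step-unique l l′ | Step-unique r r′
  Jump⇒Label (straight ⊞ a η d l r _ _) (ε′ , x , y , l′ , r′ , a<i , i≤a) | refl , refl | _ , refl = ℕP.<⇒≱ a<i i≤a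
  Jump⇒Label (straight ⊟ a η d l r _ _) (ε′ , x , y , l′ , r′ , a<i , i≤a) | refl , refl | _ , refl = ℕP.<⇒≱ a<i i≤a
  Jump⇒Label (bend ε η lo hi _ _ l r _ _) (ε′ , x , y , l′ , r′ , bt) with Step-unique l l′ | Step-unique r r′
  Jump⇒Label (bend ⊞ η lo hi _ _ l r _ _) (ε′ , x , y , l′ , r′ , bt) | refl , refl | _ , refl = bt
  Jump⇒Label (bend ⊟ η lo hi _ _ l r _ _) (ε′ , x , y , l′ , r′ , bt) | refl , refl | _ , refl = bt

  Label-transpose : ∀ {C A D B} (s : Sq C A D B) {i} → Label s i → Label (Sq-transpose s) i
  Label-transpose (bend _ _ _ _ _ _ _ _ _ _) bt = bt

  -- Reflection turns `lo < i` and `i ≤ hi` into `rev hi < r ∸ i` and `r ∸ i ≤ rev lo`.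
  Label-κ : ∀ k {C A D B} (s : Sq C A D B) {i} → Label s i → Label (Sq-κ k s) (r ∸ i)
  Label-κ k (bend ε η lo hi lt fl l r′ b t) {i} (lo<i , i≤hi) =
    ℕP.∸-monoʳ-< (s≤s i≤hi) (proj₂ (bend-bounds lt l r′)) , ℕP.∸-monoʳ-≤ r lo<i

  Jump-κ : ∀ k {C A D B i} → Sq C A D B → Jump C A D B i → Jump (κ k B) (κ k D) (κ k A) (κ k C) (r ∸ i)
  Jump-κ k s j = Label⇒Jump (Sq-κ k s) (Label-κ k s (Jump⇒Label s j))

  Jump-transpose : ∀ {C A D B i} → Sq C A D B → Jump C A D B i → Jump C D A B i
  Jump-transpose s j = Label⇒Jump (Sq-transpose s) (Label-transpose s (Jump⇒Label s j))

  -- The letter has crossed the border between the rows `i - 1` and `i` in the direction of its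
  -- sign. Along a strip this switches on once, and the cell where it does carries the label `i`.
  Beyond : Sgn → ℕ → ℕ → Set
  Beyond ⊞ a i = i ≤ a
  Beyond ⊟ a i = a < i

  Passed : ℕ → V → V → Set
  Passed i X Y = ∃ λ ε → ∃ λ a → Step ε a X Y × Beyond ε a i

  beyond? : ∀ ε a i → Dec (Beyond ε a i)
  beyond? ⊞ a i = i ℕ.≤? a
  beyond? ⊟ a i = a ℕ.<? i

  passed? : ∀ i {X Y} → AStep X Y → Dec (Passed i X Y)
  passed? i {X} {Y} (ε , a , s) with beyond? ε a i
  ... | yes b = yes (ε , a , s , b)
  ... | no nb = no λ (ε′ , a′ , s′ , b) → nb (same (Step-unique s′ s) b)
    where
    same : ∀ {ε′ a′} → ε′ ≡ ε × a′ ≡ a → Beyond ε′ a′ i → Beyond ε a i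
    same (refl , refl) b = b

  Between⇔ : ∀ ε {a b i} → (Between ε a b i → ¬ Beyond ε a i × Beyond ε b i) × (¬ Beyond ε a i → Beyond ε b i → Between ε a b i)
  Between⇔ ⊞ = (λ (a<i , i≤b) → ℕP.<⇒≱ a<i , i≤b) , (λ n b → ℕP.≰⇒> n , b)
  Between⇔ ⊟ = (λ (b<i , i≤a) → ℕP.≤⇒≯ i≤a , b<i) , (λ n b → b , ℕP.≮⇒≥ n)

  Jump⇒switch : ∀ {C A D B i} → Jump C A D B i → ¬ Passed i C A × Passed i D B
  Jump⇒switch {C} {A} {i = i} (ε , a , b , l , r , bt) =
    (λ (ε′ , a′ , s′ , p) → proj₁ (proj₁ (Between⇔ ε) bt) (same (Step-unique s′ l) p)) , (ε , b , r , proj₂ (proj₁ (Between⇔ ε) bt))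
    where
    same : ∀ {ε′ a′} → ε′ ≡ ε × a′ ≡ a → Beyond ε′ a′ i → Beyond ε a i
    same (refl , refl) b = b

  Sq-sides : ∀ {C A D B} → Sq C A D B → ∃ λ ε → ∃ λ a → ∃ λ b → Step ε a C A × Step ε b D B × Le ε a b
  Sq-sides (straight ε a η d l r _ _) = ε , a , a , l , r , Le-refl ε
  Sq-sides (bend ε η lo hi lt _ l r _ _) = ε , _ , _ , l , r , Lt⇒Le ε (src-Lt-tgt ε lt)

  switch⇒Jump : ∀ {C A D B i} → Sq C A D B → ¬ Passed i C A → Passed i D B → Jump C A D B i
  switch⇒Jump {i = i} s np (ε′ , b′ , r′ , p) with Sq-sides s
  ... | ε , a , b , l , r , _ with Step-unique r′ r
  ...   | refl , refl = ε , a , b , l , r , proj₂ (Between⇔ ε) (λ p′ → np (ε , a , l , p′)) p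

  Beyond-mono : ∀ ε {a b i} → Le ε a b → Beyond ε a i → Beyond ε b i
  Beyond-mono ⊞ a≤b p = ℕP.≤-trans p a≤b
  Beyond-mono ⊟ b≤a p = ℕP.≤-<-trans b≤a p

  Passed-right : ∀ {C A D B i} → Sq C A D B → Passed i C A → Passed i D B
  Passed-right {i = i} s (ε′ , a′ , l′ , p) with Sq-sides s
  ... | ε , a , b , l , r , le with Step-unique l′ l
  ...   | refl , refl = ε , b , r , Beyond-mono ε le p

  module Promotion {t k U} (P : Path (suc t) k U) where
    open Rows P
    open Periodic P

    J : ℕ → ℕ → ℕ → Set
    J x m i = Jump (Λ (suc x) m) (Λ x (suc m)) (Λ (suc x) (suc m)) (Λ x (suc (suc m))) i

    -- From the zero shape a cell can only be added in the first row or removed in the last one,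
    -- that is, at the beginning of the filling order.
    not-passed-first : ∀ x {i} → 0 < i → i < r → ¬ Passed i (Λ (suc x) 0) (Λ x 1)
    not-passed-first x {i} 0<i i<r (⊞ , a , s , i≤a) = 1+≰ {0ℤ} (subst₂ ℤ._≤_
      (trans (eqn s (bound s)) (cong₂ _+_ (Λ-first (suc x) (bound s)) (δ-≡ a)))
      (trans (eqn s 0<r) (cong₂ _+_ (Λ-first (suc x) 0<r) (δ-≢ {a} {0} (λ e → ℕP.<⇒≱ 0<i (subst (i ≤_) e i≤a)))))
      (dom (row-path x) (s≤s z≤n) z≤n (bound s)))
      where
      0<r : 0 < r
      0<r = ℕP.<-trans 0<i i<r
    not-passed-first x {i} 0<i i<r (⊟ , a , s , a<i) = ¬0≤-1 (subst₂ ℤ._≤_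
      (trans (eqn s i<r) (cong₂ _+_ (Λ-first (suc x) i<r) (cong -_ (δ-≢ {a} {i} (ℕP.<⇒≢ a<i)))))
      (trans (eqn s (bound s)) (cong₂ _+_ (Λ-first (suc x) (bound s)) (cong -_ (δ-≡ a))))
      (dom (row-path x) (s≤s z≤n) (ℕP.<⇒≤ a<i) i<r))
      where
      ¬0≤-1 : ¬ (0ℤ + 0ℤ ℤ.≤ 0ℤ - 1ℤ)
      ¬0≤-1 ()

    -- The last vertical step ends at a constant shape, so the decreasing shape before it is one
    -- cell short in the last row or has one cell too many in the first.
    passed-last : ∀ x {i} → 0 < i → i < r → Passed i (Λ (suc x) t) (Λ x (suc t))
    passed-last x {i} 0<i i<r with vertical x ℕP.≤-refl
    ... | ⊞ , a , s = ⊞ , a , s , ℕP.≮⇒≥ λ a<i → 1+≰ {Λ (suc x) t a} (subst (ℤ._≤ Λ (suc x) t a)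
          (trans (sym (l (Λ (suc x) t i))) (trans (cong (λ u → Λ (suc x) t i + u) (sym (δ-≢ {a} {i} (ℕP.<⇒≢ a<i))))
             (trans (sym (eqn s i<r)) (trans (Λ-last x i<r) (trans (sym (Λ-last x (bound s))) (trans (eqn s (bound s)) (cong (λ u → Λ (suc x) t a + u) (δ-≡ a))))))))
          (dom (row-path (suc x)) (ℕP.n≤1+n t) (ℕP.<⇒≤ a<i) i<r))
      where
      l : ∀ y → y + 0ℤ ≡ y
      l = solve-∀
    ... | ⊟ , a , s = ⊟ , a , s , ℕP.≰⇒> λ i≤a → 1+≰ {Λ (suc x) t 0} (subst (ℤ._≤ Λ (suc x) t 0)
          (trans (l (Λ (suc x) t a)) (cong (_+ 1ℤ) (trans (cong (λ u → Λ (suc x) t a + u) (sym (cong -_ (δ-≡ a))))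
             (trans (sym (eqn s (bound s))) (trans (Λ-last x (bound s)) (trans (sym (Λ-last x (0<r))) (trans (eqn s 0<r)
               (trans (cong (λ u → Λ (suc x) t 0 + u) (cong -_ (δ-≢ {a} {0} (λ e → ℕP.<⇒≱ 0<i (subst (i ≤_) e i≤a))))) (l₀ (Λ (suc x) t 0))))))))))
          (dom (row-path (suc x)) (ℕP.n≤1+n t) z≤n (bound s)))
      where
      0<r : 0 < r
      0<r = ℕP.<-trans 0<i i<r
      l : ∀ y → y ≡ y - 1ℤ + 1ℤ
      l = solve-∀
      l₀ : ∀ y → y + 0ℤ ≡ y
      l₀ = solve-∀

    J-exists : ∀ x {i} → 0 < i → i < r → ∃ λ m → m < t × J x m i
    J-exists x {i} 0<i i<r with switch {λ j → Passed i (Λ (suc x) j) (Λ x (suc j))} t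
      (λ j≤t → passed? i (vertical x j≤t)) (not-passed-first x 0<i i<r) (passed-last x 0<i i<r)
    ... | m , m<t , nm , pm = m , m<t , switch⇒Jump (square x m<t) nm pm

    J-unique : ∀ x {i m m′} → m < t → m′ < t → J x m i → J x m′ i → m ≡ m′
    J-unique x {i} m<t m′<t j j′ = switch-unique {λ j → Passed i (Λ (suc x) j) (Λ x (suc j))} t
      (λ j<t → Passed-right (square x j<t)) m<t m′<t
      (proj₁ (Jump⇒switch j)) (proj₂ (Jump⇒switch j)) (proj₁ (Jump⇒switch j′)) (proj₂ (Jump⇒switch j′))

    row-cong-suc : ∀ {x y} → row U x ≡ row U y → row U (suc x) ≡ row U (suc y)
    row-cong-suc eq = cong (nextRow (headOr U) (lastOr [] U)) eq

    row-+* : ∀ x q → row U (x ℕ.+ q ℕ.* suc t) ≡ row U x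
    row-+* x zero    = cong (row U) (ℕP.+-identityʳ x)
    row-+* x (suc q) = trans (cong (row U) (trans (cong (x ℕ.+_) (ℕP.+-comm (suc t) (q ℕ.* suc t)))
      (trans (sym (ℕP.+-assoc x (q ℕ.* suc t) (suc t))) (ℕP.+-comm (x ℕ.+ q ℕ.* suc t) (suc t)))))
      (trans (row-period (x ℕ.+ q ℕ.* suc t)) (row-+* x q))

    row-% : ∀ x → row U x ≡ row U (x % suc t)
    row-% x = trans (cong (row U) (m≡m%n+[m/n]*n x (suc t))) (row-+* (x % suc t) (x / suc t))

    J-cong : ∀ {x y m i} → row U x ≡ row U y → J x m i → J y m i
    J-cong {x} {y} {m} {i} eq = go (row U x) (row U (suc x)) eq (row-cong-suc eq)
      where
      go : ∀ R R′ → R ≡ row U y → R′ ≡ row U (suc y) →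
        Jump (get (at R′ m)) (get (at R (suc m))) (get (at R′ (suc m))) (get (at R (suc (suc m)))) i → J y m i
      go _ _ refl refl j = j

    -- Read the bend in its column strip and complement: the column strip turns into row strip
    -- `suc m + x`, the cell stands at position `t ∸ suc m` there, and the label is reflected.
    J-inverse : ∀ {x m i} → m < t → J x m i → J (suc m ℕ.+ x) (t ∸ suc m) (r ∸ i)
    J-inverse {x} {m} {i} m<t j = Jump-resp
        (λ p<r → sym (complement x {suc (suc m)} (s≤s m<t) p<r))
        (λ {p} p<r → sym (trans (cong (λ z → Λ (suc m ℕ.+ x) z p) (sym (ℕP.+-∸-assoc 1 m<t))) (complement x {suc m} (s≤s (ℕP.<⇒≤ m<t)) p<r)))
        (λ {p} p<r → sym (trans (cong₂ (λ y z → Λ y z p) (cong suc (sym (ℕP.+-suc m x))) (sym (ℕP.+-∸-assoc 1 m<t)))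
          (complement (suc x) {suc m} (s≤s (ℕP.<⇒≤ m<t)) p<r)))
        (λ {p} p<r → sym (trans (cong₂ (λ y z → Λ y z p) (sym (ℕP.+-suc m x)) (trans (cong suc (sym (ℕP.+-∸-assoc 1 m<t))) (sym (ℕP.+-∸-assoc 1 (ℕP.<⇒≤ m<t)))))
          (complement (suc x) {m} (ℕP.m≤n⇒m≤1+n (ℕP.<⇒≤ m<t)) p<r)))
        (Jump-κ k (Sq-transpose (square x m<t)) (Jump-transpose (square x m<t) j))

    -- Off the diagonal: `x` and `y` are residues modulo `suc t`, and `suc m` is the cyclic distance
    -- from `x` to `y`.
    data Q (i x y : ℕ) : Set where
      offset : ∀ m → m < t → (x ℕ.+ suc m) % suc t ≡ y → J x m i → Q i x y

    t-split : ∀ {m} → m < t → suc m ℕ.+ suc (t ∸ suc m) ≡ suc t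
    t-split {m} m<t = trans (ℕP.+-suc (suc m) _) (cong suc (ℕP.m+[n∸m]≡n m<t))

    Q-inverse : ∀ {i x y} → x < suc t → Q i x y → Q (r ∸ i) y x
    Q-inverse {i} {x} {y} x<n (offset m m<t refl j) = offset (t ∸ suc m) (ℕP.∸-monoʳ-< {o = 0} (s≤s z≤n) m<t) back
      (J-cong {suc m ℕ.+ x} {(x ℕ.+ suc m) % suc t} (trans (cong (row U) (ℕP.+-comm (suc m) x)) (row-% (x ℕ.+ suc m))) (J-inverse {x} {m} m<t j))
      where
      back : ((x ℕ.+ suc m) % suc t ℕ.+ suc (t ∸ suc m)) % suc t ≡ x
      back = trans (%-+ˡ (x ℕ.+ suc m) (suc (t ∸ suc m)) t)
        (trans (cong (_% suc t) (trans (ℕP.+-assoc x (suc m) _) (cong (x ℕ.+_) (t-split m<t))))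
        (trans ([m+n]%n≡m%n x (suc t)) (m<n⇒m%n≡m x<n)))

-- Evacuation, and the shift and half turn of the diagram

at-evacuation : ∀ X {n j} → length X ≡ suc n → j ≤ n → at (evacuation X) j ≡ at (row X (n ∸ j)) j
at-evacuation X {n} {j} len j≤n = trans (go (length X ∸ 1) (subst (j ≤_) (sym len′) j≤n))
    (trans (cong (λ N → diag X (N ∸ j) N) len′) (cong (at (row X (n ∸ j))) (ℕP.m∸[m∸n]≡n j≤n)))
  where
  len′ : length X ∸ 1 ≡ n
  len′ = cong (_∸ 1) len
  go : ∀ N → j ≤ N → at (reverse (map (λ i → diag X i N) (upTo (suc N)))) j ≡ diag X (N ∸ j) N
  go N j≤N = trans (at-nth (reverse l) j) (trans (nth-reverse [] l (subst (j <_) (sym len-l) (s≤s j≤N)))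
      (trans (cong (λ z → nth [] l (z ∸ suc j)) len-l)
      (trans (nth-map 0 [] (λ i → diag X i N) (upTo (suc N)) (subst (N ∸ j <_) (sym (ListP.length-upTo (suc N))) lt))
             (cong (λ i → diag X i N) (nth-applyUpTo 0 (λ x → x) (suc N) lt)))))
    where
    l : List Shape
    l = map (λ i → diag X i N) (upTo (suc N))
    len-l : length l ≡ suc N
    len-l = trans (ListP.length-map _ (upTo (suc N))) (ListP.length-upTo (suc N))
    lt : N ∸ j < suc N
    lt = s≤s (ℕP.m∸n≤m N j)

length-evacuation : ∀ X {n} → length X ≡ suc n → length (evacuation X) ≡ suc n
length-evacuation X {n} len = trans (ListP.length-reverse (map (λ i → diag X i (length X ∸ 1)) (upTo (suc (length X ∸ 1)))))
  (trans (ListP.length-map (λ i → diag X i (length X ∸ 1)) (upTo (suc (length X ∸ 1))))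
  (trans (ListP.length-upTo _) (cong (λ l → suc (l ∸ 1)) len)))

module Symmetries (r : ℕ) where
  open Cells r
  open Grids r
  open Shapes r
  open Diagrams r
  open Jumps r
  open Path

  Sq⇒≈ : ∀ {C A D B} → Sq C A D B → D ≈ (λ p → C p + (B p - A p))
  Sq⇒≈ (straight ε a η d _ _ b t) = ≈-local b t refl
  Sq⇒≈ {C} (bend ε η lo hi lt fl _ _ b t) = ≈-local b t (flat η)
    where
    flat : ∀ η → C (src η lo hi) ≡ C (tgt η lo hi)
    flat ⊞ = fl
    flat ⊟ = sym fl

  JR : List Shape → List Shape → ℕ → ℕ → Set
  JR R R′ m i = Jump (get (at R′ m)) (get (at R (suc m))) (get (at R′ (suc m))) (get (at R (suc (suc m)))) i

  module Shift {t k U} (P : Path (suc t) k U) (c : ℕ) where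
    open Rows P
    open Promotion P
    module V = Promotion (row-path c)

    σ : ℕ → ℕ
    σ x = (x ℕ.+ c) % suc t

    -- Row `x` below row `c` is row `x + c` of the original diagram, and periodicity reduces this
    -- number modulo `suc t`.
    J-shift : ∀ x m i → V.J x m i → J (σ x) m i
    J-shift x m i j = J-cong {x ℕ.+ c} {σ x} (row-% (x ℕ.+ c)) (subst₂ (λ R R′ → JR R R′ m i) (row-+ c x) (row-+ c (suc x)) j)

    J-unshift : ∀ x m i → J (σ x) m i → V.J x m i
    J-unshift x m i j = subst₂ (λ R R′ → JR R R′ m i) (sym (row-+ c x)) (sym (row-+ c (suc x)))
      (J-cong {σ x} {x ℕ.+ c} (sym (row-% (x ℕ.+ c))) j)

    σ-+ : ∀ x m → (σ x ℕ.+ m) % suc t ≡ σ ((x ℕ.+ m) % suc t)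
    σ-+ x m = trans (%-+ˡ (x ℕ.+ c) m t) (trans (cong (_% suc t) (trans (ℕP.+-assoc x c m)
      (trans (cong (x ℕ.+_) (ℕP.+-comm c m)) (sym (ℕP.+-assoc x m c))))) (sym (%-+ˡ (x ℕ.+ m) c t)))

    σ-injective : ∀ {x y} → x < suc t → y < suc t → σ x ≡ σ y → x ≡ y
    σ-injective {x} {y} x<n y<n eq = trans (sym (m<n⇒m%n≡m x<n)) (trans (%-cancelʳ {x} {y} c t eq) (m<n⇒m%n≡m y<n))

    Q-shift : ∀ {i x y} → V.Q i x y → Q i (σ x) (σ y)
    Q-shift {i} {x} (V.offset m m<t refl j) = offset m m<t (σ-+ x (suc m)) (J-shift x m i j)

    Q-unshift : ∀ {i x y} → y < suc t → Q i (σ x) (σ y) → V.Q i x y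
    Q-unshift {i} {x} {y} y<n (offset m m<t eq j) =
      V.offset m m<t (σ-injective (m%n<n (x ℕ.+ suc m) (suc t)) y<n (trans (sym (σ-+ x (suc m))) eq)) (J-unshift x m i j)

  module Evacuation {t k U} (P : Path (suc t) k U) where
    open Rows P
    open Periodic P
    open Promotion P

    at-V : ∀ {j} → j ≤ suc t → at (evacuation U) j ≡ at (row U (suc t ∸ j)) j
    at-V = at-evacuation U (length-path P)

    path-V : Path (suc t) k (evacuation U)
    path-V = record
      { length-path = length-evacuation U (length-path P)
      ; length-shape = λ {j} j≤ → subst (λ s → length s ≡ r) (sym (at-V j≤)) (length-shape (row-path (suc t ∸ j)) j≤)
      ; dom = λ {j} j≤ → subst (λ s → Dom (get s)) (sym (at-V j≤)) (dom (row-path (suc t ∸ j)) j≤)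
      ; steps = λ {j} j< → subst₂ (λ s s′ → AStep (get s) (get s′))
          (sym (trans (at-V (ℕP.<⇒≤ j<)) (cong (λ i → at (row U i) j) (ℕP.+-∸-assoc 1 j<)))) (sym (at-V j<))
          (vertical (suc t ∸ suc j) (ℕP.≤-pred j<))
      ; first = trans (at-V z≤n) (first (row-path (suc t)))
      ; last = trans (at-V ℕP.≤-refl) (trans (cong (λ i → at (row U i) (suc t)) (ℕP.n∸n≡0 t)) (last P))
      }

    module V = Rows path-V
    module VP = Promotion path-V

    evac-cell : ∀ {i j} → i < suc t → j < t →
      V.Λ i (suc j) ≐ κ k (Λ (suc t ∸ i) (t ∸ j)) → V.Λ i (suc (suc j)) ≐ κ k (Λ (suc t ∸ i) (t ∸ suc j)) →
      V.Λ (suc i) j ≐ κ k (Λ (t ∸ i) (suc t ∸ j)) → V.Λ (suc i) (suc j) ≐ κ k (Λ (t ∸ i) (t ∸ j))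
    evac-cell {i} {j} i<n j<t ha hb hc {p} p<r = trans (cong (λ s → get s p) here) (local-rule a b c
          (length-shape (V.row-path i) j<n) (length-shape (V.row-path i) (s≤s j<t)) (length-shape (V.row-path (suc i)) (ℕP.<⇒≤ j<n))
          {κ k A′} (Dom-κ k (dom (row-path x) (ℕP.m∸n≤m (suc t) (suc j)))) Y≈ p<r)
      where
      j<n : suc j ≤ suc t
      j<n = s≤s (ℕP.<⇒≤ j<t)
      a b c : Shape
      a = at (row (evacuation U) i) (suc j)
      b = at (row (evacuation U) i) (suc (suc j))
      c = at (row (evacuation U) (suc i)) j
      x m : ℕ
      x = t ∸ i
      m = t ∸ suc j
      A′ B′ C′ D′ : V
      A′ = Λ x (t ∸ j)
      B′ = Λ x (suc t ∸ j)
      C′ = Λ (suc x) m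
      D′ = Λ (suc x) (t ∸ j)
      e₁ : t ∸ j ≡ suc m
      e₁ = ℕP.+-∸-assoc 1 j<t
      e₂ : suc t ∸ j ≡ suc (suc m)
      e₂ = trans (ℕP.+-∸-assoc 1 (ℕP.<⇒≤ j<t)) (cong suc e₁)
      sq : Sq C′ A′ D′ B′
      sq = subst₂ (λ z z′ → Sq (Λ (suc x) m) (Λ x z) (Λ (suc x) z) (Λ x z′)) (sym e₁) (sym e₂) (square x (ℕP.∸-monoʳ-< {o = 0} (s≤s z≤n) j<t))
      here : at (row (evacuation U) (suc i)) (suc j) ≡ sortDesc ((b ⊕ c) ⊖ a)
      here = trans (cong (λ R → at R (suc j)) (V.row-suc i)) (trans (NextRow.at-R-suc (V.row-path i) j<t)
        (cong (λ z → sortDesc ((b ⊕ z) ⊖ a)) (cong (λ R → at R j) (sym (V.row-suc i)))))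
      row-i : suc t ∸ i ≡ suc x
      row-i = ℕP.+-∸-assoc 1 (ℕP.≤-pred i<n)
      a≐ : get a ≐ κ k D′
      a≐ {p} p<r = trans (ha p<r) (cong (λ z → k - Λ z (t ∸ j) (rev p)) row-i)
      b≐ : get b ≐ κ k C′
      b≐ {p} p<r = trans (hb p<r) (cong (λ z → k - Λ z m (rev p)) row-i)
      c≐ : get c ≐ κ k B′
      c≐ p<r = hc p<r
      Y≈ : κ k A′ ≈ (λ p → get c p + (get b p - get a p))
      Y≈ = ≈-trans (Sq⇒≈ (Sq-κ k sq)) (≐⇒≈ λ p<r →
          cong₂ _+_ (sym (c≐ p<r)) (cong₂ _-_ (sym (b≐ p<r)) (sym (a≐ p<r))))

    -- The complemented half turn maps cells to cells, hence obeys the local rule, and a diagram is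
    -- determined by its first row and its boundary. The first row agrees by `complement`, since row
    -- `suc t` equals row 0.
    evac-row : ∀ i {j} → i ≤ suc t → j ≤ suc t → V.Λ i j ≐ κ k (Λ (suc t ∸ i) (suc t ∸ j))
    evac-row zero {j} _ j≤ {p} p<r = trans (cong (λ s → get s p) (at-V j≤))
      (trans (cong₂ (λ a b → Λ a b p) (sym (ℕP.+-identityʳ (suc t ∸ j))) (sym (ℕP.m∸[m∸n]≡n j≤)))
      (trans (complement 0 (ℕP.m∸n≤m (suc t) j) p<r)
        (cong (λ R → k - get (at R (suc t ∸ j)) (rev p)) (sym (trans (cong (row U) (sym (ℕP.+-identityʳ (suc t)))) (row-period 0))))))
    evac-row (suc i) {j} i<n = go j
      where
      go : ∀ j → j ≤ suc t → V.Λ (suc i) j ≐ κ k (Λ (suc t ∸ suc i) (suc t ∸ j))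
      go zero _ {p} p<r = trans (V.Λ-first (suc i) p<r) (trans (sym (ℤP.+-inverseʳ k))
        (cong (λ x → k - x) (sym (Λ-last (suc t ∸ suc i) (rev-< p<r)))))
      go (suc j) j<n {p} p<r with j ℕ.<? t
      ... | yes j<t = evac-cell i<n j<t (evac-row i (ℕP.<⇒≤ i<n) j<n) (evac-row i (ℕP.<⇒≤ i<n) (s≤s j<t)) (go j (ℕP.<⇒≤ j<n)) p<r
      ... | no j≮t = trans (cong (λ z → V.Λ (suc i) (suc z) p) j≡t) (trans (V.Λ-last (suc i) p<r)
            (trans (l k) (cong (λ x → k - x) (sym (trans (cong (λ z → Λ (suc t ∸ suc i) z (rev p)) (trans (cong (t ∸_) j≡t) (ℕP.n∸n≡0 t)))
              (Λ-first (suc t ∸ suc i) (rev-< p<r)))))))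
        where
        j≡t : j ≡ t
        j≡t = ℕP.≤-antisym (ℕP.≤-pred j<n) (ℕP.≮⇒≥ j≮t)
        l : ∀ x → x ≡ x - 0ℤ
        l = solve-∀

    module Reflect {x m} (x<n : x < suc t) (m<t : m < t) where

      x′ m′ : ℕ
      x′ = t ∸ x
      m′ = t ∸ suc m

      m′<t : m′ < t
      m′<t = ℕP.∸-monoʳ-< {o = 0} (s≤s z≤n) m<t

      e₀ : suc t ∸ x ≡ suc x′
      e₀ = ℕP.+-∸-assoc 1 (ℕP.≤-pred x<n)

      e₁ : suc t ∸ suc m ≡ suc m′
      e₁ = ℕP.+-∸-assoc 1 m<t

      e₂ : suc t ∸ m ≡ suc (suc m′)
      e₂ = trans (ℕP.+-∸-assoc 1 (ℕP.<⇒≤ m<t)) (cong suc e₁)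

      sq : Sq (Λ (suc x′) m′) (Λ x′ (suc m′)) (Λ (suc x′) (suc m′)) (Λ x′ (suc (suc m′)))
      sq = square x′ m′<t

      C≐ : V.Λ (suc x) m ≐ κ k (Λ x′ (suc (suc m′)))
      C≐ {p} p<r = trans (evac-row (suc x) x<n (ℕP.<⇒≤ (ℕP.m<n⇒m<1+n m<t)) p<r) (cong (λ z → k - Λ x′ z (rev p)) e₂)
      A≐ : V.Λ x (suc m) ≐ κ k (Λ (suc x′) (suc m′))
      A≐ {p} p<r = trans (evac-row x (ℕP.<⇒≤ x<n) (s≤s (ℕP.<⇒≤ m<t)) p<r) (cong₂ (λ y z → k - Λ y z (rev p)) e₀ e₁)
      D≐ : V.Λ (suc x) (suc m) ≐ κ k (Λ x′ (suc m′))
      D≐ {p} p<r = trans (evac-row (suc x) x<n (s≤s (ℕP.<⇒≤ m<t)) p<r) (cong (λ z → k - Λ x′ z (rev p)) e₁)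
      B≐ : V.Λ x (suc (suc m)) ≐ κ k (Λ (suc x′) m′)
      B≐ {p} p<r = trans (evac-row x (ℕP.<⇒≤ x<n) (s≤s m<t) p<r) (cong (λ z → k - Λ z m′ (rev p)) e₀)

      J-from : ∀ {i} → VP.J x m i → J x′ m′ (r ∸ i)
      J-from {i} j = Jump-resp (κ-κ k {Λ (suc x′) m′}) (κ-κ k {Λ x′ (suc m′)}) (κ-κ k {Λ (suc x′) (suc m′)}) (κ-κ k {Λ x′ (suc (suc m′))})
        (Jump-κ k (Sq-κ k sq) (Jump-resp {C = V.Λ (suc x) m} {A = V.Λ x (suc m)} {D = V.Λ (suc x) (suc m)} {B = V.Λ x (suc (suc m))} C≐ A≐ D≐ B≐ j))

      J-to : ∀ {i} → J x′ m′ i → VP.J x m (r ∸ i)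
      J-to j = Jump-resp (λ p<r → sym (C≐ p<r)) (λ p<r → sym (A≐ p<r)) (λ p<r → sym (D≐ p<r)) (λ p<r → sym (B≐ p<r)) (Jump-κ k sq j)

    -- Reflecting both ends replaces the cyclic distance by its complement in `suc t`; after adding
    -- `x + suc m`, both sides are `t` modulo `suc t`.
    reflect-+ : ∀ {x y m} → x < suc t → y < suc t → m < t → (x ℕ.+ suc m) % suc t ≡ y → ((t ∸ x) ℕ.+ suc (t ∸ suc m)) % suc t ≡ t ∸ y
    reflect-+ {x} {y} {m} x<n y<n m<t refl = trans (%-cancelʳ {(t ∸ x) ℕ.+ suc (t ∸ suc m)} {t ∸ y} (x ℕ.+ suc m) t
        (trans (cong (_% suc t) sum) (trans ([m+n]%n≡m%n t (suc t))
          (sym (trans (sym (%-+ʳ (t ∸ y) (x ℕ.+ suc m) t)) (cong (_% suc t) (ℕP.m∸n+n≡m (ℕP.≤-pred y<n))))))))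
        (m<n⇒m%n≡m (s≤s (ℕP.m∸n≤m t y)))
      where
      sum : (t ∸ x) ℕ.+ suc (t ∸ suc m) ℕ.+ (x ℕ.+ suc m) ≡ t ℕ.+ suc t
      sum = trans (rearrange (t ∸ x) (suc (t ∸ suc m)) x (suc m))
        (cong₂ ℕ._+_ (ℕP.m∸n+n≡m (ℕP.≤-pred x<n)) (trans (ℕP.+-comm (suc (t ∸ suc m)) (suc m)) (t-split m<t)))
        where
        rearrange : ∀ a b c d → a ℕ.+ b ℕ.+ (c ℕ.+ d) ≡ (a ℕ.+ c) ℕ.+ (b ℕ.+ d)
        rearrange = ℕSolver.solve-∀

    Q-from : ∀ {i x y} → x < suc t → y < suc t → VP.Q i x y → Q (r ∸ i) (t ∸ x) (t ∸ y)
    Q-from {i} {x} {y} x<n y<n (VP.offset m m<t eq j) =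
      offset (t ∸ suc m) (Reflect.m′<t {x} {m} x<n m<t) (reflect-+ x<n y<n m<t eq) (Reflect.J-from {x} {m} x<n m<t j)

    Q-to : ∀ {i x y} → x < suc t → y < suc t → Q i (t ∸ x) (t ∸ y) → VP.Q (r ∸ i) x y
    Q-to {i} {x} {y} x<n y<n (offset m m<t eq j) = VP.offset m′ m′<t
        (trans (cong (λ z → (z ℕ.+ suc m′) % suc t) (sym (ℕP.m∸[m∸n]≡n (ℕP.≤-pred x<n))))
          (trans (reflect-+ {t ∸ x} (s≤s (ℕP.m∸n≤m t x)) (s≤s (ℕP.m∸n≤m t y)) m<t eq) (ℕP.m∸[m∸n]≡n (ℕP.≤-pred y<n))))
        (Reflect.J-to {x} {m′} x<n m′<t (subst (λ z → J (t ∸ x) z i) back j))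
      where
      m′ : ℕ
      m′ = t ∸ suc m
      m′<t : m′ < t
      m′<t = ℕP.∸-monoʳ-< {o = 0} (s≤s z≤n) m<t
      back : m ≡ t ∸ suc m′
      back = trans (sym (ℕP.m∸[m∸n]≡n (ℕP.<⇒≤ m<t))) (cong (t ∸_) (ℕP.+-∸-assoc 1 m<t))

-- Cyclic distance and the columns of the promotion matrix

if-<ᵇ : ∀ {A : Set} {x y} {a b : A} → x < y → (if x ℕ.<ᵇ y then a else b) ≡ a
if-<ᵇ {x = x} {y} lt with x ℕ.<ᵇ y | ℕP.<⇒<ᵇ lt
... | true | _ = refl

if-≮ᵇ : ∀ {A : Set} {x y} {a b : A} → ¬ (x < y) → (if x ℕ.<ᵇ y then a else b) ≡ b
if-≮ᵇ {x = x} {y} nlt with x ℕ.<ᵇ y in eq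
... | true  = ⊥-elim (nlt (ℕP.<ᵇ⇒< x y (subst T (sym eq) tt)))
... | false = refl

+suc∸suc : ∀ x m → x ℕ.+ suc m ∸ suc x ≡ m
+suc∸suc x m = trans (cong (_∸ suc x) (ℕP.+-suc x m)) (ℕP.m+n∸m≡n x m)

suc+∸ : ∀ x m → suc (x ℕ.+ m) ∸ x ≡ suc m
suc+∸ x m = trans (cong (_∸ x) (sym (ℕP.+-suc x m))) (ℕP.m+n∸m≡n x (suc m))

-- The column at which the definition of prom looks is suc (x + suc m),
-- where suc m is the cyclic distance from x to y.
jOf-offset : ∀ {t x y} → x < suc t → y < suc t → x ≢ y →
             ∃ λ m → m < t × jOf (suc t) (suc x) (suc y) ≡ suc (x ℕ.+ suc m) × (x ℕ.+ suc m) % suc t ≡ y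
jOf-offset {t} {x} {y} x<n y<n x≢y with x ℕ.<? y
... | yes x<y = y ∸ suc x , ℕP.<-≤-trans (ℕP.∸-monoʳ-< {o = 0} (s≤s z≤n) x<y) (ℕP.≤-pred y<n) ,
      trans (if-<ᵇ x<y) (cong suc (sym here)) , trans (cong (_% suc t) here) (m<n⇒m%n≡m y<n)
  where
  here : x ℕ.+ suc (y ∸ suc x) ≡ y
  here = trans (ℕP.+-suc x _) (ℕP.m+[n∸m]≡n x<y)
... | no x≮y = m , m<t , trans (if-≮ᵇ x≮y) (cong suc (sym here)) ,
      trans (cong (_% suc t) here) (trans ([m+n]%n≡m%n y (suc t)) (m<n⇒m%n≡m y<n))
  where
  y<x : y < x
  y<x = ℕP.≤∧≢⇒< (ℕP.≮⇒≥ x≮y) (λ e → x≢y (sym e))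
  m : ℕ
  m = t ∸ (x ∸ y)
  m<t : m < t
  m<t = ℕP.∸-monoʳ-< {o = 0} (ℕP.m<n⇒0<n∸m y<x) (ℕP.≤-trans (ℕP.m∸n≤m x y) (ℕP.≤-pred x<n))
  here : x ℕ.+ suc m ≡ y ℕ.+ suc t
  here = trans (cong (ℕ._+ suc m) (sym (ℕP.m+[n∸m]≡n (ℕP.<⇒≤ y<x)))) (trans (ℕP.+-assoc y (x ∸ y) (suc m))
    (cong (y ℕ.+_) (trans (ℕP.+-suc (x ∸ y) m) (cong suc (ℕP.m+[n∸m]≡n (ℕP.≤-trans (ℕP.m∸n≤m x y) (ℕP.≤-pred x<n)))))))

offset-≢ : ∀ {t x m} → x < suc t → m < t → x ≢ (x ℕ.+ suc m) % suc t
offset-≢ {t} {x} {m} x<n m<t eq = ℕP.1+n≢0 (trans (sym (m<n⇒m%n≡m (s≤s m<t)))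
  (%-cancelʳ {suc m} {0} x t (trans (cong (_% suc t) (ℕP.+-comm (suc m) x)) (trans (sym eq) (sym (m<n⇒m%n≡m x<n))))))

offset-unique : ∀ {t x m m′} → m < t → m′ < t → (x ℕ.+ suc m) % suc t ≡ (x ℕ.+ suc m′) % suc t → m ≡ m′
offset-unique {t} {x} {m} {m′} m<t m′<t eq = ℕP.suc-injective (trans (sym (m<n⇒m%n≡m (s≤s m<t))) (trans
  (%-cancelʳ {suc m} {suc m′} x t (trans (cong (_% suc t) (ℕP.+-comm (suc m) x)) (trans eq (cong (_% suc t) (ℕP.+-comm x (suc m′))))))
  (m<n⇒m%n≡m (s≤s m′<t))))

-- The promotion functions of an oscillating tableau

module PromotionFunctions (r : ℕ) where
  open Cells r
  open Grids r
  open Shapes r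
  open Diagrams r
  open Jumps r
  open Symmetries r
  open Path

  -- The pairs of `i` and `r ∸ i` once index `r` has been replaced by 0, which is therefore its own
  -- partner.
  data Dual : ℕ → ℕ → Set where
    trivial : Dual 0 0
    inner   : ∀ {i} → 0 < i → i < r → Dual i (r ∸ i)

  Dual-sym : ∀ {i i′} → Dual i i′ → Dual i′ i
  Dual-sym trivial = trivial
  Dual-sym (inner {i} 0<i i<r) = subst (Dual (r ∸ i)) (ℕP.m∸[m∸n]≡n (ℕP.<⇒≤ i<r))
    (inner (ℕP.m<n⇒0<n∸m i<r) (ℕP.∸-monoʳ-< {o = 0} 0<i (ℕP.<⇒≤ i<r)))

  length-add : ∀ {μ} ε a → length μ ≡ r → length (μ ⊕ e r (letter ε a)) ≡ r
  length-add {μ} ε a len = trans (length-zipWith-≡ _+_ μ _ (trans len (sym (length-e r ε a)))) len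

  get-add : ∀ {μ} ε a → length μ ≡ r → get (μ ⊕ e r (letter ε a)) ≐ add ε a (get μ)
  get-add {μ} ε a len {p} p<r = trans (get-⊕ {μ} {e r (letter ε a)} (trans len (sym (length-e r ε a))) p)
    (cong (_+_ (get μ p)) (get-e r ε a p<r))

  Step⇒≡ : ∀ {ε a μ ν} → length μ ≡ r → length ν ≡ r → Step ε a (get μ) (get ν) → ν ≡ μ ⊕ e r (letter ε a)
  Step⇒≡ {ε} {a} {μ} {ν} lμ lν s = shape-ext lν (length-add {μ} ε a lμ) λ p<r → trans (eqn s p<r) (sym (get-add {μ} ε a lμ p<r))

  ≡⇒Step : ∀ {ε a μ ν} → a < r → length μ ≡ r → ν ≡ μ ⊕ e r (letter ε a) → Step ε a (get μ) (get ν)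
  ≡⇒Step {ε} {a} {μ} a<r lμ refl = step a<r (get-add {μ} ε a lμ)

  Letter-letter : ∀ ε {a} → a < r → Letter r (letter ε a)
  Letter-letter ⊞ a<r = s≤s z≤n , a<r
  Letter-letter ⊟ a<r = s≤s z≤n , a<r

  InM-letter : ∀ ε {a b i} → Between ε a b i → InM (letter ε a) (letter ε b) i
  InM-letter ⊞ (a<i , i≤b) = pos a<i (s≤s i≤b)
  InM-letter ⊟ (b<i , i≤a) = neg b<i (s≤s i≤a)

  module Prom-Path {t k U} (P : Path (suc t) k U) where
    open Rows P
    open Promotion P

    E : ℕ → ℕ → ℕ → Set
    E i x y = (i ≡ 0 × x ≡ y) ⊎ Q i x y

    Q-pos : ∀ {i x y} → Q i x y → 0 < i
    Q-pos (offset _ _ _ (⊞ , _ , _ , _ , _ , a<i , _)) = ℕP.≤-<-trans z≤n a<i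
    Q-pos (offset _ _ _ (⊟ , _ , _ , _ , _ , b<i , _)) = ℕP.≤-<-trans z≤n b<i

    E-total : ∀ {i i′ x} → Dual i i′ → x < suc t → ∃ λ y → y < suc t × E i x y
    E-total {x = x} trivial x<n = x , x<n , inj₁ (refl , refl)
    E-total {i} {x = x} (inner 0<i i<r) x<n =
      let (m , m<t , j) = J-exists x {i} 0<i i<r in
      (x ℕ.+ suc m) % suc t , m%n<n (x ℕ.+ suc m) (suc t) , inj₂ (offset m m<t refl j)

    E-functional : ∀ {i x y y′} → E i x y → E i x y′ → y ≡ y′
    E-functional (inj₁ (_ , refl)) (inj₁ (_ , refl)) = refl
    E-functional (inj₁ (refl , _)) (inj₂ q) = ⊥-elim (ℕP.<-irrefl refl (Q-pos q))
    E-functional (inj₂ q) (inj₁ (refl , _)) = ⊥-elim (ℕP.<-irrefl refl (Q-pos q))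
    E-functional {i} {x} (inj₂ (offset m m<t eq j)) (inj₂ (offset m′ m′<t eq′ j′)) =
      trans (sym eq) (trans (cong (λ z → (x ℕ.+ suc z) % suc t) (J-unique x {i} {m} {m′} m<t m′<t j j′)) eq′)

    E-inverse : ∀ {i i′ x y} → Dual i i′ → x < suc t → E i x y → E i′ y x
    E-inverse trivial x<n (inj₁ (_ , eq)) = inj₁ (refl , sym eq)
    E-inverse trivial x<n (inj₂ q) = ⊥-elim (ℕP.<-irrefl refl (Q-pos q))
    E-inverse (inner () _) x<n (inj₁ (refl , _))
    E-inverse {i} {_} {x} {y} (inner _ _) x<n (inj₂ q) = inj₂ (Q-inverse {i} {x} {y} x<n q)

    N : ℕ
    N = length U ∸ 1

    N≡ : N ≡ suc t
    N≡ = cong (_∸ 1) (length-path P)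

    toE : ∀ {i x y} → PromOsc r U i (suc x) (suc y) → E i x y
    toE (_ , _ , inj₁ (eq , refl)) = inj₁ (refl , ℕP.suc-injective eq)
    toE {i} {x} {y} ((_ , x<N) , (_ , y<N) , inj₂ (x≢y , a , b , La , Lb , eqa , eqb , im)) = go (jOf-offset x<n y<n (λ eq → x≢y (cong suc eq)))
      where
      x<n : x < suc t
      x<n = subst (suc x ≤_) N≡ x<N
      y<n : y < suc t
      y<n = subst (suc y ≤_) N≡ y<N
      go : (∃ λ m → m < t × jOf (suc t) (suc x) (suc y) ≡ suc (x ℕ.+ suc m) × (x ℕ.+ suc m) % suc t ≡ y) → E i x y
      go (m , m<t , jeq , meq) = inj₂ (offset m m<t meq (jump a b La Lb im left right))
        where
        j≡ : jOf N (suc x) (suc y) ≡ suc (x ℕ.+ suc m)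
        j≡ = trans (cong (λ n → jOf n (suc x) (suc y)) N≡) jeq
        left : at (row U x) (suc m) ≡ at (row U (suc x)) m ⊕ e r a
        left = trans (cong (at (row U x)) (sym (ℕP.m+n∸m≡n x (suc m)))) (trans (subst (λ j → diag U x (j ∸ 1) ≡ diag U (suc x) (j ∸ 1) ⊕ e r a) j≡ eqa)
          (cong (λ z → at (row U (suc x)) z ⊕ e r a) (+suc∸suc x m)))
        right : at (row U x) (suc (suc m)) ≡ at (row U (suc x)) (suc m) ⊕ e r b
        right = trans (cong (at (row U x)) (sym (suc+∸ x (suc m)))) (trans (subst (λ j → diag U x j ≡ diag U (suc x) j ⊕ e r b) j≡ eqb)
          (cong (λ z → at (row U (suc x)) z ⊕ e r b) (ℕP.m+n∸m≡n x (suc m))))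
        len₀ : length (at (row U (suc x)) m) ≡ r
        len₀ = length-shape (row-path (suc x)) (ℕP.<⇒≤ (ℕP.m<n⇒m<1+n m<t))
        len₁ : length (at (row U (suc x)) (suc m)) ≡ r
        len₁ = length-shape (row-path (suc x)) (s≤s (ℕP.<⇒≤ m<t))
        jump : ∀ a b → Letter r a → Letter r b → InM a b i → at (row U x) (suc m) ≡ at (row U (suc x)) m ⊕ e r a →
               at (row U x) (suc (suc m)) ≡ at (row U (suc x)) (suc m) ⊕ e r b → J x m i
        jump (+ suc a) (+ suc b) (_ , a<r) (_ , b<r) (pos a<i i<b) l r′ = ⊞ , a , b ,
          ≡⇒Step a<r len₀ l , ≡⇒Step b<r len₁ r′ , a<i , ℕP.≤-pred i<b
        jump -[1+ a ] -[1+ b ] (_ , a<r) (_ , b<r) (neg b<i i<a) l r′ = ⊟ , a , b ,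
          ≡⇒Step a<r len₀ l , ≡⇒Step b<r len₁ r′ , b<i , ℕP.≤-pred i<a

    fromE : ∀ {i x y} → x < suc t → y < suc t → E i x y → PromOsc r U i (suc x) (suc y)
    fromE {i} {x} {y} x<n y<n ex = (s≤s z≤n , subst (suc x ≤_) (sym N≡) x<n) , (s≤s z≤n , subst (suc y ≤_) (sym N≡) y<n) , go ex
      where
      j : ℕ
      j = jOf N (suc x) (suc y)
      Body : Set
      Body = (suc x ≡ suc y × i ≡ 0) ⊎ (suc x ≢ suc y × Σ ℤ λ a → Σ ℤ λ b → Letter r a × Letter r b ×
              diag U x (j ∸ 1) ≡ diag U (suc x) (j ∸ 1) ⊕ e r a × diag U x j ≡ diag U (suc x) j ⊕ e r b × InM a b i)
      go : E i x y → Body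
      go (inj₁ (refl , refl)) = inj₁ (refl , refl)
      go (inj₂ (offset m m<t meq (ε , a , b , l , r′ , bt))) =
        inj₂ ((λ eq → x≢y (ℕP.suc-injective eq)) , letter ε a , letter ε b , Letter-letter ε (bound l) , Letter-letter ε (bound r′) , left , right , InM-letter ε bt)
        where
        x≢y : x ≢ y
        x≢y eq = offset-≢ x<n m<t (trans eq (sym meq))
        j≡ : j ≡ suc (x ℕ.+ suc m)
        j≡ with jOf-offset x<n y<n x≢y
        ... | m″ , m″<t , jeq , meq′ = trans (cong (λ n → jOf n (suc x) (suc y)) N≡)
          (trans jeq (cong (λ z → suc (x ℕ.+ suc z)) (offset-unique {t} {x} m″<t m<t (trans meq′ (sym meq)))))
        left : diag U x (j ∸ 1) ≡ diag U (suc x) (j ∸ 1) ⊕ e r (letter ε a)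
        left = subst (λ j → diag U x (j ∸ 1) ≡ diag U (suc x) (j ∸ 1) ⊕ e r (letter ε a)) (sym j≡)
          (trans (cong (at (row U x)) (ℕP.m+n∸m≡n x (suc m))) (trans
            (Step⇒≡ (length-shape (row-path (suc x)) (ℕP.<⇒≤ (ℕP.m<n⇒m<1+n m<t))) (length-shape (row-path x) (s≤s (ℕP.<⇒≤ m<t))) l)
            (cong (λ z → at (row U (suc x)) z ⊕ e r (letter ε a)) (sym (+suc∸suc x m)))))
        right : diag U x j ≡ diag U (suc x) j ⊕ e r (letter ε b)
        right = subst (λ j → diag U x j ≡ diag U (suc x) j ⊕ e r (letter ε b)) (sym j≡)
          (trans (cong (at (row U x)) (suc+∸ x (suc m))) (trans
            (Step⇒≡ (length-shape (row-path (suc x)) (s≤s (ℕP.<⇒≤ m<t))) (length-shape (row-path x) (s≤s m<t)) r′)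
            (cong (λ z → at (row U (suc x)) z ⊕ e r (letter ε b)) (sym (ℕP.m+n∸m≡n x (suc m))))))

    inT : ∀ {i u v} → PromOsc r U i u v → InT (suc t) u × InT (suc t) v
    inT {_} {u} {v} ((a , b) , (c , d) , _) = (a , subst (u ≤_) N≡ b) , (c , subst (v ≤_) N≡ d)

    inverse : ∀ {i i′} → Dual i i′ → ∀ u v → PromOsc r U i u v → PromOsc r U i′ v u
    inverse d u v p with inT p
    inverse d (suc x) (suc y) p | (_ , x<n) , (_ , y<n) = fromE y<n x<n (E-inverse d x<n (toE p))

    functional : ∀ {i} u v v′ → PromOsc r U i u v → PromOsc r U i u v′ → v ≡ v′
    functional u v v′ p p′ with inT p | inT p′
    functional (suc x) (suc y) (suc y′) p p′ | _ | _ = cong suc (E-functional (toE p) (toE p′))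

    total : ∀ {i i′} → Dual i i′ → ∀ u → InT (suc t) u → ∃ λ v → PromOsc r U i u v
    total d (suc x) (_ , x<n) with E-total d x<n
    ... | y , y<n , ex = suc y , fromE x<n y<n ex

    -- Injectivity and surjectivity are functionality and totality of the inverse relation, which
    -- belongs to the dual index.
    isPermutation : ∀ {i i′} → Dual i i′ → IsPermutation (suc t) (PromOsc r U i)
    isPermutation d = (λ u v p → inT p) , total d , functional ,
      (λ u u′ v p p′ → functional v u u′ (inverse d u v p) (inverse d u′ v p′)) ,
      (λ v iv → let (u , p) = total (Dual-sym d) v iv in u , inverse (Dual-sym d) v u p)

  module Prom-Theorems {t k U} (P : Path (suc t) k U) where
    open Prom-Path P

    inverse⇔ : ∀ {i i′} → Dual i i′ → ∀ u v → PromOsc r U i u v ⇔ PromOsc r U i′ v u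
    inverse⇔ d u v = mk⇔ (inverse d u v) (inverse (Dual-sym d) v u)

    shift⇔ : ∀ {i} c u v → InT (suc t) u → InT (suc t) v →
             PromOsc r (row U c) i u v ⇔ PromOsc r U i (σpow (suc t) c u) (σpow (suc t) c v)
    shift⇔ {i} c (suc x) (suc y) (_ , x<n) (_ , y<n) =
      mk⇔ (λ p → fromE (m%n<n (x ℕ.+ c) (suc t)) (m%n<n (y ℕ.+ c) (suc t)) (to (V.toE p))) (λ p → V.fromE x<n y<n (from (toE p)))
      where
      module V = Prom-Path (Rows.row-path P c)
      open Shift P c hiding (module V)
      to : V.E i x y → E i (σ x) (σ y)
      to (inj₁ (i≡0 , eq)) = inj₁ (i≡0 , cong σ eq)
      to (inj₂ q) = inj₂ (Q-shift q)
      from : E i (σ x) (σ y) → V.E i x y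
      from (inj₁ (i≡0 , eq)) = inj₁ (i≡0 , σ-injective x<n y<n eq)
      from (inj₂ q) = inj₂ (Q-unshift y<n q)

    evacuation⇔ : ∀ {i i′} → Dual i i′ → ∀ u v → InT (suc t) u → InT (suc t) v →
                  PromOsc r (evacuation U) i u v ⇔ PromOsc r U i′ (w₀ (suc t) u) (w₀ (suc t) v)
    evacuation⇔ {i} {i′} d (suc x) (suc y) (_ , x<n) (_ , y<n) = mk⇔
        (λ p → subst₂ (PromOsc r U i′) (w-eq x<n) (w-eq y<n) (fromE (s≤s (ℕP.m∸n≤m t x)) (s≤s (ℕP.m∸n≤m t y)) (to d (V.toE p))))
        (λ p → V.fromE x<n y<n (from d (toE (subst₂ (PromOsc r U i′) (sym (w-eq x<n)) (sym (w-eq y<n)) p))))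
      where
      open Evacuation P hiding (module V)
      module V = Prom-Path path-V
      w-eq : ∀ {x} → x < suc t → suc (t ∸ x) ≡ suc t ∸ x
      w-eq x<n = sym (ℕP.+-∸-assoc 1 (ℕP.≤-pred x<n))
      to : ∀ {i i′} → Dual i i′ → V.E i x y → E i′ (t ∸ x) (t ∸ y)
      to trivial (inj₁ (_ , eq)) = inj₁ (refl , cong (t ∸_) eq)
      to trivial (inj₂ q) = ⊥-elim (ℕP.<-irrefl refl (V.Q-pos q))
      to (inner () _) (inj₁ (refl , _))
      to (inner _ _) (inj₂ q) = inj₂ (Q-from x<n y<n q)
      from : ∀ {i i′} → Dual i i′ → E i′ (t ∸ x) (t ∸ y) → V.E i x y
      from trivial (inj₁ (_ , eq)) = inj₁ (refl , ℕP.∸-cancelˡ-≡ (ℕP.≤-pred x<n) (ℕP.≤-pred y<n) eq)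
      from trivial (inj₂ q) = ⊥-elim (ℕP.<-irrefl refl (Q-pos q))
      from (inner 0<i i<r) (inj₁ (r∸i≡0 , _)) = ⊥-elim (ℕP.<⇒≢ (ℕP.m<n⇒0<n∸m i<r) (sym r∸i≡0))
      from (inner {i} 0<i i<r) (inj₂ q) = inj₂ (subst (λ i → VP.Q i x y) (ℕP.m∸[m∸n]≡n (ℕP.<⇒≤ i<r)) (Q-to x<n y<n q))

-- Blocks of cells with ascending sides

module Blocks (r : ℕ) where
  open Cells r
  open Shapes r
  open Diagrams r
  open Symmetries r

  data Asc (X Y Z : V) : Set where
    asc : ∀ η c₁ c₂ → Step η c₁ X Y → Step η c₂ Y Z → Lt η c₁ c₂ → Asc X Y Z

  Asc-resp : ∀ {X Y Z X′ Y′ Z′} → X ≐ X′ → Y ≐ Y′ → Z ≐ Z′ → Asc X Y Z → Asc X′ Y′ Z′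
  Asc-resp x y z (asc η c₁ c₂ s₁ s₂ lt) = asc η c₁ c₂ (Step-resp x y s₁) (Step-resp y z s₂) lt

  Asc-κ : ∀ k {X Y Z} → Asc X Y Z → Asc (κ k Z) (κ k Y) (κ k X)
  Asc-κ k (asc η c₁ c₂ s₁ s₂ lt) = asc η (rev c₂) (rev c₁) (Step-κ k s₂) (Step-κ k s₁) (flip η lt)
    where
    flip : ∀ η → Lt η c₁ c₂ → Lt η (rev c₂) (rev c₁)
    flip ⊞ lt = rev-anti-< lt (bound s₂)
    flip ⊟ lt = rev-anti-< lt (bound s₁)

  -- A cell seen through its horizontal sides; of a bend only the flatness at the two corners is
  -- retained.
  data Horizontal (C A D B : V) : Set where
    level : ∀ η d → Step η d C D → Step η d A B → Horizontal C A D B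
    sink  : ∀ η lo hi → lo < hi → C lo ≡ C hi → B lo ≡ B hi → lo < r → hi < r →
            Step η (src η lo hi) C D → Step η (tgt η lo hi) A B → Horizontal C A D B

  horizontal : ∀ {C A D B} → Sq C A D B → Horizontal C A D B
  horizontal (straight ε a η d l r b t) = level η d b t
  horizontal (bend ε η lo hi lt fl l r b t) =
    sink η lo hi lt fl (bend-upper-flat lt fl l r b t) (proj₁ (bend-bounds lt l r)) (proj₂ (bend-bounds lt l r)) b t

  bottom-of : ∀ {C A D B η c} → Sq C A D B → Step η c A B → ∃ λ d → Step η d C D × Le η d c
  bottom-of s t with horizontal s
  ... | level η d b t′ with Step-unique t t′
  ...   | refl , refl = d , b , Le-refl η
  bottom-of s t | sink η lo hi lt _ _ _ _ b t′ with Step-unique t t′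
  ...   | refl , refl = src η lo hi , b , Lt⇒Le η (src-Lt-tgt η lt)

  top-of : ∀ {C A D B η d} → Sq C A D B → Step η d C D → ∃ λ c → Step η c A B × Le η d c
  top-of s b with horizontal s
  ... | level η d b′ t with Step-unique b b′
  ...   | refl , refl = d , t , Le-refl η
  top-of s b | sink η lo hi lt _ _ _ _ b′ t with Step-unique b b′
  ...   | refl , refl = tgt η lo hi , t , Lt⇒Le η (src-Lt-tgt η lt)

  step-at : ∀ ε {a X Y} → Step ε a X Y → Y a ≡ X a + val ε 1ℤ
  step-at ⊞ {a} {X} s = trans (eqn s (bound s)) (cong (_+_ (X a)) (δ-≡ a))
  step-at ⊟ {a} {X} s = trans (eqn s (bound s)) (cong (λ x → X a + - x) (δ-≡ a))

  step-off : ∀ {ε a X Y p} → Step ε a X Y → p < r → a ≢ p → Y p ≡ X p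
  step-off {ε} {a} {X} {p = p} s p<r a≢p = trans (eqn s p<r) (trans (cong (_+_ (X p)) (unit-≢ ε a≢p)) (ℤP.+-identityʳ (X p)))

  private
    -1≱ : ∀ {x} → ¬ (x ℤ.≤ x - 1ℤ)
    -1≱ {x} p = 1+≰ {x - 1ℤ} (subst (ℤ._≤ x - 1ℤ) (l x) p)
      where
      l : ∀ x → x ≡ x - 1ℤ + 1ℤ
      l = solve-∀

  -- Only a bend of the second cell could break the order. Then `d₁` would lie on the plateau of
  -- `C₁` from `lo` to `hi`, but the step at `d₁` has just changed that entry, and `C₀` could not
  -- decrease as well.
  pairDown : ∀ {C₀ A₀ C₁ A₁ C₂ A₂} → Dom C₀ → Dom C₁ → Sq C₀ A₀ C₁ A₁ → Sq C₁ A₁ C₂ A₂ → Asc A₀ A₁ A₂ → Asc C₀ C₁ C₂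
  pairDown {C₀} {C₁ = C₁} dC₀ dC₁ s₁ s₂ (asc η c₁ c₂ t₁ t₂ lt) with bottom-of s₁ t₁ | horizontal s₂
  ... | d₁ , b₁ , d₁≤c₁ | level η′ d₂ b₂ t₂′ with Step-unique t₂ t₂′
  ...   | refl , refl = asc η d₁ d₂ b₁ b₂ (Le-Lt-trans η d₁≤c₁ lt)
  pairDown {C₀} {C₁ = C₁} dC₀ dC₁ s₁ s₂ (asc η c₁ c₂ t₁ t₂ lt) | d₁ , b₁ , d₁≤c₁ | sink η′ lo hi lh fl _ lo<r hi<r b₂ t₂′ with Step-unique t₂ t₂′
  ...   | refl , refl = asc η d₁ (src η lo hi) b₁ b₂ (order η b₁ (Le-Lt-trans η d₁≤c₁ lt))
    where
    order : ∀ η → Step η d₁ C₀ C₁ → Lt η d₁ (tgt η lo hi) → Lt η d₁ (src η lo hi)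
    order ⊞ b₁ d₁<hi = ℕP.≰⇒> λ lo≤d₁ → 1+≰ {C₀ d₁} (ℤP.≤-trans (ℤP.≤-reflexive (sym (step-at ⊞ b₁)))
      (ℤP.≤-trans (dC₁ lo≤d₁ (bound b₁)) (ℤP.≤-trans (ℤP.≤-reflexive (trans fl (step-off b₁ hi<r (ℕP.<⇒≢ d₁<hi)))) (dC₀ (ℕP.<⇒≤ d₁<hi) hi<r))))
    order ⊟ b₁ lo<d₁ = ℕP.≰⇒> λ d₁≤hi → -1≱ {C₀ d₁} (ℤP.≤-trans (dC₀ (ℕP.<⇒≤ lo<d₁) (bound b₁))
      (ℤP.≤-trans (ℤP.≤-reflexive (trans (sym (step-off b₁ lo<r (λ e → ℕP.<⇒≢ lo<d₁ (sym e)))) fl))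
      (ℤP.≤-trans (dC₁ d₁≤hi hi<r) (ℤP.≤-reflexive (step-at ⊟ b₁)))))

  -- The mirror image of `pairDown`: the plateau is now that of `A₁`, and the second upper step
  -- would break the decrease of `A₂`.
  pairUp : ∀ {C₀ A₀ C₁ A₁ C₂ A₂} → Dom A₁ → Dom A₂ → Sq C₀ A₀ C₁ A₁ → Sq C₁ A₁ C₂ A₂ → Asc C₀ C₁ C₂ → Asc A₀ A₁ A₂
  pairUp {A₁ = A₁} {A₂ = A₂} dA₁ dA₂ s₁ s₂ (asc η d₁ d₂ b₁ b₂ lt) with top-of s₂ b₂ | horizontal s₁
  ... | c₂ , t₂ , d₂≤c₂ | level η′ c₁ b₁′ t₁ with Step-unique b₁ b₁′
  ...   | refl , refl = asc η c₁ c₂ t₁ t₂ (Lt-Le-trans η lt d₂≤c₂)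
  pairUp {A₁ = A₁} {A₂ = A₂} dA₁ dA₂ s₁ s₂ (asc η d₁ d₂ b₁ b₂ lt) | c₂ , t₂ , d₂≤c₂ | sink η′ lo hi lh _ fl lo<r hi<r b₁′ t₁ with Step-unique b₁ b₁′
  ...   | refl , refl = asc η (tgt η lo hi) c₂ t₁ t₂ (order η t₂ (Lt-Le-trans η lt d₂≤c₂))
    where
    order : ∀ η → Step η c₂ A₁ A₂ → Lt η (src η lo hi) c₂ → Lt η (tgt η lo hi) c₂
    order ⊞ t₂ lo<c₂ = ℕP.≰⇒> λ c₂≤hi → 1+≰ {A₁ c₂} (ℤP.≤-trans (ℤP.≤-reflexive (sym (step-at ⊞ t₂)))
      (ℤP.≤-trans (dA₂ (ℕP.<⇒≤ lo<c₂) (bound t₂)) (ℤP.≤-trans (ℤP.≤-reflexive (trans (step-off t₂ lo<r (λ e → ℕP.<⇒≢ lo<c₂ (sym e))) fl)) (dA₁ c₂≤hi hi<r))))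
    order ⊟ t₂ c₂<hi = ℕP.≰⇒> λ lo≤c₂ → -1≱ {A₁ c₂} (ℤP.≤-trans (dA₁ lo≤c₂ (bound t₂))
      (ℤP.≤-trans (ℤP.≤-reflexive (trans fl (sym (step-off t₂ hi<r (ℕP.<⇒≢ c₂<hi)))))
      (ℤP.≤-trans (dA₂ (ℕP.<⇒≤ c₂<hi) hi<r) (ℤP.≤-reflexive (step-at ⊟ t₂)))))

  record AscPath (X : ℕ → V) (m : ℕ) : Set where
    constructor ascPath
    field
      unit-steps : ∀ {j} → j < m → AStep (X j) (X (suc j))
      ascending  : ∀ {j} → suc j < m → Asc (X j) (X (suc j)) (X (suc (suc j)))

  -- Rows of the diagram are numbered downwards while vertical steps point upwards, so a column is
  -- an ascending path listed from its end.
  record DescPath (X : ℕ → V) (m : ℕ) : Set where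
    constructor descPath
    field
      unit-steps : ∀ {j} → j < m → AStep (X (suc j)) (X j)
      ascending  : ∀ {j} → suc j < m → Asc (X (suc (suc j))) (X (suc j)) (X j)

  AscPath-resp : ∀ {X Y m} → (∀ {j} → j ≤ m → X j ≐ Y j) → AscPath X m → AscPath Y m
  AscPath-resp eq (ascPath st as) = ascPath
    (λ j<m → let (ε , a , s) = st j<m in ε , a , Step-resp (eq (ℕP.<⇒≤ j<m)) (eq j<m) s)
    (λ {j} lt → Asc-resp (eq (ℕP.<⇒≤ (ℕP.<-trans (ℕP.n<1+n j) lt))) (eq (ℕP.<⇒≤ lt)) (eq lt) (as lt))

  AscPath-tail : ∀ {X m} → AscPath X (suc m) → AscPath (X ∘ suc) m
  AscPath-tail (ascPath st as) = ascPath (λ lt → st (s≤s lt)) (λ lt → as (s≤s lt))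

  DescPath-tail : ∀ {X m} → DescPath X (suc m) → DescPath (X ∘ suc) m
  DescPath-tail (descPath st as) = descPath (λ lt → st (s≤s lt)) (λ lt → as (s≤s lt))

  AscPath-init : ∀ {X m n} → n ≤ m → AscPath X m → AscPath X n
  AscPath-init n≤m (ascPath st as) = ascPath (λ lt → st (ℕP.<-≤-trans lt n≤m)) (λ lt → as (ℕP.<-≤-trans lt n≤m))

  DescPath-resp : ∀ {X Y m} → (∀ {j} → j ≤ m → X j ≐ Y j) → DescPath X m → DescPath Y m
  DescPath-resp eq (descPath st as) = descPath
    (λ j<m → let (ε , a , s) = st j<m in ε , a , Step-resp (eq j<m) (eq (ℕP.<⇒≤ j<m)) s)
    (λ {j} lt → Asc-resp (eq lt) (eq (ℕP.<⇒≤ lt)) (eq (ℕP.<⇒≤ (ℕP.<-trans (ℕP.n<1+n j) lt))) (as lt))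

  AscPath-reverse : ∀ {X} m → AscPath X m → DescPath (λ j → X (m ∸ j)) m
  AscPath-reverse {X} m (ascPath st as) = descPath
    (λ {j} lt → subst (λ z → AStep (X (m ∸ suc j)) (X z)) (sym (ℕP.+-∸-assoc 1 lt)) (st (ℕP.∸-monoʳ-< {o = 0} (s≤s z≤n) lt)))
    (λ {j} lt → subst₂ (λ y z → Asc (X (m ∸ suc (suc j))) (X y) (X z)) (sym (ℕP.+-∸-assoc 1 lt))
      (sym (trans (ℕP.+-∸-assoc 1 (ℕP.<⇒≤ lt)) (cong suc (ℕP.+-∸-assoc 1 lt))))
      (as (subst (_≤ m) (trans (ℕP.+-∸-assoc 1 (ℕP.<⇒≤ lt)) (cong suc (ℕP.+-∸-assoc 1 lt))) (ℕP.m∸n≤m m j))))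

  DescPath-κ : ∀ k {X m} → DescPath X m → AscPath (λ j → κ k (X j)) m
  DescPath-κ k (descPath st as) = ascPath
    (λ lt → let (ε , a , s) = st lt in ε , rev a , Step-κ k s) (λ lt → Asc-κ k (as lt))

  -- Letters ascend strictly, so rows up to the first letter are not touched again. The two variants
  -- below say the same of rows from the last letter on.
  first-step-rest : ∀ {η c} X m → AscPath X (suc m) → Step η c (X 0) (X 1) → ∀ {p} → p < r → Le η p c → X (suc m) p ≡ X 1 p
  first-step-rest X zero    a s p<r p≤c = refl
  first-step-rest {η} X (suc m) a s {p} p<r p≤c with AscPath.ascending a (s≤s (s≤s z≤n))
  ... | asc η′ c₁ c₂ s₁ s₂ lt with Step-unique s s₁
  ...   | refl , refl = trans (first-step-rest (X ∘ suc) m (AscPath-tail a) s₂ p<r (Le-trans η p≤c (Lt⇒Le η lt)))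
            (step-off s₂ p<r (λ e → Lt⇒≢ η (Le-Lt-trans η p≤c lt) (sym e)))

  last-step-rest : ∀ {η c} X m → AscPath X (suc m) → Step η c (X m) (X (suc m)) → ∀ {p} → p < r → Le η c p → X m p ≡ X 0 p
  last-step-rest X zero    a s p<r c≤p = refl
  last-step-rest {η} X (suc m) a s {p} p<r c≤p with AscPath.ascending a ℕP.≤-refl
  ... | asc η′ c₁ c₂ s₁ s₂ lt with Step-unique s s₂
  ...   | refl , refl = trans (step-off s₁ p<r (Lt⇒≢ η (Lt-Le-trans η lt c≤p)))
            (last-step-rest X m (AscPath-init (ℕP.n≤1+n (suc m)) a) s₁ p<r (Le-trans η (Lt⇒Le η lt) c≤p))

  top-step-rest : ∀ {η c} X m → DescPath X (suc m) → Step η c (X 1) (X 0) → ∀ {p} → p < r → Le η c p → X (suc m) p ≡ X 1 p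
  top-step-rest X zero    a s p<r c≤p = refl
  top-step-rest {η} X (suc m) a s {p} p<r c≤p with DescPath.ascending a (s≤s (s≤s z≤n))
  ... | asc η′ c₁ c₂ s₁ s₂ lt with Step-unique s s₂
  ...   | refl , refl = trans (top-step-rest (X ∘ suc) m (DescPath-tail a) s₁ p<r (Le-trans η (Lt⇒Le η lt) c≤p))
            (sym (step-off s₁ p<r (Lt⇒≢ η (Lt-Le-trans η lt c≤p))))

  Le-tgt : ∀ η {lo hi} → lo < hi → Le η lo (tgt η lo hi) × Le η hi (tgt η lo hi)
  Le-tgt ⊞ lt = ℕP.<⇒≤ lt , ℕP.≤-refl
  Le-tgt ⊟ lt = ℕP.≤-refl , ℕP.<⇒≤ lt

  src-Le : ∀ ε {lo hi} → lo < hi → Le ε (src ε lo hi) lo × Le ε (src ε lo hi) hi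
  src-Le ⊞ lt = ℕP.≤-refl , ℕP.<⇒≤ lt
  src-Le ⊟ lt = ℕP.<⇒≤ lt , ℕP.≤-refl

  -- One row strip crossing a block of columns, tested on any base Z that looks like X 0
  -- to the strip.
  strip-≈ : ∀ {ε a} X Y m (Z : V) → (∀ {j} → j < m → Sq (X j) (Y j) (X (suc j)) (Y (suc j))) → AscPath Y m →
            Step ε a (X 0) (Y 0) → (∀ {p} → p < r → Le ε a p → Z p ≡ X 0 p) →
            (λ p → Z p + (X m p - X 0 p)) ≈ (λ p → Z p + (Y m p - Y 0 p))
  strip-≈ X Y zero Z sq up s agree = ≐⇒≈
    λ {p} _ → cong (_+_ (Z p)) (trans (ℤP.+-inverseʳ (X 0 p)) (sym (ℤP.+-inverseʳ (Y 0 p))))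
  strip-≈ {ε} {a} X Y (suc m) Z sq up s agree = go (sq (s≤s z≤n))
    where
    M : ℕ
    M = suc m
    W Z₁ : V
    W p = Z p + (Y M p - Y 1 p)
    Z₁ p = Z p + (X 1 p - X 0 p)
    Goal : Set
    Goal = (λ p → Z p + (X M p - X 0 p)) ≈ (λ p → Z p + (Y M p - Y 0 p))
    l₁ : ∀ z x₀ x₁ xm → z + (xm - x₀) ≡ z + (x₁ - x₀) + (xm - x₁)
    l₁ = solve-∀
    -- The induction hypothesis is applied to the base moved by the first lower step. Against the
    -- upper path this leaves a unit in row `d` of `W` instead of row `c`, the same multiset if `W`
    -- agrees there.
    combine : ∀ {ε′ a′ η c d} → Step ε a (X 0) (Y 0) → Step ε′ a′ (X 1) (Y 1) → ε′ ≡ ε → Le ε a a′ →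
              Step η d (X 0) (X 1) → Step η c (Y 0) (Y 1) → W d ≡ W c → Goal
    combine {_} {a′} {η} {c} {d} _ r′ refl a≤a′ b t flat = ≈-trans
      (≐⇒≈ λ {p} _ → l₁ (Z p) (X 0 p) (X 1 p) (X M p))
      (≈-trans (strip-≈ (X ∘ suc) (Y ∘ suc) m Z₁ (λ lt → sq (s≤s lt)) (AscPath-tail up) r′ agree₁)
        (≈-trans (≐⇒≈ bottom) (≈-trans (≈-add η {d} {c} {W} (bound b) (bound t) flat) (≐⇒≈ top))))
      where
      agree₁ : ∀ {p} → p < r → Le ε a′ p → Z₁ p ≡ X 1 p
      agree₁ {p} p<r a′≤p = trans (cong (_+ (X 1 p - X 0 p)) (agree p<r (Le-trans ε a≤a′ a′≤p))) (l (X 0 p) (X 1 p))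
        where
        l : ∀ x y → x + (y - x) ≡ y
        l = solve-∀
      bottom : ∀ {p} → p < r → Z₁ p + (Y M p - Y 1 p) ≡ W p + unit η d p
      bottom {p} p<r = trans (cong (λ x → Z p + (x - X 0 p) + (Y M p - Y 1 p)) (eqn b p<r)) (l (Z p) (X 0 p) (unit η d p) (Y M p) (Y 1 p))
        where
        l : ∀ z x u y y₁ → z + (x + u - x) + (y - y₁) ≡ z + (y - y₁) + u
        l = solve-∀
      top : ∀ {p} → p < r → W p + unit η c p ≡ Z p + (Y M p - Y 0 p)
      top {p} p<r = trans (cong (λ y → Z p + (Y M p - y) + unit η c p) (eqn t p<r)) (l (Z p) (unit η c p) (Y M p) (Y 0 p))
        where
        l : ∀ z u y y₀ → z + (y - (y₀ + u)) + u ≡ z + (y - y₀)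
        l = solve-∀
    -- Neither row precedes the letter of the strip, so the base looks like `X 0` in both; neither
    -- comes after the first upper letter, so the later steps of `Y` leave both alone.
    bent : ∀ η lo hi → lo < hi → X 0 lo ≡ X 0 hi → lo < r → hi < r → a ≡ src ε lo hi →
           Step η (tgt η lo hi) (Y 0) (Y 1) → W lo ≡ W hi
    bent η lo hi lt fl lo<r hi<r a≡ t = cong₂ _+_ (trans (at-base lo<r (proj₁ (src-Le ε lt))) (trans fl (sym (at-base hi<r (proj₂ (src-Le ε lt))))))
        (trans (still lo<r (proj₁ (Le-tgt η lt))) (sym (still hi<r (proj₂ (Le-tgt η lt)))))
      where
      at-base : ∀ {p} → p < r → Le ε (src ε lo hi) p → Z p ≡ X 0 p
      at-base {p} p<r le = agree p<r (subst (λ z → Le ε z p) (sym a≡) le)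
      still : ∀ {p} → p < r → Le η p (tgt η lo hi) → Y M p - Y 1 p ≡ 0ℤ
      still {p} p<r le = trans (cong (_- Y 1 p) (first-step-rest Y m up t p<r le)) (ℤP.+-inverseʳ (Y 1 p))
    src-tgt-sym : ∀ η {lo hi} → W lo ≡ W hi → W (src η lo hi) ≡ W (tgt η lo hi)
    src-tgt-sym ⊞ eq = eq
    src-tgt-sym ⊟ eq = sym eq
    go : Sq (X 0) (Y 0) (X 1) (Y 1) → Goal
    go (straight ε′ a′ η d l r′ b t) with Step-unique l s
    ... | refl , refl = combine s r′ refl (Le-refl ε) b t refl
    go (bend ε′ η lo hi lt fl l r′ b t) with Step-unique l s
    ... | refl , refl = combine s r′ refl (Lt⇒Le ε (src-Lt-tgt ε lt)) b t
          (src-tgt-sym η (bent η lo hi lt fl (proj₁ (bend-bounds lt l r′)) (proj₂ (bend-bounds lt l r′)) refl t))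

  record Block (l m : ℕ) (H : ℕ → ℕ → V) : Set where
    field
      doms  : ∀ {i x} → i ≤ l → x ≤ m → Dom (H i x)
      cells : ∀ {i x} → i < l → x < m → Sq (H (suc i) x) (H i x) (H (suc i) (suc x)) (H i (suc x))
      top   : AscPath (H 0) m
      left  : DescPath (λ i → H i 0) l

  open Block

  Block-tail : ∀ {l m H} → Block (suc l) m H → Block l m (H ∘ suc)
  Block-tail B = record
    { doms = λ i≤l → doms B (s≤s i≤l)
    ; cells = λ i<l → cells B (s≤s i<l)
    ; top = ascPath (λ x<m → Sq-bottom (cells B (s≤s z≤n) x<m))
        (λ {x} lt → pairDown (doms B (s≤s z≤n) (ℕP.<⇒≤ (ℕP.<-trans (ℕP.n<1+n x) lt))) (doms B (s≤s z≤n) (ℕP.<⇒≤ lt))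
          (cells B (s≤s z≤n) (ℕP.<-trans (ℕP.n<1+n x) lt)) (cells B (s≤s z≤n) lt) (AscPath.ascending (top B) lt))
    ; left = DescPath-tail (left B)
    }

  block-bottom : ∀ l {m H} → Block l m H → AscPath (H l) m
  block-bottom zero    B = top B
  block-bottom (suc l) B = block-bottom l (Block-tail B)

  block-right : ∀ {l m H} → Block l m H → DescPath (λ i → H i m) l
  block-right {l} {m} {H} B = go m ℕP.≤-refl
    where
    go : ∀ x → x ≤ m → DescPath (λ i → H i x) l
    go zero    _   = left B
    go (suc x) x<m = descPath (λ i<l → Sq-right (cells B i<l x<m))
      (λ {i} lt → pairUp (doms B (ℕP.<⇒≤ lt) x<m) (doms B (ℕP.<⇒≤ (ℕP.<-trans (ℕP.n<1+n i) lt)) x<m)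
        (Sq-transpose (cells B lt x<m)) (Sq-transpose (cells B (ℕP.<-trans (ℕP.n<1+n i) lt) x<m))
        (DescPath.ascending (go x (ℕP.<⇒≤ x<m)) lt))

  -- The strips are exchanged one at a time on the base `H l 0`. It agrees with the lower left
  -- corner of each strip from the letter of the strip on, since the steps below in the left column
  -- have earlier letters. The outcome is the local rule of one fluctuating cell.
  block-≈ : ∀ l {m} H → Block l m H → H l m ≈ (λ p → H l 0 p + (H 0 m p - H 0 0 p))
  block-≈ zero {m} H B = ≐⇒≈ λ {p} _ → lem (H 0 0 p) (H 0 m p)
    where
    lem : ∀ x y → y ≡ x + (y - x)
    lem = solve-∀
  block-≈ (suc l) {m} H B = ≈-trans (block-≈ l (H ∘ suc) (Block-tail B)) (go (DescPath.unit-steps (left B) (s≤s z≤n)))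
    where
    go : AStep (H 1 0) (H 0 0) → (λ p → H (suc l) 0 p + (H 1 m p - H 1 0 p)) ≈ (λ p → H (suc l) 0 p + (H 0 m p - H 0 0 p))
    go (ε , a , s) = strip-≈ (H 1) (H 0) m (H (suc l) 0) (cells B (s≤s z≤n)) (top B) s
      (top-step-rest (λ i → H i 0) l (left B) s)

-- Refinements and their promotion

offsets : (ℕ → ℕ) → ℕ → ℕ
offsets m zero    = 0
offsets m (suc j) = offsets m j ℕ.+ m j

offsets-+ : ∀ m i j → offsets m (i ℕ.+ j) ≡ offsets m i ℕ.+ offsets (λ x → m (i ℕ.+ x)) j
offsets-+ m i zero    = trans (cong (offsets m) (ℕP.+-identityʳ i)) (sym (ℕP.+-identityʳ _))
offsets-+ m i (suc j) = trans (cong (offsets m) (ℕP.+-suc i j))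
  (trans (cong (ℕ._+ m (i ℕ.+ j)) (offsets-+ m i j)) (ℕP.+-assoc (offsets m i) _ _))

offsets-suc : ∀ m j → offsets m (suc j) ≡ m 0 ℕ.+ offsets (m ∘ suc) j
offsets-suc m j = offsets-+ m 1 j

offsets-mono : ∀ m {i j} → i ≤ j → offsets m i ≤ offsets m j
offsets-mono m {i} {j} i≤j = subst (λ z → offsets m i ≤ offsets m z) (ℕP.m+[n∸m]≡n i≤j)
  (subst (offsets m i ≤_) (sym (offsets-+ m i (j ∸ i))) (ℕP.m≤m+n (offsets m i) _))

module Refinements (r : ℕ) where
  open Cells r
  open Shapes r
  open Diagrams r
  open Symmetries r
  open Blocks r
  open Path

  -- U refines T: the j-th step of T is the ascending block of m j unit steps of U that starts at offsets m j.
  record Refines (n : ℕ) (m : ℕ → ℕ) (T U : List Shape) : Set where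
    field
      length-coarse : length T ≡ suc n
      length-fine   : length U ≡ suc (offsets m n)
      points        : ∀ {j} → j ≤ n → at U (offsets m j) ≡ at T j
      blocks        : ∀ {j} → j < n → AscPath (λ x → get (at U (offsets m j ℕ.+ x))) (m j)

  open Refines

  module Promote {t k U} (P : Path (suc t) k U) {n m T} (F : Refines (suc n) m T U) (periodic : m (suc n) ≡ m 0) where
    open Rows P
    open Periodic P

    l : ℕ
    l = m 0

    m′ : ℕ → ℕ
    m′ = m ∘ suc

    full : offsets m (suc n) ≡ suc t
    full = ℕP.suc-injective (trans (sym (length-fine F)) (length-path P))

    l≤ : l ≤ suc t
    l≤ = ℕP.≤-trans (ℕP.m≤m+n l (offsets m′ n)) (ℕP.≤-reflexive (trans (sym (offsets-suc m n)) full))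

    first-block : AscPath (Λ 0) l
    first-block = blocks F (s≤s z≤n)

    -- The first block starts at the zero shape and its ascending letters reach each row for the
    -- first time, so both rows are still 0 in `Λ 0 j` and the two letters may be exchanged.
    flat-letters : ∀ {j} → suc j < l → Λ 0 (suc j) ≈ (λ p → Λ 0 j p + (Λ 0 (suc (suc j)) p - Λ 0 (suc j) p))
    flat-letters {j} lt with AscPath.ascending first-block lt
    ... | asc η c₁ c₂ s₁ s₂ c₁<c₂ = ≈-local s₁ s₂
        (trans (zero-at (bound s₁) (Le-refl η)) (sym (zero-at (bound s₂) (Lt⇒Le η c₁<c₂))))
      where
      zero-at : ∀ {p} → p < r → Le η c₁ p → Λ 0 j p ≡ 0ℤ
      zero-at p<r le = trans (last-step-rest (Λ 0) j (AscPath-init (ℕP.<⇒≤ lt) first-block) s₁ p<r le) (Λ-first 0 p<r)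

    triangle-cell : ∀ {i j} → i ℕ.+ suc (suc j) ≤ l → Λ (suc i) j ≐ Λ 0 j → Λ i (suc j) ≐ Λ 0 (suc j) →
                    Λ i (suc (suc j)) ≐ Λ 0 (suc (suc j)) → Λ (suc i) (suc j) ≐ Λ 0 (suc j)
    triangle-cell {i} {j} le hc ha hb = Dom-≈⇒≐ (dom (row-path (suc i)) j<) (dom P j<)
      (≈-trans (Sq⇒≈ (square i (ℕP.≤-pred (ℕP.≤-trans jj<l l≤))))
        (≈-trans (≐⇒≈ {X₁} {X₂} λ p<r → cong₂ _+_ (hc p<r) (cong₂ _-_ (hb p<r) (ha p<r)))
          (≈-sym (flat-letters jj<l))))
      where
      jj<l : suc j < l
      jj<l = ℕP.≤-trans (ℕP.m≤n+m (suc (suc j)) i) le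
      j< : suc j ≤ suc t
      j< = ℕP.≤-trans (ℕP.<⇒≤ jj<l) l≤
      X₁ X₂ : V
      X₁ p = Λ (suc i) j p + (Λ i (suc (suc j)) p - Λ i (suc j) p)
      X₂ p = Λ 0 j p + (Λ 0 (suc (suc j)) p - Λ 0 (suc j) p)

    -- The cells below the first block all bend, which just shifts the block.
    triangle : ∀ i j → i ℕ.+ j ≤ l → Λ i j ≐ Λ 0 j
    triangle zero    j       _ _ = refl
    triangle (suc i) = go
      where
      go : ∀ j → suc i ℕ.+ j ≤ l → Λ (suc i) j ≐ Λ 0 j
      go zero    _ p<r = trans (Λ-first (suc i) p<r) (sym (Λ-first 0 p<r))
      go (suc j) le = triangle-cell {i} {j} le₀ (go j (ℕP.≤-trans (ℕP.+-monoʳ-≤ (suc i) (ℕP.n≤1+n j)) le))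
          (triangle i (suc j) (ℕP.≤-trans (ℕP.n≤1+n _) le)) (triangle i (suc (suc j)) le₀)
        where
        le₀ : i ℕ.+ suc (suc j) ≤ l
        le₀ = subst (_≤ l) (sym (ℕP.+-suc i (suc j))) le

    -- Since positions count from the start of the row, `l ∸ i` places all rows of the block at the
    -- same absolute column `l + q + x`.
    H : ℕ → ℕ → ℕ → V
    H q i x = Λ i (q ℕ.+ (l ∸ i) ℕ.+ x)

    cell : ∀ i {o a d b} → o < t → a ≡ suc o → d ≡ suc o → b ≡ suc (suc o) → Sq (Λ (suc i) o) (Λ i a) (Λ (suc i) d) (Λ i b)
    cell i o<t refl refl refl = square i o<t

    -- By `triangle`, the column that closes the first block is that block itself, read from its
    -- end.
    first-column : DescPath (λ i → H 0 i 0) l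
    first-column = DescPath-resp {λ j → Λ 0 (l ∸ j)} (λ {j} j≤l {p} p<r →
        trans (sym (triangle j (l ∸ j) (ℕP.≤-reflexive (ℕP.m+[n∸m]≡n j≤l)) p<r)) (cong (λ z → Λ j z p) (sym (ℕP.+-identityʳ (l ∸ j)))))
      (AscPath-reverse l first-block)

    block : ∀ {j} → j < n → DescPath (λ i → H (offsets m′ j) i 0) l → Block l (m′ j) (H (offsets m′ j))
    block {j} j<n left = record { doms = doms ; cells = cells ; top = top ; left = left }
      where
      q w : ℕ
      q = offsets m′ j
      w = m′ j
      room : q ℕ.+ l ℕ.+ w ≤ suc t
      room = subst (_≤ suc t) (cong (ℕ._+ w) (trans (offsets-suc m j) (ℕP.+-comm l q)))
        (subst (offsets m (suc (suc j)) ≤_) full (offsets-mono m (s≤s j<n)))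
      doms : ∀ {i x} → i ≤ l → x ≤ w → Dom (H q i x)
      doms {i} i≤l x≤w = dom (row-path i) (ℕP.≤-trans (ℕP.+-mono-≤ (ℕP.+-monoʳ-≤ q (ℕP.m∸n≤m l i)) x≤w) room)
      cells : ∀ {i x} → i < l → x < w → Sq (H q (suc i) x) (H q i x) (H q (suc i) (suc x)) (H q i (suc x))
      cells {i} {x} i<l x<w = cell i o<t a≡ (ℕP.+-suc _ x) (trans (ℕP.+-suc _ x) (cong suc a≡))
        where
        z : ℕ
        z = l ∸ suc i
        l∸i : l ∸ i ≡ suc z
        l∸i = ℕP.+-∸-assoc 1 i<l
        a≡ : q ℕ.+ (l ∸ i) ℕ.+ x ≡ suc (q ℕ.+ z ℕ.+ x)
        a≡ = trans (cong (λ y → q ℕ.+ y ℕ.+ x) l∸i) (cong (ℕ._+ x) (ℕP.+-suc q z))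
        o<t : q ℕ.+ z ℕ.+ x < t
        o<t = ℕP.≤-pred (ℕP.≤-trans (subst (_≤ q ℕ.+ l ℕ.+ w) (trans (ℕP.+-suc _ x) (cong suc a≡))
          (ℕP.+-mono-≤ (ℕP.+-monoʳ-≤ q (ℕP.m∸n≤m l i)) x<w)) room)
      top : AscPath (H q 0) w
      top = AscPath-resp {λ x → Λ 0 (offsets m (suc j) ℕ.+ x)}
        (λ {x} _ {p} _ → cong (λ z → Λ 0 (z ℕ.+ x) p) (trans (offsets-suc m j) (ℕP.+-comm l q))) (blocks F (s≤s j<n))

    R : List Shape
    R = row T 1

    spec : length R ≡ suc (suc n) × at R (suc n) ≡ lastOr [] T ×
           (∀ {j} → j < n → at R (suc j) ≡ sortDesc ((at T (suc (suc j)) ⊕ at R j) ⊖ at T (suc j)))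
    spec = nextRow-spec (headOr T) (lastOr [] T) T (length-coarse F)

    coarse-length : ∀ {j} → j ≤ suc n → length (at T j) ≡ r
    coarse-length {j} j≤ = trans (cong length (sym (points F j≤))) (length-shape P (subst (offsets m j ≤_) full (offsets-mono m j≤)))

    offsets-< : ∀ {j} → j ≤ n → offsets m′ j ≤ suc t
    offsets-< {j} j≤n = ℕP.≤-trans (ℕP.m≤n+m (offsets m′ j) l) (subst₂ _≤_ (offsets-suc m j) full (offsets-mono m (s≤s j≤n)))

    Matched : ℕ → Set
    Matched j = at R j ≡ at (row U l) (offsets m′ j) × DescPath (λ i → H (offsets m′ j) i 0) l

    -- `block-≈` says that the fine corner satisfies the coarse local rule, and `block-right` hands
    -- an ascending column to the next block.
    advance : ∀ {j} → j < n → Matched j → Matched (suc j)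
    advance {j} j<n (eq , left) = shape-ext lenL (length-shape (row-path l) (offsets-< j<n)) match , right
      where
      q w : ℕ
      q = offsets m′ j
      w = m′ j
      B : Block l w (H q)
      B = block j<n left
      a b c : Shape
      a = at T (suc j)
      b = at T (suc (suc j))
      c = at R j
      lena : length a ≡ r
      lena = coarse-length (ℕP.m≤n⇒m≤1+n j<n)
      lenb : length b ≡ r
      lenb = coarse-length (s≤s j<n)
      lenc : length c ≡ r
      lenc = trans (cong length eq) (length-shape (row-path l) (offsets-< (ℕP.<⇒≤ j<n)))
      lenL : length (at R (suc j)) ≡ r
      lenL = trans (cong length (proj₂ (proj₂ spec) j<n)) (length-sortDesc ((b ⊕ c) ⊖ a) (length-local a b c lena lenb lenc))
      target : V
      target = H q l w
      on-l : ∀ x → q ℕ.+ (l ∸ l) ℕ.+ x ≡ q ℕ.+ x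
      on-l x = cong (ℕ._+ x) (trans (cong (q ℕ.+_) (ℕP.n∸n≡0 l)) (ℕP.+-identityʳ q))
      c-eq : ∀ p → H q l 0 p ≡ get c p
      c-eq p = trans (cong (λ z → Λ l z p) (trans (on-l 0) (ℕP.+-identityʳ q))) (cong (λ s → get s p) (sym eq))
      col : q ℕ.+ l ≡ offsets m (suc j)
      col = trans (ℕP.+-comm q l) (sym (offsets-suc m j))
      a-eq : ∀ p → H q 0 0 p ≡ get a p
      a-eq p = cong (λ s → get s p) (trans (cong (at U) (trans (ℕP.+-identityʳ _) col)) (points F (ℕP.m≤n⇒m≤1+n j<n)))
      b-eq : ∀ p → H q 0 w p ≡ get b p
      b-eq p = cong (λ s → get s p) (trans (cong (at U) (cong (ℕ._+ w) col)) (points F (s≤s j<n)))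
      target≈ : target ≈ (λ p → get c p + (get b p - get a p))
      target≈ = ≈-trans (block-≈ l (H q) B)
        (≐⇒≈ λ {p} _ → cong₂ _+_ (c-eq p) (cong₂ _-_ (b-eq p) (a-eq p)))
      match : get (at R (suc j)) ≐ get (at (row U l) (offsets m′ (suc j)))
      match {p} p<r = trans (cong (λ s → get s p) (proj₂ (proj₂ spec) j<n))
        (trans (local-rule a b c lena lenb lenc {target} (Block.doms B ℕP.≤-refl ℕP.≤-refl) target≈ p<r)
          (cong (λ z → Λ l z p) (on-l w)))
      right : DescPath (λ i → H (offsets m′ (suc j)) i 0) l
      right = DescPath-resp {λ i → H q i w} (λ {i} _ {p} _ → cong (λ z → Λ i z p) (shuffle q w (l ∸ i))) (block-right B)
        where
        shuffle : ∀ q w z → q ℕ.+ z ℕ.+ w ≡ q ℕ.+ w ℕ.+ z ℕ.+ 0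
        shuffle = ℕSolver.solve-∀

    matched : ∀ j → j ≤ n → Matched j
    matched zero    _   = trans (headOr-at T) (trans (sym (points F z≤n)) (trans (first P) (sym (first (row-path l))))) , first-column
    matched (suc j) j<n = advance j<n (matched j (ℕP.<⇒≤ j<n))

    full′ : offsets m′ (suc n) ≡ suc t
    full′ = ℕP.+-cancelˡ-≡ l _ _ (trans (sym (offsets-suc m (suc n))) (trans (cong₂ ℕ._+_ full periodic) (ℕP.+-comm (suc t) l)))

    -- By complementation the last l steps of row l mirror the first block.
    last-block : AscPath (λ x → Λ l (offsets m′ n ℕ.+ x)) l
    last-block = AscPath-resp {λ x → κ k (Λ 0 (l ∸ x))} mirror (DescPath-κ k (AscPath-reverse l first-block))
      where
      mirror : ∀ {x} → x ≤ l → κ k (Λ 0 (l ∸ x)) ≐ Λ l (offsets m′ n ℕ.+ x)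
      mirror {x} x≤l {p} p<r = sym (trans (cong₂ (λ i j → Λ i j p) (sym (ℕP.m∸n+n≡m x≤l)) col)
        (trans (complement x {l ∸ x} (ℕP.≤-trans (ℕP.m∸n≤m l x) l≤) p<r)
          (κ-cong k (triangle x (l ∸ x) (ℕP.≤-reflexive (ℕP.m+[n∸m]≡n x≤l))) p<r)))
        where
        col : offsets m′ n ℕ.+ x ≡ suc t ∸ (l ∸ x)
        col = sym (trans (cong (_∸ (l ∸ x)) (trans (sym (trans (cong (offsets m′ n ℕ.+_) (sym periodic)) full′))
          (cong (offsets m′ n ℕ.+_) (sym (ℕP.m+[n∸m]≡n x≤l)))))
          (trans (cong (_∸ (l ∸ x)) (sym (ℕP.+-assoc (offsets m′ n) x (l ∸ x)))) (ℕP.m+n∸n≡m _ (l ∸ x))))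

    -- The weights are read cyclically: by `periodic` the step that leaves in front returns at the
    -- end with the same weight. All blocks but the last are lower sides of blocks of cells.
    promoted : Refines (suc n) m′ (row T 1) (row U l)
    promoted = record
      { length-coarse = proj₁ spec
      ; length-fine = trans (length-path (row-path l)) (cong suc (sym full′))
      ; points = λ {j} j≤ → point j j≤
      ; blocks = λ {j} j< → blk j (ℕP.≤-pred j<)
      }
      where
      point : ∀ j → j ≤ suc n → at (row U l) (offsets m′ j) ≡ at (row T 1) j
      point j j≤ with j ℕ.≤? n
      ... | yes j≤n = sym (proj₁ (matched j j≤n))
      ... | no j≰n with ℕP.≤-antisym j≤ (ℕP.≰⇒> j≰n)
      ...   | refl = trans (cong (at (row U l)) full′) (trans (last (row-path l)) (trans (sym (last P))
              (trans (cong (at U) (sym full)) (trans (points F ℕP.≤-refl) (sym (trans (proj₁ (proj₂ spec)) (lastOr-at [] T (length-coarse F))))))))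
      blk : ∀ j → j ≤ n → AscPath (λ x → get (at (row U l) (offsets m′ j ℕ.+ x))) (m′ j)
      blk j j≤n with j ℕ.<? n
      ... | yes j<n = AscPath-resp {λ x → H (offsets m′ j) l x}
            (λ {x} _ {p} _ → cong (λ z → Λ l (z ℕ.+ x) p) (trans (cong (offsets m′ j ℕ.+_) (ℕP.n∸n≡0 l)) (ℕP.+-identityʳ _)))
            (block-bottom l (block j<n (proj₂ (matched j j≤n))))
      ... | no j≮n with ℕP.≤-antisym j≤n (ℕP.≮⇒≥ j≮n)
      ...   | refl = subst (AscPath _) (sym periodic) last-block

-- The letters of a step in increasing order

posCell negCell : ℕ × ℤ → List ℤ
posCell (p , + suc _)  = [ + suc p ]
posCell (p , + zero)   = []
posCell (p , -[1+ _ ]) = []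
negCell (p , -[1+ _ ]) = [ -[1+ p ] ]
negCell (p , + _)      = []

-- The index map `h` is carried along because the tail of an index list starting at 0 starts at 1.
Pos Neg : (ℕ → ℕ) → List ℤ → List ℤ
Pos h d = concatMap posCell (zip (applyUpTo h (length d)) d)
Neg h d = concatMap negCell (zip (applyUpTo h (length d)) d)

posCell-≤0 : ∀ p {x} → x ℤ.≤ 0ℤ → posCell (p , x) ≡ []
posCell-≤0 p { + zero}    _ = refl
posCell-≤0 p { + suc n}   (ℤ.+≤+ ())
posCell-≤0 p { -[1+ n ]} _ = refl

negCell-≥0 : ∀ p {x} → 0ℤ ℤ.≤ x → negCell (p , x) ≡ []
negCell-≥0 p { + zero}    _ = refl
negCell-≥0 p { + suc n}   _ = refl
negCell-≥0 p { -[1+ n ]} ()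

Pos-none : ∀ h d → (∀ {p} → p < length d → get d p ℤ.≤ 0ℤ) → Pos h d ≡ []
Pos-none h []      _  = refl
Pos-none h (x ∷ d) le = cong₂ _++_ (posCell-≤0 (h 0) (le (s≤s z≤n))) (Pos-none (h ∘ suc) d (λ lt → le (s≤s lt)))

Neg-none : ∀ h d → (∀ {p} → p < length d → 0ℤ ℤ.≤ get d p) → Neg h d ≡ []
Neg-none h []      _  = refl
Neg-none h (x ∷ d) le = cong₂ _++_ (negCell-≥0 (h 0) (le (s≤s z≤n))) (Neg-none (h ∘ suc) d (λ lt → le (s≤s lt)))

Pos-peel : ∀ h d d′ {c} → length d ≡ length d′ → c < length d → get d c ≡ 1ℤ →
           (∀ {p} → p < length d → p ≢ c → get d p ≡ get d′ p) → (∀ {p} → p ≤ c → get d′ p ≡ 0ℤ) →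
           Pos h d ≡ + suc (h c) ∷ Pos h d′
Pos-peel h (x ∷ d) (x′ ∷ d′) {zero} len _ one same zer = begin-eq
  where
  d≡d′ : d ≡ d′
  d≡d′ = nth-ext 0ℤ d d′ (ℕP.suc-injective len) (λ lt → same (s≤s lt) (λ ()))
  begin-eq : posCell (h 0 , x) ++ Pos (h ∘ suc) d ≡ + suc (h 0) ∷ (posCell (h 0 , x′) ++ Pos (h ∘ suc) d′)
  begin-eq = trans (cong₂ _++_ (trans (cong (λ y → posCell (h 0 , y)) one) refl) (cong (Pos (h ∘ suc)) d≡d′))
    (cong (λ l → + suc (h 0) ∷ (l ++ Pos (h ∘ suc) d′)) (sym (trans (cong (λ y → posCell (h 0 , y)) (zer z≤n)) refl)))
Pos-peel h (x ∷ d) (x′ ∷ d′) {suc c} len lt one same zer = trans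
  (cong₂ _++_ (trans (cong (λ y → posCell (h 0 , y)) (trans (same (s≤s z≤n) (λ ())) (zer z≤n))) refl)
    (Pos-peel (h ∘ suc) d d′ (ℕP.suc-injective len) (ℕP.≤-pred lt) one (λ l ne → same (s≤s l) (λ e → ne (ℕP.suc-injective e))) (λ le → zer (s≤s le))))
  (cong (λ l → + suc (h (suc c)) ∷ (l ++ Pos (h ∘ suc) d′)) (sym (trans (cong (λ y → posCell (h 0 , y)) (zer z≤n)) refl)))

-- Negative letters increase as integers when the row decreases, so the first letter of the step is
-- the last one found; `singles` reverses the list.
Neg-peel : ∀ h d d′ {c} → length d ≡ length d′ → c < length d → get d c ≡ -[1+ 0 ] →
           (∀ {p} → p < length d → p ≢ c → get d p ≡ get d′ p) → (∀ {p} → p < length d → c ≤ p → get d′ p ≡ 0ℤ) →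
           Neg h d ≡ Neg h d′ ++ [ -[1+ h c ] ]
Neg-peel h (x ∷ d) (x′ ∷ d′) {zero} len _ one same zer = trans
    (cong₂ _++_ (trans (cong (λ y → negCell (h 0 , y)) one) refl) (none d (λ lt → trans (same (s≤s lt) (λ ())) (zer (s≤s lt) z≤n))))
    (cong (_++ [ -[1+ h 0 ] ]) (sym (cong₂ _++_ (trans (cong (λ y → negCell (h 0 , y)) (zer (s≤s z≤n) z≤n)) refl)
      (none d′ (λ lt → zer (s≤s (subst (_ <_) (sym (ℕP.suc-injective len)) lt)) z≤n)))))
  where
  none : ∀ d → (∀ {p} → p < length d → get d p ≡ 0ℤ) → Neg (h ∘ suc) d ≡ []
  none d z = Neg-none (h ∘ suc) d (λ lt → ℤP.≤-reflexive (sym (z lt)))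
Neg-peel h (x ∷ d) (x′ ∷ d′) {suc c} len lt one same zer = trans
  (cong₂ _++_ (cong (λ y → negCell (h 0 , y)) (same (s≤s z≤n) (λ ())))
    (Neg-peel (h ∘ suc) d d′ (ℕP.suc-injective len) (ℕP.≤-pred lt) one (λ l ne → same (s≤s l) (λ e → ne (ℕP.suc-injective e))) (λ l le → zer (s≤s l) (s≤s le))))
  (sym (ListP.++-assoc (negCell (h 0 , x′)) (Neg (h ∘ suc) d′) [ -[1+ h (suc c) ] ]))

-- The anonymous selectors in the definition of singles can only be compared pointwise.
singles-as : ∀ f g → (∀ x → f x ≡ posCell x) → (∀ x → g x ≡ negCell x) → ∀ d →
  concatMap f (indexed d) ++ reverse (concatMap g (indexed d)) ≡ Pos (λ x → x) d ++ reverse (Neg (λ x → x) d)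
singles-as f g f≗ g≗ d = cong₂ (λ a b → a ++ reverse b) (ListP.concatMap-cong f≗ (indexed d)) (ListP.concatMap-cong g≗ (indexed d))

singles-def : ∀ d → singles d ≡ Pos (λ x → x) d ++ reverse (Neg (λ x → x) d)
singles-def d = singles-as _ _ (λ { (_ , + zero) → refl ; (_ , + suc _) → refl ; (_ , -[1+ _ ]) → refl })
  (λ { (_ , + _) → refl ; (_ , -[1+ _ ]) → refl }) d

singles-zero : ∀ d → (∀ {p} → p < length d → get d p ≡ 0ℤ) → singles d ≡ []
singles-zero d z = trans (singles-def d) (cong₂ (λ a b → a ++ reverse b)
  (Pos-none _ d (λ lt → ℤP.≤-reflexive (z lt))) (Neg-none _ d (λ lt → ℤP.≤-reflexive (sym (z lt)))))

singles-peel-⊞ : ∀ d d′ {c} → length d ≡ length d′ → c < length d → get d c ≡ 1ℤ →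
  (∀ {p} → p < length d → p ≢ c → get d p ≡ get d′ p) → (∀ {p} → p ≤ c → get d′ p ≡ 0ℤ) →
  (∀ {p} → p < length d′ → 0ℤ ℤ.≤ get d′ p) → (∀ {p} → p < length d → 0ℤ ℤ.≤ get d p) → singles d ≡ letter ⊞ c ∷ singles d′
singles-peel-⊞ d d′ {c} len lt one same zer nn′ nn = trans (singles-def d) (trans
  (cong₂ (λ a b → a ++ reverse b) (Pos-peel _ d d′ len lt one same zer) (trans (Neg-none _ d nn) (sym (Neg-none _ d′ nn′))))
  (cong (letter ⊞ c ∷_) (sym (singles-def d′))))

singles-peel-⊟ : ∀ d d′ {c} → length d ≡ length d′ → c < length d → get d c ≡ -[1+ 0 ] →
  (∀ {p} → p < length d → p ≢ c → get d p ≡ get d′ p) → (∀ {p} → p < length d → c ≤ p → get d′ p ≡ 0ℤ) →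
  (∀ {p} → p < length d′ → get d′ p ℤ.≤ 0ℤ) → (∀ {p} → p < length d → get d p ℤ.≤ 0ℤ) → singles d ≡ letter ⊟ c ∷ singles d′
singles-peel-⊟ d d′ {c} len lt one same zer np′ np = trans (singles-def d) (trans
  (cong₂ (λ a b → a ++ reverse b) (Pos-none _ d np) (Neg-peel _ d d′ len lt one same zer))
  (trans (ListP.reverse-++ (Neg _ d′) [ -[1+ c ] ])
    (cong (letter ⊟ c ∷_) (trans (cong (_++ reverse (Neg _ d′)) (sym (Pos-none _ d′ np′))) (sym (singles-def d′))))))

applyUpTo-cong : ∀ {A : Set} {f g : ℕ → A} n → (∀ {k} → k < n → f k ≡ g k) → applyUpTo f n ≡ applyUpTo g n
applyUpTo-cong zero    eq = refl
applyUpTo-cong (suc n) eq = cong₂ _∷_ (eq (s≤s z≤n)) (applyUpTo-cong n (λ lt → eq (s≤s lt)))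

applyUpTo-++ : ∀ {A : Set} (f : ℕ → A) m n → applyUpTo f (m ℕ.+ n) ≡ applyUpTo f m ++ applyUpTo (λ k → f (m ℕ.+ k)) n
applyUpTo-++ f zero    n = refl
applyUpTo-++ f (suc m) n = cong (f 0 ∷_) (applyUpTo-++ (f ∘ suc) m n)

applyUpTo-at : ∀ U → applyUpTo (at U) (length U) ≡ U
applyUpTo-at []      = refl
applyUpTo-at (x ∷ U) = cong (x ∷_) (applyUpTo-at U)

-- Oscillization recovers every ascending refinement

module Standardization (r : ℕ) where
  open Cells r
  open Shapes r
  open Diagrams r
  open PromotionFunctions r
  open Blocks r
  open Refinements r

  val-nonneg : ∀ η {a X Y p} → Step η a X Y → p < r → 0ℤ ℤ.≤ val η (Y p - X p)
  val-nonneg η {a} {X} {Y} {p} s p<r with a ℕ.≟ p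
  ... | no ne = ℤP.≤-reflexive (sym (trans (cong (λ y → val η (y - X p)) (step-off s p<r ne)) (trans (cong (val η) (ℤP.+-inverseʳ (X p))) (val-0 η))))
  ... | yes refl = subst (0ℤ ℤ.≤_) (sym (trans (cong (λ y → val η (y - X a)) (step-at η s)) (trans (cong (val η) (x+y-x≡y (X a) (val η 1ℤ))) (val1 η)))) (ℤ.+≤+ z≤n)
    where
    val1 : ∀ η → val η (val η 1ℤ) ≡ 1ℤ
    val1 ⊞ = refl
    val1 ⊟ = refl

  val-+ : ∀ η x y → val η (x + y) ≡ val η x + val η y
  val-+ ⊞ x y = refl
  val-+ ⊟ x y = ℤP.neg-distrib-+ x y

  first-step-sign : ∀ {η c} X m → AscPath X (suc m) → Step η c (X 0) (X 1) → ∀ {p} → p < r → 0ℤ ℤ.≤ val η (X (suc m) p - X 0 p)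
  first-step-sign {η} X zero    up s p<r = val-nonneg η s p<r
  first-step-sign {η} X (suc m) up s {p} p<r with AscPath.ascending up (s≤s (s≤s z≤n))
  ... | asc η′ c₁ c₂ s₁ s₂ lt with Step-unique s s₁
  ...   | refl , refl = subst (0ℤ ℤ.≤_) (trans (sym (val-+ η _ _)) (cong (val η) (lem (X 0 p) (X 1 p) (X (suc (suc m)) p))))
          (ℤP.+-mono-≤ (first-step-sign (X ∘ suc) m (AscPath-tail up) s₂ p<r) (val-nonneg η s p<r))
    where
    lem : ∀ a b c → c - b + (b - a) ≡ c - a
    lem = solve-∀

  length-⊖ : ∀ {x y} → length x ≡ r → length y ≡ r → length (y ⊖ x) ≡ r
  length-⊖ {x} {y} lx ly = trans (length-zipWith-≡ _-_ y x (trans ly (sym lx))) ly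

  module _ {x y₁ y : Shape} (lx : length x ≡ r) (ly₁ : length y₁ ≡ r) (ly : length y ≡ r) where

    private
      d-eq : ∀ p → get (y ⊖ x) p ≡ get y p - get x p
      d-eq = get-⊖ {y} {x} (trans ly (sym lx))
      d′-eq : ∀ p → get (y ⊖ y₁) p ≡ get y p - get y₁ p
      d′-eq = get-⊖ {y} {y₁} (trans ly (sym ly₁))
      ld : length (y ⊖ x) ≡ r
      ld = length-⊖ {x} {y} lx ly
      ld′ : length (y ⊖ y₁) ≡ r
      ld′ = length-⊖ {y₁} {y} ly₁ ly

    singles-peel : ∀ η {c} → Step η c (get x) (get y₁) → (∀ {p} → p < r → Le η p c → get y p ≡ get y₁ p) →
                   (∀ {p} → p < r → 0ℤ ℤ.≤ val η (get y p - get y₁ p)) → (∀ {p} → p < r → 0ℤ ℤ.≤ val η (get y p - get x p)) →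
                   singles (y ⊖ x) ≡ letter η c ∷ singles (y ⊖ y₁)
    singles-peel η {c} s rest sg₁ sg = go η refl
      where
      at-c : get (y ⊖ x) c ≡ val η 1ℤ
      at-c = trans (d-eq c) (trans (cong (_- get x c) (trans (rest (bound s) (Le-refl η)) (step-at η s))) (x+y-x≡y (get x c) (val η 1ℤ)))
      same : ∀ {p} → p < length (y ⊖ x) → p ≢ c → get (y ⊖ x) p ≡ get (y ⊖ y₁) p
      same {p} lt ne = trans (d-eq p) (trans (cong (λ z → get y p - z) (sym (step-off s (subst (p <_) ld lt) (λ e → ne (sym e))))) (sym (d′-eq p)))
      zer : ∀ {p} → p < r → Le η p c → get (y ⊖ y₁) p ≡ 0ℤ
      zer {p} p<r le = trans (d′-eq p) (trans (cong (_- get y₁ p) (rest p<r le)) (ℤP.+-inverseʳ (get y₁ p)))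
      nn : ∀ {p} → p < length (y ⊖ x) → 0ℤ ℤ.≤ val η (get (y ⊖ x) p)
      nn {p} lt = subst (λ z → 0ℤ ℤ.≤ val η z) (sym (d-eq p)) (sg (subst (p <_) ld lt))
      nn′ : ∀ {p} → p < length (y ⊖ y₁) → 0ℤ ℤ.≤ val η (get (y ⊖ y₁) p)
      nn′ {p} lt = subst (λ z → 0ℤ ℤ.≤ val η z) (sym (d′-eq p)) (sg₁ (subst (p <_) ld′ lt))
      neg-≤ : ∀ {z} → 0ℤ ℤ.≤ - z → z ℤ.≤ 0ℤ
      neg-≤ {z} le = subst (ℤ._≤ 0ℤ) (ℤP.neg-involutive z) (ℤP.neg-mono-≤ le)
      go : ∀ η′ → η ≡ η′ → singles (y ⊖ x) ≡ letter η c ∷ singles (y ⊖ y₁)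
      go ⊞ refl = singles-peel-⊞ (y ⊖ x) (y ⊖ y₁) (trans ld (sym ld′)) (subst (c <_) (sym ld) (bound s)) at-c same
        (λ le → zer (ℕP.≤-<-trans le (bound s)) le) nn′ nn
      go ⊟ refl = singles-peel-⊟ (y ⊖ x) (y ⊖ y₁) (trans ld (sym ld′)) (subst (c <_) (sym ld) (bound s)) at-c same
        (λ {p} lt le → zer (subst (p <_) ld lt) le) (λ lt → neg-≤ (nn′ lt)) (λ lt → neg-≤ (nn lt))

  -- An ascending path is determined by its end points: its first letter is the least letter of
  -- their difference, and the others are those of the remaining path.
  expand-singles : ∀ (s : ℕ → Shape) m → (∀ {j} → j ≤ m → length (s j) ≡ r) → AscPath (λ j → get (s j)) m →
                   expand r (s 0) (singles (s m ⊖ s 0)) ≡ applyUpTo (s ∘ suc) m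
  expand-singles s zero lens up = cong (expand r (s 0)) (singles-zero (s 0 ⊖ s 0) λ {p} _ →
    trans (get-⊖ {s 0} {s 0} refl p) (ℤP.+-inverseʳ (get (s 0) p)))
  expand-singles s (suc m) lens up = go (AscPath.unit-steps up (s≤s z≤n))
    where
    go : AStep (get (s 0)) (get (s 1)) → expand r (s 0) (singles (s (suc m) ⊖ s 0)) ≡ applyUpTo (s ∘ suc) (suc m)
    go (η , c , st) = trans (cong (expand r (s 0)) (singles-peel {s 0} {s 1} {s (suc m)} (lens z≤n) (lens (s≤s z≤n)) (lens ℕP.≤-refl) η st
        (λ p<r le → first-step-rest (λ j → get (s j)) m up st p<r le) (λ p<r → later m up p<r)
        (λ p<r → first-step-sign (λ j → get (s j)) m up st p<r)))
      (trans (cong (λ z → z ∷ expand r z (singles (s (suc m) ⊖ s 1))) (sym (Step⇒≡ {η} {c} {s 0} {s 1} (lens z≤n) (lens (s≤s z≤n)) st)))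
        (cong (s 1 ∷_) (expand-singles (s ∘ suc) m (λ le → lens (s≤s le)) (AscPath-tail up))))
      where
      later : ∀ m → AscPath (λ j → get (s j)) (suc m) → ∀ {p} → p < r → 0ℤ ℤ.≤ val η (get (s (suc m)) p - get (s 1) p)
      later zero    _ {p} _ = ℤP.≤-reflexive (sym (trans (cong (val η) (ℤP.+-inverseʳ (get (s 1) p))) (val-0 η)))
      later (suc m) up p<r with AscPath.ascending up (s≤s (s≤s z≤n))
      ... | asc η′ c₁ c₂ s₁ s₂ lt with Step-unique st s₁
      ...   | refl , refl = first-step-sign (λ j → get (s (suc j))) m (AscPath-tail up) s₂ p<r

  std-path : ∀ T n m (s : ℕ → Shape) → length T ≡ suc n → (∀ {j} → j ≤ n → s (offsets m j) ≡ at T j) →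
             (∀ {x} → x ≤ offsets m n → length (s x) ≡ r) → (∀ {j} → j < n → AscPath (λ x → get (s (offsets m j ℕ.+ x))) (m j)) →
             std r T ≡ applyUpTo s (suc (offsets m n))
  std-path (x ∷ [])      zero    m s _  pts lens up = cong [_] (sym (pts z≤n))
  std-path (x ∷ y ∷ T) (suc n) m s lT pts lens up = cong₂ _∷_ (sym (pts z≤n)) (trans
      (cong₂ _++_
        (trans (cong₂ (λ a b → expand r a (singles (b ⊖ a))) (sym (pts z≤n)) (sym (pts (s≤s z≤n))))
          (expand-singles s (m 0) (λ j≤ → lens (ℕP.≤-trans j≤ (offsets-mono m {1} {suc n} (s≤s z≤n)))) (up (s≤s z≤n))))
        (trans (ListP.∷-injectiveʳ IH) (applyUpTo-cong (offsets m′ n) (λ {k} _ → cong s (ℕP.+-suc (m 0) k)))))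
      (trans (sym (applyUpTo-++ (s ∘ suc) (m 0) (offsets m′ n))) (cong (applyUpTo (s ∘ suc)) (sym (offsets-suc m n)))))
    where
    m′ : ℕ → ℕ
    m′ = m ∘ suc
    IH : y ∷ stdAux r y T ≡ applyUpTo (λ k → s (m 0 ℕ.+ k)) (suc (offsets m′ n))
    IH = std-path (y ∷ T) n m′ (λ k → s (m 0 ℕ.+ k)) (ℕP.suc-injective lT)
      (λ {j} j≤ → trans (cong s (sym (offsets-suc m j))) (pts (s≤s j≤)))
      (λ {x} x≤ → lens (subst (m 0 ℕ.+ x ≤_) (sym (offsets-suc m n)) (ℕP.+-monoʳ-≤ (m 0) x≤)))
      (λ {j} j< → AscPath-resp {λ x → get (s (offsets m (suc j) ℕ.+ x))}
        (λ {x} _ {p} _ → cong (λ z → get (s z) p) (trans (cong (ℕ._+ x) (offsets-suc m j)) (ℕP.+-assoc (m 0) (offsets m′ j) x)))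
        (up (s≤s j<)))

  -- Uniqueness of refinements: to know the oscillization of a promoted or evacuated tableau it is
  -- enough to exhibit a refinement.
  std-Refines : ∀ {n m T U} → Refines n m T U → (∀ {x} → x ≤ offsets m n → length (at U x) ≡ r) → std r T ≡ U
  std-Refines {n} {m} {T} {U} F lens = trans (std-path T n m (at U) (Refines.length-coarse F) (Refines.points F) lens (Refines.blocks F))
    (trans (cong (applyUpTo (at U)) (sym (Refines.length-fine F))) (applyUpTo-at U))

-- Existence of the refinement

at-++ˡ : ∀ S T {j} → j < length S → at (S ++ T) j ≡ at S j
at-++ˡ (x ∷ S) T {zero}  _  = refl
at-++ˡ (x ∷ S) T {suc j} lt = at-++ˡ S T (ℕP.≤-pred lt)

at-++ʳ : ∀ S T j → at (S ++ T) (length S ℕ.+ j) ≡ at T j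
at-++ʳ []      T j = refl
at-++ʳ (x ∷ S) T j = at-++ʳ S T j

All-get : ∀ {P : ℤ → Set} {xs} → All P xs → ∀ {p} → p < length xs → P (get xs p)
All-get (px ∷ ps) {zero}  _  = px
All-get (px ∷ ps) {suc p} lt = All-get ps (ℕP.≤-pred lt)

weights : List Shape → ℕ → ℕ
weights T j = ℤ.∣ sumℤ (at T (suc j) ⊖ at T j) ∣

sumℤ-get : ∀ d → sumℤ d ≡ ∑ (length d) (get d)
sumℤ-get []      = refl
sumℤ-get (x ∷ d) = trans (cong (_+_ x) (sumℤ-get d)) (sym (∑-cons (length d) (get (x ∷ d))))

size-offsets : ∀ T {n} → length T ≡ suc n → size T ≡ offsets (weights T) n
size-offsets (x ∷ [])     {zero}  _  = refl
size-offsets (x ∷ y ∷ T) {suc n} le = trans (cong (ℤ.∣ sumℤ (y ⊖ x) ∣ ℕ.+_) (size-offsets (y ∷ T) (ℕP.suc-injective le)))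
  (sym (offsets-suc (weights (x ∷ y ∷ T)) n))

module Oscillization (r : ℕ) where
  open Cells r
  open Shapes r
  open Diagrams r
  open PromotionFunctions r
  open Blocks r
  open Refinements r
  open Standardization r

  -- The filling order runs from the first row when cells are added and from the last row when they
  -- are removed.
  nthRow : Sgn → ℕ → ℕ
  nthRow ⊞ q = q
  nthRow ⊟ q = rev q

  nthRow-< : ∀ η {q} → q < r → nthRow η q < r
  nthRow-< ⊞ q<r = q<r
  nthRow-< ⊟ q<r = rev-< q<r

  nthRow-involutive : ∀ η {q} → q < r → nthRow η (nthRow η q) ≡ q
  nthRow-involutive ⊞ q<r = refl
  nthRow-involutive ⊟ q<r = rev-rev q<r

  nthRow-injective : ∀ η {q q′} → q < r → q′ < r → nthRow η q ≡ nthRow η q′ → q ≡ q′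
  nthRow-injective η q<r q′<r eq = trans (sym (nthRow-involutive η q<r)) (trans (cong (nthRow η) eq) (nthRow-involutive η q′<r))

  nthRow-mono : ∀ η {q q′} → q < q′ → q′ < r → Lt η (nthRow η q) (nthRow η q′)
  nthRow-mono ⊞ lt _ = lt
  nthRow-mono ⊟ lt q′<r = rev-anti-< lt q′<r

  nthRow-reflect : ∀ η {p q} → p < r → q < r → Lt η p (nthRow η q) → nthRow η p < q
  nthRow-reflect ⊞ _ _ lt = lt
  nthRow-reflect ⊟ {p} {q} p<r q<r lt = subst (rev p <_) (rev-rev q<r) (rev-anti-< lt p<r)

  Rise : Sgn → Shape → Shape → ℕ → Set
  Rise η x y p = get y p ≡ get x p ⊎ get y p ≡ get x p + val η 1ℤ

  -- The neighbour filled before `c` already has its final value, so the decrease there is inherited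
  -- from `Y`; towards the other neighbour the change only widens the gap.
  Dom-fill : ∀ η {c X Y} → Dom X → Dom Y → c < r → Y c ≡ X c + val η 1ℤ → (∀ {p} → p < r → Lt η p c → X p ≡ Y p) → Dom (add η c X)
  Dom-fill η {c} {X} {Y} dX dY c<r rise done = Dom-of-steps λ {p} → go η rise done {p}
    where
    off : ∀ η {p} → c ≢ p → add η c X p ≡ X p
    off η {p} ne = trans (cong (_+_ (X p)) (unit-≢ η ne)) (ℤP.+-identityʳ (X p))
    on : ∀ η → add η c X c ≡ X c + val η 1ℤ
    on ⊞ = cong (_+_ (X c)) (δ-≡ c)
    on ⊟ = cong (λ x → X c + - x) (δ-≡ c)
    go : ∀ η → Y c ≡ X c + val η 1ℤ → (∀ {p} → p < r → Lt η p c → X p ≡ Y p) → ∀ {p} → suc p < r → add η c X (suc p) ℤ.≤ add η c X p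
    go η rise done {p} p+1<r with c ℕ.≟ suc p | c ℕ.≟ p
    go η rise done {p} p+1<r | yes refl | yes ()
    go η rise done {p} p+1<r | no a | no b = subst₂ ℤ._≤_ (sym (off η a)) (sym (off η b)) (dX (ℕP.n≤1+n p) p+1<r)
    go ⊞ rise done {p} p+1<r | yes refl | no b = subst₂ ℤ._≤_ (trans rise (sym (on ⊞)))
      (trans (sym (done (ℕP.<-trans (ℕP.n<1+n p) p+1<r) ℕP.≤-refl)) (sym (off ⊞ b))) (dY (ℕP.n≤1+n p) p+1<r)
    go ⊟ rise done {p} p+1<r | yes refl | no b = subst₂ ℤ._≤_ (sym (on ⊟)) (sym (off ⊟ b))
      (ℤP.≤-trans (ℤP.i≤j⇒i-k≤j 1ℤ {{_}} (ℤP.≤-refl {X (suc p)})) (dX (ℕP.n≤1+n p) p+1<r))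
    go ⊞ rise done {p} p+1<r | no a | yes refl = subst₂ ℤ._≤_ (sym (off ⊞ a)) (sym (on ⊞))
      (ℤP.≤-trans (dX (ℕP.n≤1+n p) p+1<r) (ℤP.i≤i+j (X p) 1ℤ))
    go ⊟ rise done {p} p+1<r | no a | yes refl = subst₂ ℤ._≤_ (trans (sym (done p+1<r ℕP.≤-refl)) (sym (off ⊟ a)))
      (trans rise (sym (on ⊟))) (dY (ℕP.n≤1+n p) p+1<r)

  -- Only rows from the `q`-th on in the filling order are still to be filled. `start` bounds the
  -- first letter, so that a letter put in front keeps the path ascending.
  record Filling (η : Sgn) (q : ℕ) (x y : Shape) : Set where
    field
      between : List Shape
      reaches : at (x ∷ between) (length between) ≡ y
      shapes  : ∀ {j} → j ≤ length between → length (at (x ∷ between) j) ≡ r × Dom (get (at (x ∷ between) j))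
      up      : AscPath (λ j → get (at (x ∷ between) j)) (length between)
      start   : ∀ {ε c} → 0 < length between → Step ε c (get x) (get (at between 0)) → ε ≡ η × ∃ λ q′ → q ≤ q′ × q′ < r × c ≡ nthRow η q′
      weight  : ∑ r (get y) ≡ ∑ r (get x) + val η (+ length between)

  ∑-step : ∀ {ε a X Y} → Step ε a X Y → ∑ r Y ≡ ∑ r X + val ε 1ℤ
  ∑-step {ε} {a} {X} s = trans (∑-cong r (eqn s)) (trans (∑-+ r X (unit ε a))
    (cong (_+_ (∑ r X)) (trans (∑-cong r λ {p} _ → sym (ℤP.*-identityˡ (unit ε a p))) (∑-unit ε r (λ _ → 1ℤ) (bound s)))))

  fill : ∀ η f {q x y} → q ℕ.+ f ≡ r → length x ≡ r → length y ≡ r → Dom (get x) → Dom (get y) →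
         (∀ {q′} → q′ < q → q′ < r → get x (nthRow η q′) ≡ get y (nthRow η q′)) →
         (∀ {q′} → q ≤ q′ → q′ < r → Rise η x y (nthRow η q′)) → Filling η q x y
  fill η zero {q} {x} {y} q≡r lx ly dx dy done rise = record
    { between = []
    ; reaches = shape-ext {x} {y} lx ly x≐y
    ; shapes = λ { z≤n → lx , dx }
    ; up = ascPath (λ ()) (λ ())
    ; start = λ ()
    ; weight = trans (∑-cong r (λ p<r → sym (x≐y p<r))) (sym (trans (cong (_+_ (∑ r (get x))) (val-0 η)) (ℤP.+-identityʳ (∑ r (get x)))))
    }
    where
    x≐y : get x ≐ get y
    x≐y {p} p<r = subst (λ z → get x z ≡ get y z) (nthRow-involutive η p<r)
      (done (subst (nthRow η p <_) (trans (sym q≡r) (ℕP.+-identityʳ q)) (nthRow-< η p<r)) (nthRow-< η p<r))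
  fill η (suc f) {q} {x} {y} q+f≡r lx ly dx dy done rise with rise ℕP.≤-refl (subst (q <_) q+f≡r (ℕP.m<m+n q (s≤s z≤n)))
  ... | inj₁ same = record
    { between = F.between ; reaches = F.reaches ; shapes = F.shapes ; up = F.up ; weight = F.weight
    ; start = λ nonempty s → let (e , q′ , q<q′ , rest) = F.start nonempty s in e , q′ , ℕP.<⇒≤ q<q′ , rest
    }
    where
    done′ : ∀ {q′} → q′ < suc q → q′ < r → get x (nthRow η q′) ≡ get y (nthRow η q′)
    done′ {q′} q′≤q q′<r with q′ ℕ.≟ q
    ... | yes refl = sym same
    ... | no ne = done (ℕP.≤∧≢⇒< (ℕP.≤-pred q′≤q) ne) q′<r
    module F = Filling (fill η f {suc q} {x} {y} (trans (sym (ℕP.+-suc q f)) q+f≡r) lx ly dx dy done′ (λ q<q′ → rise (ℕP.<⇒≤ q<q′)))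
  ... | inj₂ jump = record
    { between = x₁ ∷ F.between
    ; reaches = F.reaches
    ; shapes = λ { {zero} _ → lx , dx ; {suc j} (s≤s j≤) → F.shapes j≤ }
    ; up = ascPath (λ { {zero} _ → η , c , s ; {suc j} (s≤s lt) → AscPath.unit-steps F.up lt })
        (λ { {zero} (s≤s lt) → ascend lt ; {suc j} (s≤s lt) → AscPath.ascending F.up lt })
    ; start = λ _ s′ → let (e , e′) = Step-unique s′ s in e , q , ℕP.≤-refl , q<r , e′
    ; weight = trans F.weight (trans (cong (_+ val η (+ length F.between)) (∑-step s))
        (trans (ℤP.+-assoc (∑ r (get x)) _ _) (cong (_+_ (∑ r (get x))) (val-suc η))))
    }
    where
    q<r : q < r
    q<r = subst (q <_) q+f≡r (ℕP.m<m+n q (s≤s z≤n))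
    c : ℕ
    c = nthRow η q
    c<r : c < r
    c<r = nthRow-< η q<r
    x₁ : Shape
    x₁ = x ⊕ e r (letter η c)
    l₁ : length x₁ ≡ r
    l₁ = length-add {x} η c lx
    x₁≐ : get x₁ ≐ add η c (get x)
    x₁≐ = get-add {x} η c lx
    s : Step η c (get x) (get x₁)
    s = step c<r x₁≐
    d-add : Dom (add η c (get x))
    d-add = Dom-fill η dx dy c<r jump λ {p} p<r lt →
      subst (λ z → get x z ≡ get y z) (nthRow-involutive η p<r) (done (nthRow-reflect η p<r q<r lt) (nthRow-< η p<r))
    d₁ : Dom (get x₁)
    d₁ p≤q q<r = subst₂ ℤ._≤_ (sym (x₁≐ q<r)) (sym (x₁≐ (ℕP.≤-<-trans p≤q q<r))) (d-add p≤q q<r)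
    off : ∀ {q′} → q′ < r → q′ ≢ q → get x₁ (nthRow η q′) ≡ get x (nthRow η q′)
    off q′<r ne = step-off s (nthRow-< η q′<r) (λ e → ne (sym (nthRow-injective η q<r q′<r e)))
    done₁ : ∀ {q′} → q′ < suc q → q′ < r → get x₁ (nthRow η q′) ≡ get y (nthRow η q′)
    done₁ {q′} q′≤q q′<r with q′ ℕ.≟ q
    ... | yes refl = trans (step-at η s) (sym jump)
    ... | no ne = trans (off q′<r ne) (done (ℕP.≤∧≢⇒< (ℕP.≤-pred q′≤q) ne) q′<r)
    rise₁ : ∀ {q′} → suc q ≤ q′ → q′ < r → Rise η x₁ y (nthRow η q′)
    rise₁ {q′} q<q′ q′<r = subst (λ z → get y (nthRow η q′) ≡ z ⊎ get y (nthRow η q′) ≡ z + val η 1ℤ)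
      (sym (off q′<r (λ e → ℕP.<⇒≢ q<q′ (sym e)))) (rise (ℕP.<⇒≤ q<q′) q′<r)
    module F = Filling (fill η f {suc q} {x₁} {y} (trans (sym (ℕP.+-suc q f)) q+f≡r) l₁ ly d₁ dy done₁ rise₁)
    ascend : 0 < length F.between → Asc (get x) (get x₁) (get (at F.between 0))
    ascend nonempty with AscPath.unit-steps F.up nonempty
    ... | ε , c₂ , s₂ with F.start nonempty s₂
    ...   | refl , q′ , q<q′ , q′<r , refl = asc η c _ s s₂ (nthRow-mono η q<q′ q′<r)
    val-suc : ∀ η → val η 1ℤ + val η (+ length F.between) ≡ val η (+ suc (length F.between))
    val-suc ⊞ = refl
    val-suc ⊟ = sym (ℤP.neg-distrib-+ 1ℤ (+ length F.between))

  fill-step : ∀ {x y} → length x ≡ r → length y ≡ r → Dom (get x) → Dom (get y) → ValidStep (y ⊖ x) → ∃ λ η → Filling η 0 x y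
  fill-step {x} {y} lx ly dx dy v = go v
    where
    ld : length (y ⊖ x) ≡ r
    ld = length-⊖ {x} {y} lx ly
    value : ∀ {p v} → get (y ⊖ x) p ≡ v → get y p ≡ get x p + v
    value {p} {v} eq = trans (lem (get y p) (get x p)) (cong (_+_ (get x p)) (trans (sym (get-⊖ {y} {x} (trans ly (sym lx)) p)) eq))
      where
      lem : ∀ a b → a ≡ b + (a - b)
      lem = solve-∀
    value₀ : ∀ {p} → get (y ⊖ x) p ≡ 0ℤ → get y p ≡ get x p
    value₀ {p} eq = trans (value eq) (ℤP.+-identityʳ (get x p))
    rises : ∀ η → All (λ z → z ≡ 0ℤ ⊎ z ≡ val η 1ℤ) (y ⊖ x) → ∀ {p} → p < r → Rise η x y p
    rises η a {p} p<r with All-get a (subst (p <_) (sym ld) p<r)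
    ... | inj₁ e = inj₁ (value₀ e)
    ... | inj₂ e = inj₂ (value e)
    filled : ∀ η → All (λ z → z ≡ 0ℤ ⊎ z ≡ val η 1ℤ) (y ⊖ x) → Filling η 0 x y
    filled η a = fill η r {0} {x} {y} refl lx ly dx dy (λ ()) (λ _ q<r → rises η a (nthRow-< η q<r))
    go : ValidStep (y ⊖ x) → ∃ λ η → Filling η 0 x y
    go (inj₁ a) = ⊞ , filled ⊞ a
    go (inj₂ a) = ⊟ , filled ⊟ a

  filling-weight : ∀ {η x y} → length x ≡ r → length y ≡ r → (F : Filling η 0 x y) → length (Filling.between F) ≡ ℤ.∣ sumℤ (y ⊖ x) ∣
  filling-weight {η} {x} {y} lx ly F = sym (trans (cong ℤ.∣_∣ total) (abs η))
    where
    n : ℕ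
    n = length (Filling.between F)
    ld : length (y ⊖ x) ≡ r
    ld = length-⊖ {x} {y} lx ly
    total : sumℤ (y ⊖ x) ≡ val η (+ n)
    total = trans (sumℤ-get (y ⊖ x)) (trans (cong (λ k → ∑ k (get (y ⊖ x))) ld)
      (trans (∑-cong r λ {p} _ → get-⊖ {y} {x} (trans ly (sym lx)) p) (trans (∑-- r (get y) (get x))
        (trans (cong (_- ∑ r (get x)) (Filling.weight F)) (x+y-x≡y (∑ r (get x)) (val η (+ n)))))))
    abs : ∀ η → ℤ.∣ val η (+ n) ∣ ≡ n
    abs ⊞ = refl
    abs ⊟ = ℤP.∣-i∣≡∣i∣ (+ n)

  record Refinement (T : List Shape) (x : Shape) (n : ℕ) : Set where
    field
      rest    : List Shape
      refines : Refines n (weights T) T (x ∷ rest)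
      shapes  : ∀ {j} → j ≤ offsets (weights T) n → length (at (x ∷ rest) j) ≡ r × Dom (get (at (x ∷ rest) j))
      steps   : ∀ {j} → j < offsets (weights T) n → AStep (get (at (x ∷ rest) j)) (get (at (x ∷ rest) (suc j)))

  refine : ∀ x T → All (λ μ → length μ ≡ r × Decreasing μ) (x ∷ T) → Linked (λ α β → ValidStep (β ⊖ α)) (x ∷ T) → Refinement (x ∷ T) x (length T)
  refine x [] ((lx , dx) ∷ []) _ = record
    { rest = []
    ; refines = record { length-coarse = refl ; length-fine = refl ; points = λ { z≤n → refl } ; blocks = λ () }
    ; shapes = λ { z≤n → lx , Dom-Decreasing {x} lx dx }
    ; steps = λ ()
    }
  refine x (y ∷ T) ((lx , dx) ∷ good) (v ∷ vs) with good
  ... | (ly , dy) ∷ _ = record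
    { rest = L ++ G.rest
    ; refines = record
        { length-coarse = refl
        ; length-fine = cong suc (trans (ListP.length-++ L) (trans (cong₂ ℕ._+_ len (ℕP.suc-injective (Refines.length-fine G.refines))) (sym (offsets-suc m n))))
        ; points = λ { {zero} _ → refl ; {suc j} (s≤s j≤) → trans (cong (at U) (off j)) (trans (high (offsets m′ j)) (Refines.points G.refines j≤)) }
        ; blocks = λ { {zero} _ → AscPath-resp (λ {j} j≤ {p} _ → cong (λ s → get s p) (sym (low (subst (j ≤_) (sym len) j≤)))) (subst (AscPath _) len F.up)
                     ; {suc j} (s≤s j<) → AscPath-resp {λ z → get (at (y ∷ G.rest) (offsets m′ j ℕ.+ z))}
                         (λ {z} _ {p} _ → cong (λ s → get s p) (trans (sym (high (offsets m′ j ℕ.+ z)))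
                           (cong (at U) (trans (sym (ℕP.+-assoc (length L) (offsets m′ j) z)) (cong (ℕ._+ z) (sym (off j)))))))
                         (Refines.blocks G.refines j<) }
        }
    ; shapes = λ {j} → shapes′ j
    ; steps = λ {j} → steps′ j
    }
    where
    n : ℕ
    n = length T
    m m′ : ℕ → ℕ
    m = weights (x ∷ y ∷ T)
    m′ = weights (y ∷ T)
    filling : ∃ λ η → Filling η 0 x y
    filling = fill-step {x} {y} lx ly (Dom-Decreasing {x} lx dx) (Dom-Decreasing {y} ly dy) v
    module F = Filling (proj₂ filling)
    module G = Refinement (refine y T good vs)
    L U : List Shape
    L = F.between
    U = x ∷ L ++ G.rest
    len : length L ≡ m 0
    len = filling-weight {_} {x} {y} lx ly (proj₂ filling)
    off : ∀ j → offsets m (suc j) ≡ length L ℕ.+ offsets m′ j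
    off j = trans (offsets-suc m j) (cong (ℕ._+ offsets m′ j) (sym len))
    low : ∀ {j} → j ≤ length L → at U j ≡ at (x ∷ L) j
    low j≤ = at-++ˡ (x ∷ L) G.rest (s≤s j≤)
    high : ∀ j → at U (length L ℕ.+ j) ≡ at (y ∷ G.rest) j
    high zero    = trans (cong (at U) (ℕP.+-identityʳ (length L))) (trans (low ℕP.≤-refl) F.reaches)
    high (suc j) = trans (cong (at U) (ℕP.+-suc (length L) j)) (at-++ʳ (x ∷ L) G.rest j)
    split : ∀ j → length L ≤ j → length L ℕ.+ (j ∸ length L) ≡ j
    split j le = ℕP.m+[n∸m]≡n le
    room : ∀ {j} → length L ≤ j → j ≤ offsets m (suc n) → j ∸ length L ≤ offsets m′ n
    room {j} le j≤ = ℕP.+-cancelˡ-≤ (length L) _ _ (subst₂ _≤_ (sym (split j le)) (off n) j≤)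
    shapes′ : ∀ j → j ≤ offsets m (suc n) → length (at U j) ≡ r × Dom (get (at U j))
    shapes′ j j≤ with j ℕ.≤? length L
    ... | yes le = subst (λ s → length s ≡ r × Dom (get s)) (sym (low le)) (F.shapes le)
    ... | no nle = subst (λ s → length s ≡ r × Dom (get s)) (trans (sym (high (j ∸ length L))) (cong (at U) (split j (ℕP.<⇒≤ (ℕP.≰⇒> nle)))))
          (G.shapes (room (ℕP.<⇒≤ (ℕP.≰⇒> nle)) j≤))
    steps′ : ∀ j → j < offsets m (suc n) → AStep (get (at U j)) (get (at U (suc j)))
    steps′ j j< with j ℕ.<? length L
    ... | yes lt = subst₂ (λ s s′ → AStep (get s) (get s′)) (sym (low (ℕP.<⇒≤ lt))) (sym (low lt)) (AscPath.unit-steps F.up lt)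
    ... | no nlt = subst₂ (λ s s′ → AStep (get s) (get s′))
          (trans (sym (high (j ∸ length L))) (cong (at U) (split j le)))
          (trans (sym (high (suc (j ∸ length L)))) (cong (at U) (trans (ℕP.+-suc (length L) _) (cong suc (split j le)))))
          (G.steps (subst (_≤ offsets m′ n) (ℕP.+-∸-assoc 1 le) (room (ℕP.m≤n⇒m≤1+n le) j<)))
      where
      le : length L ≤ j
      le = ℕP.≮⇒≥ nlt

-- Iterated promotion, evacuation and the index convention

offsets-cong : ∀ {m m′} n → (∀ {j} → j < n → m j ≡ m′ j) → offsets m n ≡ offsets m′ n
offsets-cong zero    eq = refl
offsets-cong (suc n) eq = cong₂ ℕ._+_ (offsets-cong n (λ lt → eq (ℕP.m<n⇒m<1+n lt))) (eq ℕP.≤-refl)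

constant : ∀ {μ r} → length μ ≡ r → Linked _≡_ μ → μ ≡ replicate r (get μ 0)
constant {[]}        refl _ = refl
constant {x ∷ []}    refl _ = refl
constant {x ∷ y ∷ μ} refl (refl ∷ l) = cong (x ∷_) (constant refl l)

module Assembly (r : ℕ) where
  open Cells r
  open Shapes r
  open Diagrams r
  open Symmetries r
  open PromotionFunctions r
  open Blocks r
  open Refinements r
  open Standardization r
  open Oscillization r
  open Path
  open Refines

  Refines-cong : ∀ {n m m′ T U} → (∀ {j} → j < n → m j ≡ m′ j) → Refines n m T U → Refines n m′ T U
  Refines-cong {n} {m} {m′} {T} {U} eq F = record
    { length-coarse = length-coarse F
    ; length-fine = trans (length-fine F) (cong suc (offsets-cong n eq))
    ; points = λ {j} j≤ → trans (cong (at U) (sym (off j≤))) (points F j≤)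
    ; blocks = λ {j} j< → subst₂ (λ o w → AscPath (λ x → get (at U (o ℕ.+ x))) w) (off (ℕP.<⇒≤ j<)) (eq j<) (blocks F j<)
    }
    where
    off : ∀ {j} → j ≤ n → offsets m j ≡ offsets m′ j
    off {j} j≤n = offsets-cong j (λ lt → eq (ℕP.<-≤-trans lt j≤n))

  module Iterate {t k n m T U} (P : Path (suc t) k U) (F : Refines (suc n) m T U) (periodic : ∀ j → m (j ℕ.+ suc n) ≡ m j) where
    open Rows P
    open Periodic P

    full : offsets m (suc n) ≡ suc t
    full = ℕP.suc-injective (trans (sym (length-fine F)) (length-path P))

    ends : ∀ {m′ R V} → Refines (suc n) m′ R V → Path (suc t) k V → headOr R ≡ zeros r × lastOr [] R ≡ replicate r k
    ends {m′} {R} {V} G Q = trans (headOr-at R) (trans (sym (points G z≤n)) (first Q)) ,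
      trans (lastOr-at [] R (length-coarse G)) (trans (sym (points G ℕP.≤-refl))
        (trans (cong (at V) (ℕP.suc-injective (trans (sym (length-fine G)) (length-path Q)))) (last Q)))

    -- One coarse promotion amounts to as many fine ones as the leading step has cells, so row `i`
    -- of the coarse diagram is refined by row `offsets m i` of the fine one.
    iterate : ∀ i → Refines (suc n) (λ j → m (i ℕ.+ j)) (row T i) (row U (offsets m i))
    iterate zero    = F
    iterate (suc i) = subst₂ (λ R V → Refines (suc n) (λ j → m (suc i ℕ.+ j)) R V) coarse fine
        (Refines-cong (λ {j} _ → cong m (ℕP.+-suc i j)) (Promote.promoted Pᵢ (iterate i) (trans (periodic i) (cong m (sym (ℕP.+-identityʳ i))))))
      where
      Pᵢ : Path (suc t) k (row U (offsets m i))
      Pᵢ = row-path (offsets m i)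
      coarse : row (row T i) 1 ≡ row T (suc i)
      coarse = cong₂ (λ a b → nextRow a b (row T i))
        (trans (proj₁ (ends (iterate i) Pᵢ)) (sym (proj₁ (ends F P)))) (trans (proj₂ (ends (iterate i) Pᵢ)) (sym (proj₂ (ends F P))))
      fine : row (row U (offsets m i)) (m (i ℕ.+ 0)) ≡ row U (offsets m (suc i))
      fine = trans (row-+ (offsets m i) (m (i ℕ.+ 0))) (cong (row U) (trans (cong (λ z → m z ℕ.+ offsets m i) (ℕP.+-identityʳ i)) (ℕP.+-comm (m i) (offsets m i))))

    open Evacuation P using (at-V; evac-row)

    m-rev : ℕ → ℕ
    m-rev j = m (n ∸ j)

    offsets-rev : ∀ j → j ≤ suc n → offsets m-rev j ℕ.+ offsets m (suc n ∸ j) ≡ suc t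
    offsets-rev zero    _   = full
    offsets-rev (suc j) j<n = trans (ℕP.+-assoc (offsets m-rev j) (m (n ∸ j)) _)
      (trans (cong (offsets m-rev j ℕ.+_) (trans (ℕP.+-comm (m (n ∸ j)) (offsets m (n ∸ j))) (cong (offsets m) (sym (ℕP.+-∸-assoc 1 (ℕP.≤-pred j<n))))))
        (offsets-rev j (ℕP.<⇒≤ j<n)))

    -- The shapes agree because `iterate` locates each coarse row in the fine diagram. The blocks
    -- ascend because `evacuation U` is the complement of `U` read backwards, and complementation
    -- keeps blocks ascending.
    evacuated : Refines (suc n) m-rev (evacuation T) (evacuation U)
    evacuated = record
      { length-coarse = length-evacuation T (length-coarse F)
      ; length-fine = trans (length-evacuation U (length-path P)) (cong suc (sym (trans (sym (ℕP.+-identityʳ _))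
          (subst (λ z → offsets m-rev (suc n) ℕ.+ offsets m z ≡ suc t) (ℕP.n∸n≡0 n) (offsets-rev (suc n) ℕP.≤-refl)))))
      ; points = λ {j} → point j
      ; blocks = λ {j} → blk j
      }
      where
      point : ∀ j → j ≤ suc n → at (evacuation U) (offsets m-rev j) ≡ at (evacuation T) j
      point j j≤ = trans (at-V y≤) (trans (cong₂ (λ a b → at (row U a) b) row≡ col≡)
        (trans (points (iterate i) j≤) (sym (at-evacuation T (length-coarse F) j≤))))
        where
        i y : ℕ
        i = suc n ∸ j
        y = offsets m-rev j
        y≤ : y ≤ suc t
        y≤ = subst (y ≤_) (offsets-rev j j≤) (ℕP.m≤m+n y _)
        row≡ : suc t ∸ y ≡ offsets m i
        row≡ = trans (cong (_∸ y) (sym (offsets-rev j j≤))) (ℕP.m+n∸m≡n y (offsets m i))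
        col≡ : y ≡ offsets (λ z → m (i ℕ.+ z)) j
        col≡ = ℕP.+-cancelˡ-≡ (offsets m i) _ _ (trans (ℕP.+-comm (offsets m i) y) (trans (offsets-rev j j≤)
          (trans (sym full) (trans (cong (offsets m) (sym (ℕP.m∸n+n≡m j≤))) (offsets-+ m i j)))))
      blk : ∀ j → j < suc n → AscPath (λ x → get (at (evacuation U) (offsets m-rev j ℕ.+ x))) (m-rev j)
      blk j j< = AscPath-resp {λ x → κ k (get (at U (offsets m i ℕ.+ (m i ∸ x))))} mirror
          (DescPath-κ k (AscPath-reverse {λ x → get (at U (offsets m i ℕ.+ x))} (m i) (blocks F (s≤s (ℕP.m∸n≤m n j)))))
        where
        i y : ℕ
        i = n ∸ j
        y = offsets m-rev j
        total : y ℕ.+ (offsets m i ℕ.+ m i) ≡ suc t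
        total = trans (cong (λ z → y ℕ.+ offsets m z) (sym (ℕP.+-∸-assoc 1 (ℕP.≤-pred j<)))) (offsets-rev j (ℕP.<⇒≤ j<))
        mirror : ∀ {x} → x ≤ m i → κ k (get (at U (offsets m i ℕ.+ (m i ∸ x)))) ≐ get (at (evacuation U) (y ℕ.+ x))
        mirror {x} x≤ {p} p<r = sym (trans (evac-row 0 z≤n y+x≤ p<r)
            (cong (λ z → k - z (rev p)) (trans (cong (λ R → get (at R (suc t ∸ (y ℕ.+ x)))) (trans (cong (row U) (sym (ℕP.+-identityʳ (suc t)))) (row-period 0)))
              (cong (λ z → get (at U z)) col))))
          where
          y+x≤ : y ℕ.+ x ≤ suc t
          y+x≤ = subst (y ℕ.+ x ≤_) total (ℕP.+-monoʳ-≤ y (ℕP.≤-trans x≤ (ℕP.m≤n+m (m i) (offsets m i))))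
          col : suc t ∸ (y ℕ.+ x) ≡ offsets m i ℕ.+ (m i ∸ x)
          col = trans (cong (_∸ (y ℕ.+ x)) (sym total)) (trans (ℕP.[m+n]∸[m+o]≡n∸o y _ x) (ℕP.+-∸-assoc (offsets m i) x≤))

  star : ℕ → ℕ
  star i = if i ℕ.≡ᵇ r then 0 else i

  star-≡ : star r ≡ 0
  star-≡ with r ℕ.≡ᵇ r | ℕP.≡⇒≡ᵇ r r refl
  ... | true | _ = refl

  star-≢ : ∀ {i} → i ≢ r → star i ≡ i
  star-≢ {i} ne with i ℕ.≡ᵇ r in eq
  ... | true  = ⊥-elim (ne (ℕP.≡ᵇ⇒≡ i r (subst T (sym eq) tt)))
  ... | false = refl

  star-dual : 0 < r → ∀ {i} → i ≤ r → Dual (star i) (star (r ∸ i))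
  star-dual 0<r {zero}  _   = subst₂ Dual (sym (star-≢ (ℕP.<⇒≢ 0<r))) (sym star-≡) trivial
  star-dual 0<r {suc i} i≤r with suc i ℕ.≟ r
  ... | yes refl = subst₂ Dual (sym star-≡) (sym (trans (cong star (ℕP.n∸n≡0 i)) (star-≢ (ℕP.<⇒≢ 0<r)))) trivial
  ... | no ne = subst₂ Dual (sym (star-≢ ne)) (sym (star-≢ (ℕP.<⇒≢ (ℕP.∸-monoʳ-< {o = 0} (s≤s z≤n) i≤r))))
        (inner (s≤s z≤n) (ℕP.≤∧≢⇒< i≤r ne))

  Claim : List Shape → ℕ → Set
  Claim T i =
    IsPermutation (size T) (Prom r T i)
    × (∀ u v → Prom r T i u v ⇔ Prom r T (r ∸ i) v u)
    × (∀ u v → InT (size T) u → InT (size T) v →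
         Prom r (promotion T) i u v ⇔ Prom r T i (σpow (size T) (absC1 T) u) (σpow (size T) (absC1 T) v))
    × (∀ u v → InT (size T) u → InT (size T) v →
         Prom r (evacuation T) i u v ⇔ Prom r T (r ∸ i) (w₀ (size T) u) (w₀ (size T) v))

  -- Without unit steps the set of indices is empty; the case stands apart because the lemmas on the
  -- diagram take the length in the form `suc t`.
  claim-empty : ∀ T i → size T ≡ 0 → length (std r T) ≡ 1 → Claim T i
  claim-empty T i s≡0 len = ((λ u v p → ⊥-elim (none i p)) , (λ u iu → ⊥-elim (out iu)) , (λ u v v′ p _ → ⊥-elim (none i p)) ,
      (λ u u′ v p _ → ⊥-elim (none i p)) , (λ v iv → ⊥-elim (out iv))) ,
      (λ u v → mk⇔ (λ p → ⊥-elim (none i p)) (λ p → ⊥-elim (none (r ∸ i) p))) ,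
      (λ u v iu _ → ⊥-elim (out iu)) , (λ u v iu _ → ⊥-elim (out iu))
    where
    absurd : ∀ {n u} → n ≡ 0 → ¬ InT n u
    absurd refl (1≤u , u≤0) = ℕP.<⇒≱ 1≤u u≤0
    out : ∀ {u} → ¬ InT (size T) u
    out = absurd s≡0
    none : ∀ i {u v} → ¬ Prom r T i u v
    none _ (iu , _) = absurd (cong (_∸ 1) len) iu

  claim : ∀ {t k n T U} → 0 < r → Path (suc t) k U → Refines (suc n) (weights T) T U → ∀ i → i ≤ r → Claim T i
  claim {t} {k} {n} {T} {U} 0<r P F i i≤r =
      subst₂ (λ s V → IsPermutation s (PromOsc r V (star i))) (sym s≡) (sym std-T) (Prom-Path.isPermutation P d) ,
      (λ u v → subst (λ V → PromOsc r V (star i) u v ⇔ PromOsc r V (star (r ∸ i)) v u) (sym std-T) (inverse⇔ d u v)) ,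
      (λ u v iu iv → subst₂ (λ V W → PromOsc r W (star i) u v ⇔ PromOsc r V (star i) (σpow (size T) (absC1 T) u) (σpow (size T) (absC1 T) v))
        (sym std-T) (sym std-P) (subst (λ s → PromOsc r (row U (m 0)) (star i) u v ⇔ PromOsc r U (star i) (σpow s (m 0) u) (σpow s (m 0) v)) (sym s≡)
          (shift⇔ {star i} (m 0) u v (subst (λ s → InT s u) s≡ iu) (subst (λ s → InT s v) s≡ iv)))) ,
      (λ u v iu iv → subst₂ (λ V W → PromOsc r W (star i) u v ⇔ PromOsc r V (star (r ∸ i)) (w₀ (size T) u) (w₀ (size T) v))
        (sym std-T) (sym std-E) (subst (λ s → PromOsc r (evacuation U) (star i) u v ⇔ PromOsc r U (star (r ∸ i)) (w₀ s u) (w₀ s v)) (sym s≡)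
          (evacuation⇔ d u v (subst (λ s → InT s u) s≡ iu) (subst (λ s → InT s v) s≡ iv))))
    where
    open Prom-Theorems P
    d : Dual (star i) (star (r ∸ i))
    d = star-dual 0<r i≤r
    m : ℕ → ℕ
    -- The weights are extended periodically, as required for iterating promotion; on the steps of
    -- `T` nothing changes.
    m j = weights T (j % suc n)
    Fₘ : Refines (suc n) m T U
    Fₘ = Refines-cong (λ j< → cong (weights T) (sym (m<n⇒m%n≡m j<))) F
    periodic : ∀ j → m (j ℕ.+ suc n) ≡ m j
    periodic j = cong (weights T) ([m+n]%n≡m%n j (suc n))
    module I = Iterate P Fₘ periodic
    s≡ : size T ≡ suc t
    s≡ = trans (size-offsets T (length-coarse F)) (ℕP.suc-injective (trans (sym (length-fine F)) (length-path P)))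
    lengths : ∀ {m′ R V} → Refines (suc n) m′ R V → Path (suc t) k V → ∀ {x} → x ≤ offsets m′ (suc n) → length (at V x) ≡ r
    lengths G Q {x} x≤ = length-shape Q (subst (x ≤_) (ℕP.suc-injective (trans (sym (length-fine G)) (length-path Q))) x≤)
    std-T : std r T ≡ U
    std-T = std-Refines F (lengths F P)
    std-P : std r (promotion T) ≡ row U (m 0)
    std-P = std-Refines (I.iterate 1) (lengths (I.iterate 1) (Rows.row-path P (m 0)))
    std-E : std r (evacuation T) ≡ evacuation U
    std-E = std-Refines I.evacuated (lengths I.evacuated (Evacuation.path-V P))

theorem6p7 : (r : ℕ) → 1 ≤ r → (T : List Shape) →
    IsFluctuatingTableau r T → Rectangular r T →
    (i : ℕ) → i ≤ r →
    IsPermutation (size T) (Prom r T i)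
    × (∀ u v → Prom r T i u v ⇔ Prom r T (r ∸ i) v u)
    × (∀ u v → InT (size T) u → InT (size T) v →
    Prom r (promotion T) i u v
    ⇔ Prom r T i (σpow (size T) (absC1 T) u) (σpow (size T) (absC1 T) v))
    × (∀ u v → InT (size T) u → InT (size T) v →
    Prom r (evacuation T) i u v
    ⇔ Prom r T (r ∸ i) (w₀ (size T) u) (w₀ (size T) v))
theorem6p7 r 1≤r T (good , steps) ((rest , refl) , flat) i i≤r = go (length rest) (offsets (weights T) (length rest)) refl refl
  where
  open Assembly r
  open Oscillization r
  open Standardization r using (std-Refines)
  open Refinements r
  open Diagrams r
  module G = Refinement (refine (zeros r) rest good steps)
  U : List Shape
  U = zeros r ∷ G.rest
  k : ℤ
  -- All entries of the final shape are equal, so its first entry gives the width of the rectangle,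
  -- possibly negative.
  k = get (at T (length rest)) 0
  final : at T (length rest) ≡ replicate r k
  final = constant (trans (cong length (sym (Refines.points G.refines ℕP.≤-refl))) (proj₁ (G.shapes ℕP.≤-refl)))
    (subst (Linked _≡_) (lastOr-at (zeros r) T refl) flat)
  go : ∀ n N → length rest ≡ n → offsets (weights T) (length rest) ≡ N → Claim T i
  go n zero _ N≡0 = claim-empty T i (trans (size-offsets T refl) N≡0)
    (trans (cong length (std-Refines G.refines (λ x≤ → proj₁ (G.shapes x≤)))) (trans (Refines.length-fine G.refines) (cong suc N≡0)))
  go zero    (suc t) n≡ N≡ = ⊥-elim (ℕP.0≢1+n (trans (cong (offsets (weights T)) (sym n≡)) N≡))
  go (suc n) (suc t) n≡ N≡ = claim {t} {k} {n} 1≤r path (subst (λ n → Refines n (weights T) T U) n≡ G.refines) i i≤r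
    where
    path : Path (suc t) k U
    path = record
      { length-path = trans (Refines.length-fine G.refines) (cong suc N≡)
      ; length-shape = λ {j} j≤ → proj₁ (G.shapes (subst (j ≤_) (sym N≡) j≤))
      ; dom = λ {j} j≤ → proj₂ (G.shapes (subst (j ≤_) (sym N≡) j≤))
      ; steps = λ {j} j< → G.steps (subst (suc j ≤_) (sym N≡) j<)
      ; first = refl
      ; last = trans (cong (at U) (sym N≡)) (trans (Refines.points G.refines ℕP.≤-refl) final)
      }
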